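{- For any fixed integer $k$, there exists an algorithm running in $n^{O(k^{5^k})}$ time that decides, given a graph $G$ and $k$ pairs of vertices $(s_1,t_1),\dots,(s_k,t_k)$ of $G$, whether there exist $k$ internally vertex-disjoint paths $P_1,\dots,P_k$ in $G$ such that each $P_i$ is a shortest $(s_i,t_i)$-path.
   Context: Graphs are undirected, and $n$ denotes the number of vertices of $G$. The length of a path is its number of edges, and a shortest $(s,t)$-path is a path between $s$ and $t$ in $G$ of minimum length among all such paths. Paths are internally vertex-disjoint if no internal vertex of one of them is a vertex of another (they may share endpoints). -}

module Defs where

open import Data.Bool.Base using (Bool; true; false; if_then_else_)
open import Data.Fin.Base using (Fin; toℕ)
open import Data.List.Base using (List; []; _∷_; _++_; allFin; concatMap; drop; head; map)
open import Data.List.Membership.Propositional using (_∈_; _∉_)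
open import Data.List.Relation.Unary.Unique.Propositional using (Unique)
open import Data.Maybe.Base using (Maybe; just; nothing; fromMaybe)
open import Data.Nat.Base using (ℕ; zero; suc; _+_; _∸_; _≤_; _≡ᵇ_)
open import Data.Product.Base using (_×_; _,_; proj₁; proj₂; Σ-syntax)
open import Data.Sum.Base using (_⊎_; inj₁; inj₂)
open import Data.Vec.Base using (Vec; lookup; toList)
open import Level using (0ℓ)
open import Relation.Binary.Construct.Closure.ReflexiveTransitive using (Star; ε; _◅_)
open import Relation.Binary.Core using (Rel)
open import Relation.Binary.Definitions using (Decidable; Irreflexive; Symmetric)
open import Relation.Binary.PropositionalEquality using (_≡_; _≢_)
open import Relation.Nullary.Decidable.Core using (does)

------------------------------------------------------------------------
-- Graphs and paths

record Graph (n : ℕ) : Set₁ where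
  field
    _~_      : Rel (Fin n) 0ℓ
    _~?_     : Decidable _~_
    ~-sym    : Symmetric _~_
    ~-irrefl : Irreflexive _≡_ _~_

module _ {n : ℕ} (G : Graph n) where
  open Graph G

  Walk : Rel (Fin n) 0ℓ
  Walk = Star _~_

  walkLength : ∀ {s t} → Walk s t → ℕ
  walkLength ε       = 0
  walkLength (_ ◅ w) = suc (walkLength w)

  walkVertices : ∀ {s t} → Walk s t → List (Fin n)
  walkVertices {s} ε       = s ∷ []
  walkVertices {s} (_ ◅ w) = s ∷ walkVertices w

  record Path (s t : Fin n) : Set where
    field
      walk   : Walk s t
      simple : Unique (walkVertices walk)

    length : ℕ
    length = walkLength walk

    vertices : List (Fin n)
    vertices = walkVertices walk

    Internal : Fin n → Set
    Internal v = v ∈ vertices × v ≢ s × v ≢ t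

  open Path

  IsShortest : ∀ {s t} → Path s t → Set
  IsShortest {s} {t} P = (Q : Path s t) → length P ≤ length Q

  InternallyDisjoint : ∀ {s t s′ t′} → Path s t → Path s′ t′ → Set
  InternallyDisjoint P Q =
    (∀ v → Internal P v → v ∉ vertices Q) ×
    (∀ v → Internal Q v → v ∉ vertices P)

  HasDisjointShortestPaths : ∀ {k} → Vec (Fin n × Fin n) k → Set
  HasDisjointShortestPaths {k} pairs =
    Σ[ P ∈ (∀ (i : Fin k) → Path (proj₁ (lookup pairs i)) (proj₂ (lookup pairs i))) ]
      (∀ i → IsShortest (P i)) ×
      (∀ i j → i ≢ j → InternallyDisjoint (P i) (P j))

------------------------------------------------------------------------
-- Random access machines with unit cost.  The only arithmetic is addition
-- and truncated subtraction, so that cells have at most linearly many bits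
-- in the running time, and running times agree with those of Turing
-- machines up to a polynomial.

-- Arguments a, b, c are addresses of memory cells; l is a position in the
-- program, counted from 0.
data Instr : Set where
  const         : (a m : ℕ) → Instr    -- M[a] := m
  add           : (a b c : ℕ) → Instr  -- M[a] := M[b] + M[c]
  sub           : (a b c : ℕ) → Instr  -- M[a] := M[b] ∸ M[c]
  load          : (a b : ℕ) → Instr    -- M[a] := M[M[b]]
  store         : (a b : ℕ) → Instr    -- M[M[a]] := M[b]
  jump          : (l : ℕ) → Instr
  jumpIfZero    : (a l : ℕ) → Instr    -- if M[a] = 0 then jump to l
  accept reject : Instr

Program : Set
Program = List Instr

Memory : Set
Memory = ℕ → ℕ

_[_≔_] : Memory → ℕ → ℕ → Memory
(M [ a ≔ m ]) b = if b ≡ᵇ a then m else M b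

record Config : Set where
  constructor ⟨_,_⟩
  field
    counter : ℕ
    memory  : Memory

execute : Instr → Config → Config ⊎ Bool
execute (const a m)      ⟨ i , M ⟩ = inj₁ ⟨ suc i , M [ a ≔ m ] ⟩
execute (add a b c)      ⟨ i , M ⟩ = inj₁ ⟨ suc i , M [ a ≔ M b + M c ] ⟩
execute (sub a b c)      ⟨ i , M ⟩ = inj₁ ⟨ suc i , M [ a ≔ M b ∸ M c ] ⟩
execute (load a b)       ⟨ i , M ⟩ = inj₁ ⟨ suc i , M [ a ≔ M (M b) ] ⟩
execute (store a b)      ⟨ i , M ⟩ = inj₁ ⟨ suc i , M [ M a ≔ M b ] ⟩
execute (jump l)         ⟨ i , M ⟩ = inj₁ ⟨ l , M ⟩
execute (jumpIfZero a l) ⟨ i , M ⟩ = inj₁ ⟨ (if M a ≡ᵇ 0 then l else suc i) , M ⟩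
execute accept           _         = inj₂ true
execute reject           _         = inj₂ false

fetch : {A : Set} → List A → ℕ → Maybe A
fetch xs i = head (drop i xs)

-- The answer given within t executed instructions, the final accept or
-- reject included; nothing if there is none.  A program that runs past its
-- last instruction never answers.
run : Program → (t : ℕ) → Config → Maybe Bool
run p zero    c = nothing
run p (suc t) c with fetch p (Config.counter c)
... | nothing  = nothing
... | just ins with execute ins c
...   | inj₁ c′ = run p t c′
...   | inj₂ b  = just b

initial : List ℕ → Config
initial xs = ⟨ 0 , (λ a → fromMaybe 0 (fetch xs a)) ⟩

_on_answers_within_ : Program → List ℕ → Bool → ℕ → Set
p on xs answers b within t = run p t (initial xs) ≡ just b

-- The number of vertices, then s₁, t₁, …, sₖ, tₖ, then the adjacency matrix
-- row by row.
encode : ∀ {n k} → Graph n → Vec (Fin n × Fin n) k → List ℕ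
encode {n} G pairs =
  n ∷ concatMap (λ (s , t) → toℕ s ∷ toℕ t ∷ []) (toList pairs)
    ++ concatMap (λ u → map (λ v → if does (u ~? v) then 1 else 0) (allFin n)) (allFin n)
  where open Graph G

{-# OPTIONS --safe #-}
module Submission where

-- Idea.  Let D be the distance, cut off at n.  Given shortest paths P₁, …, Pₖ
-- and sources s₁, …, sₖ, place a vertex v at the point (D s₁ v, …, D sₖ v).
-- Along Pᵢ the i-th coordinate grows at full speed and the others change by at
-- most one per step, so every affine condition "D sᵢ = ± D sⱼ + c" changes its
-- sign monotonically along Pᵢ.  For each pair i, j three such conditions
-- suffice: if pieces of Pᵢ and Pⱼ on which the signs are constant span
-- intersecting intervals of the metric, then both lie on one of the three
-- lines.  Closing these conditions under composition gives boundedly many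
-- lines in subsets of the coordinates; cutting each Pᵢ wherever a sign changes
-- yields boundedly many segments such that two segments of different paths
-- either have disjoint intervals (and then so do any two shortest paths with
-- the same ends) or follow the distance from a common vertex r.
--
-- Hence the algorithm looks for the ends of the segments and plays a pebble
-- game in which every segment is traversed by a pebble moving away from its r,
-- and, among the pebbles with the same r, only one nearest to r may move.
-- Such pebbles visit a common vertex only if they meet on it, which is
-- forbidden except at common end points of the paths.

open import Defs
open import Data.Bool.Base using (Bool; true; false; if_then_else_)
open import Data.Empty using (⊥; ⊥-elim)
open import Data.Fin.Base using (Fin; zero; suc; toℕ; fromℕ<; fromℕ; inject₁; _↑ˡ_; _↑ʳ_; combine; remQuot; splitAt)
open import Data.List.Base using (List; []; _∷_; _++_; length; map; concatMap; allFin; replicate)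
import Data.List.Properties as List
open import Data.Maybe.Base using (Maybe; just; nothing; fromMaybe; maybe)
open import Data.Nat.Base
open import Data.Nat.Properties
open import Data.Product.Base using (Σ-syntax; ∃; ∃-syntax; _×_; _,_; proj₁; proj₂; uncurry)
open import Data.Sum.Base using (_⊎_; inj₁; inj₂; [_,_]′)
open import Data.Unit.Base using (⊤; tt)
open import Data.Vec.Base as Vec using (Vec; []; _∷_; lookup)
import Data.Fin.Properties as Fin
import Data.Vec.Properties as Vec
open import Function.Base using (_∘_; id; _$_; case_of_)
open import Function.Bundles using (_⇔_; mk⇔; Equivalence)
open import Relation.Binary.PropositionalEquality
open import Relation.Binary.Definitions using (tri<; tri≈; tri>)
open import Relation.Nullary using (¬_; Dec; yes; no; does; contradiction)
open import Data.List.Membership.Propositional using (_∈_; find)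
open import Data.List.Relation.Unary.Any using (here; there)
open import Relation.Binary.Construct.Closure.ReflexiveTransitive using (_◅_; _◅◅_) renaming (ε to halt)
open import Data.Integer.Base as ℤ using (ℤ; -[1+_]) renaming (+_ to ⁺_)
import Data.Integer.Properties as ℤ
import Data.Integer.Tactic.RingSolver as ℤ
open import Data.List.Membership.Propositional.Properties using (∈-concatMap⁺; ∈-concatMap⁻; ∈-allFin; ∈-map⁺; ∈-map⁻; ∈-++⁺ˡ; ∈-++⁺ʳ)
import Data.List.Relation.Unary.Any as Any
open import Data.Nat.ListAction using (sum)
import Data.List.Relation.Unary.All as All
open import Data.List.Relation.Unary.AllPairs using ([]; _∷_)
open import Data.List.Relation.Unary.Unique.Propositional using (Unique)

-- The affine geometry never enters the algorithm. A configuration guesses ends, directions and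
-- references of all segments, and only relations between distances are checked. That an accepted
-- play yields a solution is proved without lines; lines serve only to show that for every solution
-- some guess can be played to the end.
--
-- A line is prolonged in at most 3k² ways, and it has at most k coordinates. This gives k^O(k)
-- lines, hence k^O(k) segments, and a table with n^(6 · segments) cells. The exponent of the
-- running time is a polynomial in these numbers; it is compared with `k ^ (5 ^ k)` only at the end,
-- where the latter wins for every k from 4 on.
--
-- The program may depend on k but not on n. It is written in a language whose loops all run n
-- times, so that its cost can be read off from its syntax. The machine starts with the input in its
-- first cells and offers no free cell whose address is known in advance. Registers are therefore
-- taken from the adjacency matrix itself, and the displaced entries move to its diagonal, where
-- nothing of value is stored.

infix 4 _⊢_↝[_]_

-- Runs of the machine

record _⊢_↝[_]_ (p : Program) (c : Config) (t : ℕ) (c′ : Config) : Set where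
  constructor reach
  field
    -- As `run` says `nothing` when its time is up, an unfinished computation is described by what
    -- any remaining time `s` makes of it. In this form runs compose.
    runs : ∀ s → run p (t + s) c ≡ run p s c′

open _⊢_↝[_]_ public

↝-trans : ∀ {p c c′ c″ t t′} →
          p ⊢ c ↝[ t ] c′ → p ⊢ c′ ↝[ t′ ] c″ → p ⊢ c ↝[ t + t′ ] c″
↝-trans {p} {c} {t = t} {t′} a b .runs s =
  trans (cong (λ z → run p z c) (+-assoc t t′ s)) (trans (runs a (t′ + s)) (runs b s))

↝-at : ∀ {p c t i i′ M} → i ≡ i′ → p ⊢ c ↝[ t ] ⟨ i , M ⟩ → p ⊢ c ↝[ t ] ⟨ i′ , M ⟩
↝-at refl r = r

step : ∀ {p c c′ ins} → fetch p (Config.counter c) ≡ just ins →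
       execute ins c ≡ inj₁ c′ → p ⊢ c ↝[ 1 ] c′
step f e .runs s rewrite f | e = refl

At : Program → ℕ → List Instr → Set
At p i []       = ⊤
At p i (x ∷ xs) = fetch p i ≡ just x × At p (suc i) xs

At-++ : ∀ {p i} xs {ys} → At p i (xs ++ ys) → At p i xs × At p (i + length xs) ys
At-++ {p} {i} []       a       = tt , subst (λ z → At p z _) (sym (+-identityʳ i)) a
At-++ {p} {i} (x ∷ xs) {ys} (f , a) with At-++ xs a
... | b , c = (f , b) , subst (λ z → At p z ys) (sym (+-suc i (length xs))) c

fetch-++ : ∀ {A : Set} (xs {ys} : List A) i → fetch (xs ++ ys) (length xs + i) ≡ fetch ys i
fetch-++ []       i = refl
fetch-++ (x ∷ xs) i = fetch-++ xs i

At-suffix : ∀ xs ys → At (xs ++ ys) (length xs) ys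
At-suffix xs []       = tt
At-suffix xs (y ∷ ys) =
  trans (cong (fetch (xs ++ y ∷ ys)) (sym (+-identityʳ (length xs)))) (fetch-++ xs 0) ,
  subst₂ (λ p i → At p i ys) (List.++-assoc xs (y ∷ []) ys)
    (trans (List.length-++ xs) (+-comm (length xs) 1)) (At-suffix (xs ++ y ∷ []) ys)

≡ᵇ-refl : ∀ a → (a ≡ᵇ a) ≡ true
≡ᵇ-refl zero    = refl
≡ᵇ-refl (suc a) = ≡ᵇ-refl a

≡ᵇ-≢ : ∀ {a b} → a ≢ b → (a ≡ᵇ b) ≡ false
≡ᵇ-≢ {zero}  {zero}  a≢b = contradiction refl a≢b
≡ᵇ-≢ {zero}  {suc b} a≢b = refl
≡ᵇ-≢ {suc a} {zero}  a≢b = refl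
≡ᵇ-≢ {suc a} {suc b} a≢b = ≡ᵇ-≢ (a≢b ∘ cong suc)

≡ᵇ-+ : ∀ c a b → (c + a ≡ᵇ c + b) ≡ (a ≡ᵇ b)
≡ᵇ-+ zero    a b = refl
≡ᵇ-+ (suc c) a b = ≡ᵇ-+ c a b

≔-same : ∀ (M : Memory) a m → (M [ a ≔ m ]) a ≡ m
≔-same M a m rewrite ≡ᵇ-refl a = refl

≔-other : ∀ (M : Memory) {a b} m → b ≢ a → (M [ a ≔ m ]) b ≡ M b
≔-other M m b≢a rewrite ≡ᵇ-≢ b≢a = refl

jump-zero : ∀ {A : Set} {m} {x y : A} → m ≡ 0 → (if m ≡ᵇ 0 then x else y) ≡ x
jump-zero refl = refl

jump-suc : ∀ {A : Set} {m} {x y : A} → m ≢ 0 → (if m ≡ᵇ 0 then x else y) ≡ y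
jump-suc {m = zero}  m≢0 = contradiction refl m≢0
jump-suc {m = suc m} m≢0 = refl

-- A loop language over a heap: semantics, cost and use of registers

Heap : Set
Heap = ℕ → ℕ

-- There are no branches and every loop runs exactly n times, so the cost depends on the syntax and
-- on n, never on the heap. Products with n and bounded quantifiers are both expressed by `sum<n`.
data Expr (V : ℕ) : Set where
  var     : Fin V → Expr V
  con     : ℕ → Expr V
  _⊕_ _⊖_ : Expr V → Expr V → Expr V
  get     : Expr V → Expr V
  sum<n   : Expr (suc V) → Expr V

data Stmt (V : ℕ) : Set where
  skip  : Stmt V
  put   : Expr V → Expr V → Stmt V
  _⨾_   : Stmt V → Stmt V → Stmt V
  for<n : Stmt (suc V) → Stmt V

infixl 6 _⊕_ _⊖_
infixr 5 _⨾_

∑ : ℕ → (ℕ → ℕ) → ℕ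
∑ zero    f = 0
∑ (suc m) f = ∑ m f + f m

iterate : ∀ {A : Set} → ℕ → (ℕ → A → A) → A → A
iterate zero    f a = a
iterate (suc m) f a = f m (iterate m f a)

module Semantics (n : ℕ) where

  ⟦_⟧ : ∀ {V} → Expr V → Vec ℕ V → Heap → ℕ
  ⟦ var x ⟧   ε h = lookup ε x
  ⟦ con m ⟧   ε h = m
  ⟦ a ⊕ b ⟧   ε h = ⟦ a ⟧ ε h + ⟦ b ⟧ ε h
  ⟦ a ⊖ b ⟧   ε h = ⟦ a ⟧ ε h ∸ ⟦ b ⟧ ε h
  ⟦ get a ⟧   ε h = h (⟦ a ⟧ ε h)
  ⟦ sum<n a ⟧ ε h = ∑ n (λ x → ⟦ a ⟧ (x ∷ ε) h)

  exec : ∀ {V} → Stmt V → Vec ℕ V → Heap → Heap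
  exec skip      ε h = h
  exec (put a b) ε h = h [ ⟦ a ⟧ ε h ≔ ⟦ b ⟧ ε h ]
  exec (s ⨾ t)   ε h = exec t ε (exec s ε h)
  exec (for<n s) ε h = iterate n (λ x → exec s (x ∷ ε)) h

  costₑ : ∀ {V} → Expr V → ℕ
  costₑ (var x)   = 2
  costₑ (con m)   = 1
  costₑ (a ⊕ b)   = costₑ a + (costₑ b + 1)
  costₑ (a ⊖ b)   = costₑ a + (costₑ b + 1)
  costₑ (get a)   = costₑ a + 2
  costₑ (sum<n a) = 2 + (n * (2 + (costₑ a + 3)) + 2)

  cost : ∀ {V} → Stmt V → ℕ
  cost skip      = 0
  cost (put a b) = costₑ a + (costₑ b + 2)
  cost (s ⨾ t)   = cost s + cost t
  cost (for<n s) = 1 + (n * (2 + (cost s + 2)) + 2)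

-- Counts the registers occupied from the base d upwards. The second operand is evaluated one
-- register higher, and a loop sets aside two registers before its body.
heightₑ : ∀ {V} → Expr V → ℕ
heightₑ (var x)   = 1
heightₑ (con m)   = 1
heightₑ (a ⊕ b)   = heightₑ a ⊔ suc (heightₑ b)
heightₑ (a ⊖ b)   = heightₑ a ⊔ suc (heightₑ b)
heightₑ (get a)   = heightₑ a
heightₑ (sum<n a) = 2 + heightₑ a

height : ∀ {V} → Stmt V → ℕ
height skip      = 0
height (put a b) = heightₑ a ⊔ suc (heightₑ b)
height (s ⨾ t)   = height s ⊔ height t
height (for<n s) = 2 + height s

-- Compilation of the loop language

-- Cell 0 holds n and the cells one and hc hold 1 and H; heap cell x has
-- address H + x, and the registers from d up to H are free.
module Compile (one hc : ℕ) where

  -- The last argument is the position at which the code will stand, since jumps are absolute. The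
  -- value is left in register d. Copying a register takes two instructions, a reset to 0 and an
  -- addition.
  compₑ : ∀ {V} → Expr V → Vec ℕ V → ℕ → ℕ → List Instr
  compₑ (var x) γ d i = const d 0 ∷ add d d (lookup γ x) ∷ []
  compₑ (con m) γ d i = const d m ∷ []
  compₑ (a ⊕ b) γ d i =
    let ca = compₑ a γ d i in
    ca ++ compₑ b γ (suc d) (i + length ca) ++ add d d (suc d) ∷ []
  compₑ (a ⊖ b) γ d i =
    let ca = compₑ a γ d i in
    ca ++ compₑ b γ (suc d) (i + length ca) ++ sub d d (suc d) ∷ []
  compₑ (get a) γ d i = compₑ a γ d i ++ add d d hc ∷ load d d ∷ []
  compₑ (sum<n a) γ d i =
    let ca = compₑ a (suc d ∷ γ) (2 + d) (4 + i) in
    const d 0 ∷ const (suc d) 0 ∷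
    sub (2 + d) 0 (suc d) ∷ jumpIfZero (2 + d) (4 + i + length ca + 3) ∷
    ca ++ add d d (2 + d) ∷ add (suc d) (suc d) one ∷ jump (2 + i) ∷ []

  comp : ∀ {V} → Stmt V → Vec ℕ V → ℕ → ℕ → List Instr
  comp skip      γ d i = []
  comp (put a b) γ d i =
    let ca = compₑ a γ d i in
    ca ++ compₑ b γ (suc d) (i + length ca) ++ add d d hc ∷ store d (suc d) ∷ []
  comp (s ⨾ t) γ d i = let cs = comp s γ d i in cs ++ comp t γ d (i + length cs)
  comp (for<n s) γ d i =
    let cs = comp s (d ∷ γ) (2 + d) (3 + i) in
    const d 0 ∷ sub (suc d) 0 d ∷ jumpIfZero (suc d) (3 + i + length cs + 2) ∷
    cs ++ add d d one ∷ jump (1 + i) ∷ []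

  module _ (p : Program) (n H : ℕ) where
    open Semantics n

    record Regs {V} (γ : Vec ℕ V) (d : ℕ) (ε : Vec ℕ V) (h : Heap) (M : Memory) : Set where
      field
        0<d   : 0 < d
        one<d : one < d
        hc<d  : hc < d
        M0    : M 0 ≡ n
        M1    : M one ≡ 1
        MH    : M hc ≡ H
        γ<d   : ∀ x → lookup γ x < d
        vars  : ∀ x → M (lookup γ x) ≡ lookup ε x
        heap  : ∀ x → M (H + x) ≡ h x

    Same : ℕ → Memory → Memory → Set
    Same d M M′ = ∀ a → a < d → M′ a ≡ M a

    module _ {V : ℕ} {γ : Vec ℕ V} {d : ℕ} {ε : Vec ℕ V} {h : Heap} {M : Memory} where

      Regs-same : ∀ {h′ M′} → Same d M M′ → (∀ x → M′ (H + x) ≡ h′ x) →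
                  Regs γ d ε h M → Regs γ d ε h′ M′
      Regs-same s hp R = record
        { 0<d = 0<d ; one<d = one<d ; hc<d = hc<d
        ; M0 = trans (s _ 0<d) M0 ; M1 = trans (s _ one<d) M1 ; MH = trans (s _ hc<d) MH
        ; γ<d = γ<d ; vars = λ x → trans (s _ (γ<d x)) (vars x) ; heap = hp }
        where open Regs R

      Regs-up : ∀ {d′} → d ≤ d′ → Regs γ d ε h M → Regs γ d′ ε h M
      Regs-up l R = record
        { 0<d = <-≤-trans 0<d l ; one<d = <-≤-trans one<d l ; hc<d = <-≤-trans hc<d l
        ; M0 = M0 ; M1 = M1 ; MH = MH ; γ<d = λ x → <-≤-trans (γ<d x) l
        ; vars = vars ; heap = heap }
        where open Regs R

      Regs-∷ : ∀ {c x} → c < d → M c ≡ x → Regs γ d ε h M → Regs (c ∷ γ) d (x ∷ ε) h M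
      Regs-∷ c<d e R = record
        { 0<d = 0<d ; one<d = one<d ; hc<d = hc<d ; M0 = M0 ; M1 = M1 ; MH = MH
        ; γ<d = λ { zero → c<d ; (suc x) → γ<d x }
        ; vars = λ { zero → e ; (suc x) → vars x } ; heap = heap }
        where open Regs R

    Same-trans : ∀ {d M M′ M″} → Same d M M′ → Same d M′ M″ → Same d M M″
    Same-trans s t a l = trans (t a l) (s a l)

    Same-≔ : ∀ {d M a m} → d ≤ a → Same d M (M [ a ≔ m ])
    Same-≔ {M = M} {m = m} d≤a b b<d = ≔-other M m (<⇒≢ (<-≤-trans b<d d≤a))

    Same-down : ∀ {d d′ M M′} → d ≤ d′ → Same d′ M M′ → Same d M M′
    Same-down l s a a<d = s a (<-≤-trans a<d l)

    -- A Hoare triple with a frame condition: the registers below d, which hold constants, loop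
    -- counters and pending operands, survive.
    record Result (i : ℕ) (M : Memory) (t i′ d : ℕ) (h : Heap) (P : Memory → Set) : Set where
      constructor result
      field
        M′    : Memory
        steps : p ⊢ ⟨ i , M ⟩ ↝[ t ] ⟨ i′ , M′ ⟩
        same  : Same d M M′
        heap′ : ∀ x → M′ (H + x) ≡ h x
        post  : P M′

    infixl 1 _>>=_
    _>>=_ : ∀ {i M t i′ d h P t′ i″ h′ Q} → Result i M t i′ d h P →
            (∀ {M′} → Same d M M′ → (∀ x → M′ (H + x) ≡ h x) → P M′ → Result i′ M′ t′ i″ d h′ Q) →
            Result i M (t + t′) i″ d h′ Q
    result M′ st sm hp po >>= f with f sm hp po
    ... | result M″ st′ sm′ hp′ po′ = result M″ (↝-trans st st′) (Same-trans sm sm′) hp′ po′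

    cast : ∀ {i M t i′ d h P t′ i″} → t ≡ t′ → i′ ≡ i″ → Result i M t i′ d h P → Result i M t′ i″ d h P
    cast refl refl r = r

    weaken : ∀ {i M t i′ d d′ h P Q} → d ≤ d′ → (∀ {M′} → Same d′ M M′ → P M′ → Q M′) →
             Result i M t i′ d′ h P → Result i M t i′ d h Q
    weaken l f (result M′ st sm hp po) = result M′ st (Same-down l sm) hp (f sm po)

    write : ∀ {i ins M a m d h} → fetch p i ≡ just ins →
            execute ins ⟨ i , M ⟩ ≡ inj₁ ⟨ suc i , M [ a ≔ m ] ⟩ → d ≤ a → a < H →
            (∀ x → M (H + x) ≡ h x) →
            Result i M 1 (suc i) d h (λ M′ → M′ ≡ M [ a ≔ m ])
    write {M = M} {a} {m} f e d≤a a<H hp = result _ (step f e) (Same-≔ d≤a)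
      (λ x → trans (≔-other M m (≢-sym (<⇒≢ (<-≤-trans a<H (m≤m+n H x))))) (hp x)) refl

    goto : ∀ {i ins M i′ d h} → fetch p i ≡ just ins →
           execute ins ⟨ i , M ⟩ ≡ inj₁ ⟨ i′ , M ⟩ →
           (∀ x → M (H + x) ≡ h x) → Result i M 1 i′ d h (λ M′ → M′ ≡ M)
    goto f e hp = result _ (step f e) (λ _ _ → refl) hp refl

    private
      room : ∀ {d m} → d + suc m ≤ H → d < H
      room {d} {m} l = <-≤-trans (≤-trans (s≤s (m≤m+n d m)) (≤-reflexive (sym (+-suc d m)))) l

      height>0 : ∀ {V} (e : Expr V) → 0 < heightₑ e
      height>0 (var x)   = s≤s z≤n
      height>0 (con x)   = s≤s z≤n
      height>0 (a ⊕ b)   = ≤-trans (height>0 a) (m≤m⊔n (heightₑ a) (suc (heightₑ b)))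
      height>0 (a ⊖ b)   = ≤-trans (height>0 a) (m≤m⊔n (heightₑ a) (suc (heightₑ b)))
      height>0 (get a)   = height>0 a
      height>0 (sum<n a) = s≤s z≤n

      height-room : ∀ {V d} (e : Expr V) → d + heightₑ e ≤ H → d < H
      height-room {d = d} e l = <-≤-trans (m<m+n d (height>0 e)) l

      left : ∀ {d} a b → d + (a ⊔ suc b) ≤ H → d + a ≤ H
      left {d} a b = ≤-trans (+-monoʳ-≤ d (m≤m⊔n a (suc b)))

      right : ∀ {d} a b → d + (a ⊔ suc b) ≤ H → suc d + b ≤ H
      right {d} a b l = ≤-trans (≤-reflexive (sym (+-suc d b))) (≤-trans (+-monoʳ-≤ d (m≤n⊔m a (suc b))) l)

      inner : ∀ d a → d + (2 + a) ≤ H → 2 + d + a ≤ H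
      inner d a = subst (_≤ H) (trans (+-suc d (suc a)) (cong suc (+-suc d a)))

      ∸-monus : ∀ x r → x + suc r ∸ x ≢ 0
      ∸-monus x r e with trans (sym (m+n∸m≡n x (suc r))) e
      ... | ()

    module _ {V} (op : Expr V → Expr V → Expr V) (_∙_ : ℕ → ℕ → ℕ) (ins : ℕ → ℕ → ℕ → Instr)
             (ex : ∀ a b c i M → execute (ins a b c) ⟨ i , M ⟩ ≡ inj₁ ⟨ suc i , M [ a ≔ M b ∙ M c ] ⟩) where

      binary : ∀ {a b : Expr V} {γ d ε h M i} (ca cb : List Instr) →
               At p i (ca ++ cb ++ ins d d (suc d) ∷ []) →
               Regs γ d ε h M → suc d < H →
               (At p i ca → Result i M (costₑ a) (i + length ca) d h (λ M′ → M′ d ≡ ⟦ a ⟧ ε h)) →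
               (∀ {M′} → At p (i + length ca) cb → Regs γ (suc d) ε h M′ →
                 Result (i + length ca) M′ (costₑ b) (i + length ca + length cb) (suc d) h
                   (λ M″ → M″ (suc d) ≡ ⟦ b ⟧ ε h)) →
               Result i M (costₑ a + (costₑ b + 1)) (i + length (ca ++ cb ++ ins d d (suc d) ∷ [])) d h
                 (λ M′ → M′ d ≡ ⟦ a ⟧ ε h ∙ ⟦ b ⟧ ε h)
      binary {a} {b} {d = d} {ε} {h} {i = i} ca cb at R sd<H ra rb =
        cast refl pos
          (ra ata >>= λ sm hp da →
           weaken (n≤1+n d) (λ sm′ db → trans (sm′ d ≤-refl) da , db)
             (rb atb (Regs-up (n≤1+n d) (Regs-same sm hp R))) >>= λ {M″} sm′ hp′ (da , db) →
           weaken ≤-refl (λ { _ refl → trans (≔-same M″ d _) (cong₂ _∙_ da db) })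
             (write ato (ex d d (suc d) _ M″) ≤-refl (<-trans (n<1+n d) sd<H) hp′))
        where
          ata = proj₁ (At-++ ca at)
          at′ = At-++ cb (proj₂ (At-++ ca at))
          atb = proj₁ at′
          ato = proj₁ (proj₂ at′)
          pos : suc (i + length ca + length cb) ≡ i + length (ca ++ cb ++ ins d d (suc d) ∷ [])
          pos = sym (trans (cong (i +_) (trans (List.length-++ ca)
                  (cong (length ca +_) (trans (List.length-++ cb) (+-comm (length cb) 1)))))
                  (trans (cong (i +_) (+-suc (length ca) (length cb)))
                  (trans (+-suc i _) (cong suc (sym (+-assoc i (length ca) (length cb)))))))

    module _ {c d L E b : ℕ} (hs : ℕ → Heap) (I : ℕ → Memory → Set)
             (test : fetch p L ≡ just (sub (suc c) 0 c))
             (exit : fetch p (suc L) ≡ just (jumpIfZero (suc c) E))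
             (d≤c : d ≤ c) (c<H : suc c < H)
             (stable : ∀ {x M m} → I x M → I x (M [ suc c ≔ m ]))
             (counter : ∀ {x M} → I x M → M c ≡ x × M 0 ≡ n)
             (body : ∀ {x M} → I x M → (∀ y → M (H + y) ≡ hs x y) →
                     Result (2 + L) M b L d (hs (suc x)) (I (suc x))) where

      private
        d≤1+c = ≤-trans d≤c (n≤1+n c)

        diff : ∀ {x M} → I x M → M 0 ∸ M c ≡ n ∸ x
        diff ix = cong₂ _∸_ (proj₂ (counter ix)) (proj₁ (counter ix))

        leave : ∀ {x M} → x ≡ n → I x M → (∀ y → M (H + y) ≡ hs x y) →
                Result L M 2 E d (hs n) (I n)
        leave {M = M} refl ix hp =
          write {m = M 0 ∸ M c} test refl d≤1+c c<H hp >>= λ { sm hp′ refl →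
          weaken ≤-refl (λ { _ refl → stable ix })
            (goto exit (cong (λ z → inj₁ ⟨ z , _ ⟩)
              (jump-zero (trans (≔-same M (suc c) _) (trans (diff ix) (n∸n≡0 n))))) hp′) }

      -- Induction on the rounds r still to come. The test register receives `n ∸ x`, which is zero
      -- exactly when r is; `stable` says that the invariant tolerates this write.
      loop : ∀ r {x M} → x + r ≡ n → I x M → (∀ y → M (H + y) ≡ hs x y) →
             Result L M (r * (2 + b) + 2) E d (hs n) (I n)
      loop zero    {x} e ix hp = leave (trans (sym (+-identityʳ x)) e) ix hp
      loop (suc r) {x} {M} e ix hp = cast (cong (λ z → suc (suc z)) (sym (+-assoc b _ 2))) refl
        (write {m = M 0 ∸ M c} test refl d≤1+c c<H hp >>= λ { sm hp′ refl →
         goto exit (cong (λ z → inj₁ ⟨ z , _ ⟩)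
           (jump-suc (λ z → ∸-monus x r (trans (cong (_∸ x) e)
             (trans (sym (diff ix)) (trans (sym (≔-same M (suc c) _)) z)))))) hp′ >>= λ { sm′ hp″ refl →
         body (stable ix) hp″ >>= λ sm″ hp‴ ix′ →
         loop r (trans (sym (+-suc x r)) e) ix′ hp‴ } })

    correctₑ : ∀ {V} (e : Expr V) {γ d ε h M i} → At p i (compₑ e γ d i) → Regs γ d ε h M →
               d + heightₑ e ≤ H →
               Result i M (costₑ e) (i + length (compₑ e γ d i)) d h (λ M′ → M′ d ≡ ⟦ e ⟧ ε h)
    correctₑ (var x) {γ} {d} {M = M} {i} at R l = cast refl (+-comm 2 i)
      (write (proj₁ at) refl ≤-refl (room l) heap >>= λ { {M′} sm hp refl →
       weaken ≤-refl (λ { _ refl → trans (≔-same M′ d _)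
         (trans (cong₂ _+_ (≔-same M d 0) (sm _ (γ<d x))) (vars x)) })
         (write {m = M′ d + M′ (lookup γ x)} (proj₁ (proj₂ at)) refl ≤-refl (room l) hp) })
      where open Regs R
    correctₑ (con m) {d = d} {M = M} {i} at R l = cast refl (+-comm 1 i)
      (weaken ≤-refl (λ { _ refl → ≔-same M d m })
        (write (proj₁ at) refl ≤-refl (room l) (Regs.heap R)))
    correctₑ (a ⊕ b) {γ} {d} {i = i} at R l =
      binary _⊕_ _+_ add (λ _ _ _ _ _ → refl) {a} {b} (compₑ a γ d i) _ at R
        (height-room b (right (heightₑ a) _ l))
        (λ at′ → correctₑ a at′ R (left (heightₑ a) _ l))
        (λ at′ R′ → correctₑ b at′ R′ (right (heightₑ a) _ l))
    correctₑ (a ⊖ b) {γ} {d} {i = i} at R l =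
      binary _⊖_ _∸_ sub (λ _ _ _ _ _ → refl) {a} {b} (compₑ a γ d i) _ at R
        (height-room b (right (heightₑ a) _ l))
        (λ at′ → correctₑ a at′ R (left (heightₑ a) _ l))
        (λ at′ R′ → correctₑ b at′ R′ (right (heightₑ a) _ l))
    correctₑ (get a) {γ} {d} {ε} {h} {i = i} at R l = cast refl pos
      (correctₑ a (proj₁ at′) R l >>= λ {M′} sm hp da →
       (write {m = M′ d + M′ hc} (proj₁ (proj₂ at′)) refl ≤-refl d<H hp >>= λ { sm′ hp′ refl →
        weaken ≤-refl (λ { _ refl → trans (≔-same (M′ [ d ≔ M′ d + M′ hc ]) d _)
          (trans (cong (M′ [ d ≔ M′ d + M′ hc ]) (trans (≔-same M′ d _)
            (trans (cong₂ _+_ da (trans (sm _ hc<d) MH)) (+-comm _ H))))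
            (hp′ _)) })
        (write {m = (M′ [ d ≔ M′ d + M′ hc ]) ((M′ [ d ≔ M′ d + M′ hc ]) d)}
          (proj₁ (proj₂ (proj₂ at′))) refl ≤-refl d<H hp′) }))
      where
        open Regs R
        d<H = height-room a l
        ca = compₑ a γ d i
        at′ = At-++ ca at
        pos : 2 + (i + length ca) ≡ i + length (ca ++ add d d hc ∷ load d d ∷ [])
        pos = sym (trans (cong (i +_) (trans (List.length-++ ca) (+-comm (length ca) 2)))
                (trans (+-suc i _) (cong suc (+-suc i _))))
    correctₑ (sum<n a) {γ} {d} {ε} {h} {M} {i} at R l = cast refl pos
      (write (proj₁ at) refl ≤-refl d<H heap >>= λ { sm hp refl →
       write (proj₁ (proj₂ at)) refl d≤1+d 1+d<H hp >>= λ { sm′ hp′ refl →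
       weaken ≤-refl (λ _ → λ { (_ , _ , e) → e })
         (loop (λ _ → h) I (proj₁ at₂) (proj₁ (proj₂ at₂)) d≤1+d 2+d<H
           (λ { {M = N} (s , c , e) → Same-trans s (Same-≔ (≤-trans d≤1+d (n≤1+n _))) ,
             trans (≔-other N _ (<⇒≢ ≤-refl)) c , trans (≔-other N _ (<⇒≢ (s≤s d≤1+d))) e })
           (λ { (s , c , e) → c , trans (s 0 0<d) M0 })
           body n refl
           (Same-trans sm sm′ , ≔-same (M [ d ≔ 0 ]) (suc d) 0 ,
            trans (≔-other (M [ d ≔ 0 ]) 0 (<⇒≢ ≤-refl)) (≔-same M d 0)) hp′) } })
      where
        open Regs R
        l′ = inner d (heightₑ a) l
        2+d<H = height-room a l′
        1+d<H = <-trans ≤-refl 2+d<H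
        d<H = <-trans ≤-refl 1+d<H
        d≤1+d = n≤1+n d
        ca = compₑ a (suc d ∷ γ) (2 + d) (4 + i)
        at₂ = proj₂ (proj₂ at)
        at₃ = At-++ ca (proj₂ (proj₂ at₂))
        I : ℕ → Memory → Set
        I x N = Same d M N × N (suc d) ≡ x × N d ≡ ∑ x (λ y → ⟦ a ⟧ (y ∷ ε) h)
        pos : 4 + i + length ca + 3 ≡
              i + length (compₑ (sum<n a) γ d i)
        pos = sym (trans (cong (λ z → i + (4 + z)) (List.length-++ ca))
                (trans (sym (+-assoc i 4 _)) (trans (cong (_+ (length ca + 3)) (+-comm i 4))
                (sym (+-assoc (4 + i) (length ca) 3)))))
        body : ∀ {x N} → I x N → (∀ y → N (H + y) ≡ h y) →
               Result (4 + i) N (costₑ a + 3) (2 + i) d h (I (suc x))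
        body {x} {N} (s , c , e) hp =
          weaken (≤-trans d≤1+d (n≤1+n _)) (λ sm da → sm , da)
            (correctₑ a (proj₁ at₃)
              (Regs-∷ ≤-refl c (Regs-up (≤-trans d≤1+d (n≤1+n _)) (Regs-same s hp R))) l′)
          >>= λ { {N₁} sm₁ hp₁ (sm₁′ , v) →
          write {m = N₁ d + N₁ (2 + d)} (proj₁ (proj₂ at₃)) refl ≤-refl d<H hp₁
          >>= λ { sm₂ hp₂ refl →
          write {M = N₁ [ d ≔ _ ]} {m = (N₁ [ d ≔ N₁ d + N₁ (2 + d) ]) (suc d) + (N₁ [ d ≔ N₁ d + N₁ (2 + d) ]) one}
            (proj₁ (proj₂ (proj₂ at₃))) refl d≤1+d 1+d<H hp₂
          >>= λ { sm₃ hp₃ refl →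
          weaken ≤-refl (λ { _ refl →
            Same-trans s (Same-trans sm₁ (Same-trans sm₂ sm₃)) ,
            trans (≔-same (N₁ [ d ≔ N₁ d + N₁ (2 + d) ]) (suc d) _)
              (trans (cong₂ _+_ (trans (≔-other N₁ _ (≢-sym (<⇒≢ ≤-refl))) (trans (sm₁′ _ ≤-refl) c))
                (trans (≔-other N₁ _ (<⇒≢ one<d)) (trans (sm₁ _ one<d) (trans (s _ one<d) M1)))) (+-comm x 1)) ,
            trans (≔-other (N₁ [ d ≔ N₁ d + N₁ (2 + d) ]) _ (<⇒≢ ≤-refl))
              (trans (≔-same N₁ d _) (cong₂ _+_ (trans (sm₁′ d (s≤s d≤1+d)) e) v)) })
            (goto (proj₁ (proj₂ (proj₂ (proj₂ at₃)))) refl hp₃) } } }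

    correct : ∀ {V} (s : Stmt V) {γ d ε h M i} → At p i (comp s γ d i) → Regs γ d ε h M →
              d + height s ≤ H →
              Result i M (cost s) (i + length (comp s γ d i)) d (exec s ε h) (λ _ → ⊤)
    correct skip {M = M} {i} at R l =
      cast refl (sym (+-identityʳ i)) (result M (reach λ s → refl) (λ _ _ → refl) (Regs.heap R) tt)
    correct (put a b) {γ} {d} {ε} {h} {M} {i} at R l = cast refl pos
      (correctₑ a (proj₁ at₁) R (left (heightₑ a) _ l) >>= λ sm₁ hp₁ da →
       weaken (n≤1+n d) (λ sm db → trans (sm d ≤-refl) da , db)
         (correctₑ b (proj₁ at₂) (Regs-up (n≤1+n d) (Regs-same sm₁ hp₁ R)) (right (heightₑ a) _ l))
       >>= λ { {N} sm₂ hp₂ (da′ , db) →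
       write {m = N d + N hc} (proj₁ (proj₂ at₂)) refl ≤-refl d<H hp₂ >>= λ { sm₃ hp₃ refl →
       let N′ = N [ d ≔ N d + N hc ]
           addr : N′ d ≡ H + ⟦ a ⟧ ε h
           addr = trans (≔-same N d _) (trans (cong₂ _+_ da′ (trans (sm₂ _ hc<d) (trans (sm₁ _ hc<d) MH))) (+-comm _ H))
           val : N′ (suc d) ≡ ⟦ b ⟧ ε h
           val = trans (≔-other N _ (≢-sym (<⇒≢ ≤-refl))) db
       in
       result (N′ [ N′ d ≔ N′ (suc d) ]) (step (proj₁ (proj₂ (proj₂ at₂))) refl)
         (λ x x<d → ≔-other N′ _ (<⇒≢ (<-≤-trans (<-trans x<d d<H) (≤-trans (m≤m+n H _) (≤-reflexive (sym addr))))))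
         (λ x → trans (cong₂ (λ y z → (N′ [ y ≔ z ]) (H + x)) addr val)
           (trans (cong (λ z → if z then ⟦ b ⟧ ε h else N′ (H + x)) (≡ᵇ-+ H x _))
             (cong (λ z → if x ≡ᵇ ⟦ a ⟧ ε h then ⟦ b ⟧ ε h else z) (hp₃ x)))) tt } })
      where
        open Regs R
        d<H = <-trans ≤-refl (height-room b (right (heightₑ a) _ l))
        ca = compₑ a γ d i
        cb = compₑ b γ (suc d) (i + length ca)
        at₁ = At-++ ca at
        at₂ = At-++ cb (proj₂ at₁)
        pos : 2 + (i + length ca + length cb) ≡ i + length (comp (put a b) γ d i)
        pos = sym (trans (cong (i +_) (trans (List.length-++ ca)
                  (trans (cong (length ca +_) (trans (List.length-++ cb) (+-comm (length cb) 2)))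
                  (trans (+-suc (length ca) _) (cong suc (+-suc (length ca) _))))))
                  (trans (+-suc i _) (cong suc (trans (+-suc i _) (cong suc (sym (+-assoc i (length ca) (length cb))))))))
    correct (s ⨾ t) {γ} {d} {i = i} at R l = cast refl
      (trans (+-assoc i (length cs) _) (cong (i +_) (sym (List.length-++ cs))))
      (correct s (proj₁ at₁) R (≤-trans (+-monoʳ-≤ d (m≤m⊔n (height s) _)) l) >>= λ sm hp _ →
       correct t (proj₂ at₁) (Regs-same sm hp R) (≤-trans (+-monoʳ-≤ d (m≤n⊔m (height s) _)) l))
      where
        cs = comp s γ d i
        at₁ = At-++ cs at
    correct (for<n s) {γ} {d} {ε} {h} {M} {i} at R l = cast refl pos
      (write (proj₁ at) refl ≤-refl d<H heap >>= λ { sm hp refl →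
       weaken ≤-refl (λ _ _ → tt)
         (loop hs I (proj₁ (proj₂ at)) (proj₁ (proj₂ (proj₂ at))) ≤-refl 1+d<H
           (λ { {M = N} (s , c) → Same-trans s (Same-≔ d≤1+d) , trans (≔-other N _ (<⇒≢ ≤-refl)) c })
           (λ { (s , c) → c , trans (s 0 0<d) M0 })
           body n refl (sm , ≔-same M d 0) hp) })
      where
        open Regs R
        l′ = inner d (height s) l
        1+d<H : suc d < H
        1+d<H = ≤-trans (m≤m+n (2 + d) (height s)) l′
        d<H = <-trans ≤-refl 1+d<H
        d≤1+d = n≤1+n d
        cs = comp s (d ∷ γ) (2 + d) (3 + i)
        at₃ = At-++ cs (proj₂ (proj₂ (proj₂ at)))
        hs : ℕ → Heap
        hs x = iterate x (λ y → exec s (y ∷ ε)) h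
        I : ℕ → Memory → Set
        I x N = Same d M N × N d ≡ x
        pos : 3 + i + length cs + 2 ≡ i + length (comp (for<n s) γ d i)
        pos = sym (trans (cong (λ z → i + (3 + z)) (List.length-++ cs))
                (trans (sym (+-assoc i 3 _)) (trans (cong (_+ (length cs + 2)) (+-comm i 3))
                (sym (+-assoc (3 + i) (length cs) 2)))))
        body : ∀ {x N} → I x N → (∀ y → N (H + y) ≡ hs x y) →
               Result (3 + i) N (cost s + 2) (1 + i) d (hs (suc x)) (I (suc x))
        body {x} {N} (sm , c) hp =
          weaken (≤-trans d≤1+d (n≤1+n _)) (λ sm _ → sm)
            (correct s (proj₁ at₃)
              (Regs-up (n≤1+n (suc d)) (Regs-∷ ≤-refl c (Regs-up d≤1+d (Regs-same sm hp R)))) l′)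
          >>= λ { {N₁} sm₁ hp₁ sm₁′ →
          write {m = N₁ d + N₁ one} (proj₁ (proj₂ at₃)) refl ≤-refl d<H hp₁ >>= λ { sm₂ hp₂ refl →
          weaken ≤-refl (λ { _ refl → Same-trans sm (Same-trans sm₁ sm₂) ,
            trans (≔-same N₁ d _) (trans (cong₂ _+_ (trans (sm₁′ d (s≤s d≤1+d)) c)
              (trans (sm₁ _ one<d) (trans (sm _ one<d) M1))) (+-comm x 1)) })
            (goto (proj₁ (proj₂ (proj₂ at₃))) refl hp₂) } }

-- The encoded input as memory

flat : ∀ {A : Set} {k} → Vec (A × A) k → Vec A (k * 2)
flat []             = []
flat ((s , t) ∷ ps) = s ∷ t ∷ flat ps

fetch-toList : ∀ {A : Set} {m} (v : Vec A m) {ys} (i : Fin m) →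
               fetch (Vec.toList v ++ ys) (toℕ i) ≡ just (lookup v i)
fetch-toList (x ∷ v) zero    = refl
fetch-toList (x ∷ v) (suc i) = fetch-toList v i

fetch-tabulate : ∀ {A : Set} {m} (f : Fin m → A) {ys} (i : Fin m) →
                 fetch (Data.List.Base.tabulate f ++ ys) (toℕ i) ≡ just (f i)
fetch-tabulate f zero    = refl
fetch-tabulate f (suc i) = fetch-tabulate (f ∘ suc) i

fetch-rows : ∀ {A B : Set} {m n} (g : B → Fin n → A) (f : Fin m → B) i j →
  fetch (concatMap (λ u → map (g u) (allFin n)) (Data.List.Base.tabulate f)) (toℕ i * n + toℕ j) ≡ just (g (f i) j)
fetch-rows {n = n} g f zero j rewrite List.map-tabulate {n = n} id (g (f zero)) =
  fetch-tabulate (g (f zero)) j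
fetch-rows {m = suc m} {n} g f (suc i) j =
  trans (cong (fetch (map (g (f zero)) (allFin n) ++ _)) (trans (+-assoc n (toℕ i * n) (toℕ j))
    (cong (_+ (toℕ i * n + toℕ j)) (sym (trans (List.length-map (g (f zero)) (allFin n)) (List.length-tabulate {n = n} id))))))
    (trans (fetch-++ (map (g (f zero)) (allFin n)) _) (fetch-rows g (f ∘ suc) i j))

length-rows : ∀ {A B : Set} {m} n (g : B → Fin n → A) (f : Fin m → B) →
  length (concatMap (λ u → map (g u) (allFin n)) (Data.List.Base.tabulate f)) ≡ m * n
length-rows {m = zero}  n g f = refl
length-rows {m = suc m} n g f = trans (List.length-++ (map (g (f zero)) (allFin n)))
  (cong₂ _+_ (trans (List.length-map (g (f zero)) (allFin n)) (List.length-tabulate {n = n} id)) (length-rows n g (f ∘ suc)))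

fetch-beyond : ∀ {A : Set} (xs : List A) {i} → length xs ≤ i → fetch xs i ≡ nothing
fetch-beyond []       {zero}  l       = refl
fetch-beyond []       {suc i} l       = refl
fetch-beyond (x ∷ xs) {suc i} (s≤s l) = fetch-beyond xs l

module Input {n k} (G : Graph n) (pairs : Vec (Fin n × Fin n) k) where
  open Graph G

  M₀ : Memory
  M₀ = Config.memory (initial (encode G pairs))

  adjacent : Fin n → Fin n → ℕ
  adjacent u v = if does (u ~? v) then 1 else 0

  terminals : Vec ℕ (k * 2)
  terminals = Vec.map toℕ (flat pairs)

  F : ℕ
  F = suc (k * 2)

  private
    rows = concatMap (λ u → map (adjacent u) (allFin n)) (allFin n)

    terms : ∀ {j} (ps : Vec (Fin n × Fin n) j) →
            concatMap (λ (s , t) → toℕ s ∷ toℕ t ∷ []) (Vec.toList ps) ≡ Vec.toList (Vec.map toℕ (flat ps))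
    terms []       = refl
    terms (_ ∷ ps) = cong (λ z → _ ∷ _ ∷ z) (terms ps)

    M₀-suc : ∀ a → M₀ (suc a) ≡ fromMaybe 0 (fetch (Vec.toList terminals ++ rows) a)
    M₀-suc a = cong (λ z → fromMaybe 0 (fetch (z ++ rows) a)) (terms pairs)

    M₀-F : ∀ z → M₀ (F + z) ≡ fromMaybe 0 (fetch rows z)
    M₀-F z = trans (M₀-suc (k * 2 + z)) (cong (fromMaybe 0)
      (trans (cong (λ y → fetch (Vec.toList terminals ++ rows) (y + z)) (sym (Vec.length-toList terminals)))
        (fetch-++ (Vec.toList terminals) z)))

  M₀-terminals : ∀ i → M₀ (suc (toℕ i)) ≡ lookup terminals i
  M₀-terminals i = trans (M₀-suc (toℕ i)) (cong (fromMaybe 0) (fetch-toList terminals i))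

  M₀-adjacent : ∀ u v → M₀ (F + (toℕ u * n + toℕ v)) ≡ adjacent u v
  M₀-adjacent u v = trans (M₀-F _) (cong (fromMaybe 0) (fetch-rows adjacent id u v))

  M₀-beyond : ∀ {z} → n * n ≤ z → M₀ (F + z) ≡ 0
  M₀-beyond {z} l = trans (M₀-F z) (cong (fromMaybe 0)
    (fetch-beyond rows (≤-trans (≤-reflexive (length-rows n adjacent id)) l)))

digits-unique : ∀ {n} x y {a b} → a < n → b < n → x * n + a ≡ y * n + b → x ≡ y × a ≡ b
digits-unique {n} zero    zero    a<n b<n e = refl , e
digits-unique {n} zero    (suc y) a<n b<n e = contradiction
  (≤-trans (≤-trans (m≤m+n n (y * n)) (m≤m+n _ _)) (≤-reflexive (sym e))) (<⇒≱ a<n)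
digits-unique {n} (suc x) zero    a<n b<n e = contradiction
  (≤-trans (≤-trans (m≤m+n n (x * n)) (m≤m+n _ _)) (≤-reflexive e)) (<⇒≱ b<n)
digits-unique {n} (suc x) (suc y) {a} {b} a<n b<n e
  with digits-unique x y a<n b<n (+-cancelˡ-≡ n _ _ (trans (sym (+-assoc n (x * n) a)) (trans e (+-assoc n (y * n) b))))
... | p , q = cong suc p , q

digits-bound : ∀ {n x y a} → x < y → a < n → x * n + a < y * n
digits-bound {n} {x} {y} {a} x<y a<n =
  <-≤-trans (+-monoʳ-< (x * n) a<n) (≤-trans (≤-reflexive (+-comm (x * n) n)) (*-monoˡ-≤ n x<y))

iterate-inv : ∀ {A : Set} (P : ℕ → A → Set) {f : ℕ → A → A} m {a} → P 0 a →
              (∀ {x b} → x < m → P x b → P (suc x) (f x b)) → P m (iterate m f a)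
iterate-inv P zero    p₀ ps = p₀
iterate-inv P (suc m) p₀ ps = ps ≤-refl (iterate-inv P m p₀ (ps ∘ m<n⇒m<1+n))

-- Boot code: gaining registers inside the adjacency matrix

module Boot (k W : ℕ) (1≤W : 1 ≤ W) where

  F one hc d₀ H : ℕ
  F   = suc (k * 2)
  one = 1 + F
  hc  = 2 + F
  d₀  = 3 + F
  H   = suc (W + F)

  open Compile one hc

  -- The only scratch cell is `F`, the first diagonal entry of the matrix. It collects the address
  -- `F + (W + j) * (n + 1)` by a fixed number of additions of n, so the code does not depend on n.
  save : ℕ → List Instr
  save j = const F (F + (W + j)) ∷ replicate (W + j) (add F F 0) ++ store F (j + F) ∷ []

  -- Address F + (W + j) * (n + 1) is a diagonal entry of the adjacency
  -- matrix or lies past its end, so it carries no information.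
  saves : ℕ → List Instr
  saves zero    = []
  saves (suc j) = saves j ++ save (suc j)

  saveTime : ℕ → ℕ
  saveTime zero    = 0
  saveTime (suc j) = saveTime j + (1 + (W + suc j) + 1)

  -- A heap position beyond the matrix and beyond every rescued cell; the latter have heap positions
  -- `n * (W + j) + (j ∸ 1)` with j at most W.
  offset : Expr 0
  offset = sum<n (sum<n (con 1)) ⊕ sum<n (con (W + W)) ⊕ con (W + W)

  -- Heap cell `z ∸ suc W` is machine cell `F + z`, the z-th matrix entry, provided that z exceeds
  -- W. For smaller z the truncated difference is 0 and the copied value is garbage, which `restore`
  -- replaces except for z = 0, on the diagonal.
  copyCell : ∀ {V} → Fin V → Stmt (2 + V)
  copyCell X = put (var (suc (suc X)) ⊕ pos) (get (pos ⊖ con (suc W)))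
    where pos = sum<n (var (suc (suc zero))) ⊕ var zero

  copy : ∀ {V} → Fin V → Stmt V
  copy X = for<n (for<n (copyCell X))

  -- The address read here is the target of `save (suc j)`, counted from `H`.
  restore : ∀ {V} → Fin V → ℕ → Stmt V
  restore X zero    = skip
  restore X (suc j) = restore X j ⨾ put (var X ⊕ con (suc j)) (get (sum<n (con (W + suc j)) ⊕ con j))

  module _ (n : ℕ) (1≤n : 1 ≤ n) (M₀ : Memory) where
    open Semantics n

    target : ℕ → ℕ
    target j = F + (W + j) * suc n

    target-mono : ∀ {i j} → i < j → target i < target j
    target-mono i<j = +-monoʳ-< F (*-monoˡ-< (suc n) (+-monoʳ-< W i<j))

    -- No rescue overwrites a cell that is still to be rescued or will become a register. This is
    -- why the multiples of n + 1 start after W.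
    target-high : ∀ {j} → 1 ≤ j → W + F < target j
    target-high {j} 1≤j = ≤-trans (≤-reflexive (trans (cong suc (+-comm W F)) (sym (+-suc F W))))
      (+-monoʳ-≤ F (≤-trans (≤-trans (≤-reflexive (+-comm 1 W)) (+-monoʳ-≤ W 1≤j)) (m≤m*n (W + j) (suc n))))

    Saved : ℕ → Memory → Set
    Saved j M = (∀ {i} → 1 ≤ i → i ≤ j → M (target i) ≡ M₀ (i + F)) ×
                (∀ {a} → a ≢ F → (∀ {i} → 1 ≤ i → i ≤ j → a ≢ target i) → M a ≡ M₀ a)

    module _ {p : Program} where

      adds : ∀ r {i M m} → At p i (replicate r (add F F 0)) → M 0 ≡ n → M F ≡ m →
             ∃[ M′ ] p ⊢ ⟨ i , M ⟩ ↝[ r ] ⟨ i + r , M′ ⟩ × M′ F ≡ m + r * n × (∀ {a} → a ≢ F → M′ a ≡ M a)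
      adds zero {i} {M} {m} at e f =
        M , ↝-at (sym (+-identityʳ i)) (reach (λ s → refl)) ,
        trans f (sym (+-identityʳ m)) , λ _ → refl
      adds (suc r) {i} {M} {m} (at , ats) e f
        with adds r {M = M [ F ≔ M F + M 0 ]} ats e
               (trans (≔-same M F _) (cong₂ _+_ f e))
      ... | M′ , st , v , o = M′ ,
        ↝-at (sym (+-suc i r)) (↝-trans (step at refl) st) ,
        trans v (+-assoc m n (r * n)) , λ a≢F → trans (o a≢F) (≔-other M _ a≢F)

      save-correct : ∀ j {i M} → suc j ≤ W → M₀ 0 ≡ n → At p i (save (suc j)) → Saved j M →
        ∃[ M′ ] p ⊢ ⟨ i , M ⟩ ↝[ 1 + (W + suc j) + 1 ] ⟨ i + length (save (suc j)) , M′ ⟩ × Saved (suc j) M′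
      save-correct j {i} {M} j<W e₀ (at , ats) (sv , un)
        with At-++ (replicate (W + suc j) (add F F 0)) ats
      ... | at₁ , at₂ , _ with adds (W + suc j) {M = M [ F ≔ F + (W + suc j) ]} at₁
              ((trans (un (λ ()) (λ 1≤i _ → <⇒≢ (≤-trans (s≤s z≤n) (target-high 1≤i)))) e₀))
              (≔-same M F _)
      ... | M₁ , st , v , o = M₁ [ M₁ F ≔ M₁ (suc j + F) ] ,
        ↝-at pos (↝-trans (↝-trans (step at refl) st) (step at₂′ refl)) ,
        sv′ , un′
        where
        at₂′ : fetch p (suc i + (W + suc j)) ≡ just (store F (suc j + F))
        at₂′ = trans (cong (λ z → fetch p (suc i + z)) (sym (List.length-replicate (W + suc j)))) at₂
        pos : suc (suc i + (W + suc j)) ≡ i + length (save (suc j))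
        pos = sym (trans (+-suc i _) (cong suc (trans (cong (i +_) (trans (List.length-++ (replicate (W + suc j) (add F F 0)))
          (trans (+-comm _ 1) (cong suc (List.length-replicate (W + suc j)))))) (+-suc i _))))
        addr : M₁ F ≡ target (suc j)
        addr = trans v (trans (+-assoc F _ _) (cong (F +_) (sym (*-suc (W + suc j) n))))
        F<t : ∀ {l} → 1 ≤ l → F ≢ target l
        F<t 1≤l = <⇒≢ (≤-<-trans (m≤n+m F W) (target-high 1≤l))
        val : M₁ (suc j + F) ≡ M₀ (suc j + F)
        val = trans (o (≢-sym (<⇒≢ (m<n+m F (s≤s z≤n))))) (trans (≔-other M _ (≢-sym (<⇒≢ (m<n+m F (s≤s z≤n)))))
          (un (≢-sym (<⇒≢ (m<n+m F (s≤s z≤n))))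
            (λ 1≤l _ → <⇒≢ (≤-<-trans (+-monoˡ-≤ F j<W) (target-high 1≤l)))))
        sv′ : ∀ {l} → 1 ≤ l → l ≤ suc j → (M₁ [ M₁ F ≔ M₁ (suc j + F) ]) (target l) ≡ M₀ (l + F)
        sv′ {l} 1≤l l≤ rewrite addr with m≤n⇒m<n∨m≡n l≤
        ... | inj₂ refl = trans (≔-same M₁ (target (suc j)) _) val
        ... | inj₁ (s≤s l≤j) = trans (≔-other M₁ _ (<⇒≢ (target-mono (s≤s l≤j))))
          (trans (o (≢-sym (F<t 1≤l))) (trans (≔-other M _ (≢-sym (F<t 1≤l))) (sv 1≤l l≤j)))
        un′ : ∀ {a} → a ≢ F → (∀ {l} → 1 ≤ l → l ≤ suc j → a ≢ target l) →
              (M₁ [ M₁ F ≔ M₁ (suc j + F) ]) a ≡ M₀ a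
        un′ a≢F a≢t rewrite addr = trans (≔-other M₁ _ (a≢t (s≤s z≤n) ≤-refl))
          (trans (o a≢F) (trans (≔-other M _ a≢F) (un a≢F (λ 1≤l l≤j → a≢t 1≤l (m≤n⇒m≤1+n l≤j)))))

      saves-correct : ∀ j {i} → j ≤ W → M₀ 0 ≡ n → At p i (saves j) →
        ∃[ M′ ] p ⊢ ⟨ i , M₀ ⟩ ↝[ saveTime j ] ⟨ i + length (saves j) , M′ ⟩ × Saved j M′
      saves-correct zero {i} l e at =
        M₀ , ↝-at (sym (+-identityʳ i)) (reach (λ s → refl)) ,
        (λ 1≤i i≤0 → contradiction (≤-trans 1≤i i≤0) (<⇒≱ (s≤s z≤n))) , λ _ _ → refl
      saves-correct (suc j) {i} l e at with At-++ (saves j) at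
      ... | at₁ , at₂ with saves-correct j (<⇒≤ l) e at₁
      ... | M₁ , st₁ , s₁ with save-correct j l e at₂ s₁
      ... | M₂ , st₂ , s₂ = M₂ ,
        ↝-at (trans (+-assoc i _ _) (cong (i +_) (sym (List.length-++ (saves j))))) (↝-trans st₁ st₂) , s₂

∑-const : ∀ m c → ∑ m (λ _ → c) ≡ m * c
∑-const zero    c = refl
∑-const (suc m) c = trans (cong (_+ c) (∑-const m c)) (+-comm (m * c) c)

module Layout (k W n : ℕ) (1≤W : 1 ≤ W) (1≤n : 1 ≤ n) where
  open Boot k W 1≤W
  open Semantics n

  X₀ : ℕ
  X₀ = n * n + n * (W + W) + (W + W)

  offset-value : ∀ {h} → ⟦ offset ⟧ [] h ≡ X₀
  offset-value = cong (_+ (W + W)) (cong₂ _+_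
    (trans (∑-const n (∑ n (λ _ → 1))) (cong (n *_) (trans (∑-const n 1) (*-identityʳ n)))) (∑-const n (W + W)))

  n²≤X₀ : n * n ≤ X₀
  n²≤X₀ = ≤-trans (m≤m+n _ (n * (W + W))) (m≤m+n _ (W + W))

  module _ {V} (X : Fin V) (ε : Vec ℕ V) (eX : lookup ε X ≡ X₀) (h : Heap) where

    record Copied (z : ℕ) (h′ : Heap) : Set where
      field
        new : ∀ {y} → y < z → h′ (X₀ + y) ≡ h (y ∸ suc W)
        old : ∀ {x} → x < X₀ ⊎ X₀ + z ≤ x → h′ x ≡ h x

    -- The source of each copied entry lies below `X₀`, so it has not been overwritten by earlier
    -- copies.
    copy-step : ∀ {z h′} → z < n * n → Copied z h′ →
                Copied (suc z) (h′ [ X₀ + z ≔ h′ (z ∸ suc W) ])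
    copy-step {z} {h′} z<n² record { new = c ; old = u } = record { new = c′ ; old = u′ }
      where
      c′ : ∀ {y} → y < suc z → _
      c′ (s≤s y≤z) with m≤n⇒m<n∨m≡n y≤z
      ... | inj₂ refl = trans (≔-same h′ (X₀ + z) _) (u (inj₁ (≤-<-trans (m∸n≤m z (suc W)) (<-≤-trans z<n² n²≤X₀))))
      ... | inj₁ y<z = trans (≔-other h′ _ (<⇒≢ (+-monoʳ-< X₀ y<z))) (c y<z)
      u′ : ∀ {x} → x < X₀ ⊎ X₀ + suc z ≤ x → (h′ [ X₀ + z ≔ h′ (z ∸ suc W) ]) x ≡ h x
      u′ (inj₁ x<X) = trans (≔-other h′ _ (<⇒≢ (<-≤-trans x<X (m≤m+n X₀ z)))) (u (inj₁ x<X))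
      u′ (inj₂ X≤x) = trans (≔-other h′ _ (≢-sym (<⇒≢ (<-≤-trans (+-monoʳ-< X₀ (n<1+n z)) X≤x))))
        (u (inj₂ (≤-trans (+-monoʳ-≤ X₀ (n≤1+n z)) X≤x)))

    copyCell-value : ∀ u v h₂ → exec (copyCell X) (v ∷ u ∷ ε) h₂ ≡
                     h₂ [ X₀ + (u * n + v) ≔ h₂ (u * n + v ∸ suc W) ]
    copyCell-value u v h₂ rewrite eX | ∑-const n u | *-comm n u = refl

    copy-correct : Copied (n * n) (exec (copy X) ε h)
    copy-correct = iterate-inv (λ u → Copied (u * n)) {λ u → exec (for<n (copyCell X)) (u ∷ ε)} n
      (record { new = λ () ; old = λ _ → refl }) λ {u} {h₁} u<n c₁ →
      subst (λ z → Copied z (exec (for<n (copyCell X)) (u ∷ ε) h₁)) (+-comm (u * n) n)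
        (iterate-inv (λ v → Copied (u * n + v)) {λ v → exec (copyCell X) (v ∷ u ∷ ε)} n
          (subst (λ z → Copied z h₁) (sym (+-identityʳ _)) c₁)
          λ {v} {h₂} v<n c₂ → subst₂ Copied (sym (+-suc (u * n) v)) (sym (copyCell-value u v h₂))
            (copy-step (digits-bound u<n v<n) c₂))

    Restored : ℕ → Heap → Heap → Set
    Restored j h₁ h′ = (∀ {i} → i < j → h′ (X₀ + suc i) ≡ h₁ (n * (W + suc i) + i)) ×
                       (∀ {x} → (∀ {i} → i < j → x ≢ X₀ + suc i) → h′ x ≡ h₁ x)

    restore-correct : ∀ j {h₁} → j ≤ W → Restored j h₁ (exec (restore X j) ε h₁)
    restore-correct zero    {h₁} j≤W = (λ ()) , λ _ → refl
    restore-correct (suc j) {h₁} j<W rewrite eX | ∑-const n (W + suc j)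
      with restore-correct j {h₁} (<⇒≤ j<W)
    ... | r , u = r′ , u′
      where
      h₂ = exec (restore X j) ε h₁
      low : n * (W + suc j) + j < X₀
      low = +-mono-≤-< (≤-trans (*-monoʳ-≤ n (+-monoʳ-≤ W j<W)) (m≤n+m _ (n * n))) (<-≤-trans j<W (m≤m+n W W))
      r′ : ∀ {i} → i < suc j → (h₂ [ X₀ + suc j ≔ h₂ (n * (W + suc j) + j) ]) (X₀ + suc i) ≡ h₁ (n * (W + suc i) + i)
      r′ (s≤s i≤j) with m≤n⇒m<n∨m≡n i≤j
      ... | inj₂ refl = trans (≔-same h₂ (X₀ + suc j) _) (u (λ _ → <⇒≢ (<-≤-trans low (m≤m+n X₀ _))))
      ... | inj₁ i<j = trans (≔-other h₂ _ (<⇒≢ (+-monoʳ-< X₀ (s≤s i<j)))) (r i<j)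
      u′ : ∀ {x} → (∀ {i} → i < suc j → x ≢ X₀ + suc i) → (h₂ [ X₀ + suc j ≔ _ ]) x ≡ h₁ x
      u′ f = trans (≔-other h₂ _ (f ≤-refl)) (u (λ i<j → f (m<n⇒m<1+n i<j)))

  -- Nothing is claimed about the diagonal, which was sacrificed to the rescue. The cells after the
  -- matrix are zero and serve as fresh tables.
  Prepared : (Fin n → Fin n → ℕ) → Heap → Set
  Prepared a h = (∀ {u v} → u ≢ v → h (X₀ + (toℕ u * n + toℕ v)) ≡ a u v) ×
                 (∀ {x} → X₀ + n * n ≤ x → h x ≡ 0)

  module _ (G : Graph n) (pairs : Vec (Fin n × Fin n) k) {M : Memory}
           (saved : Saved n 1≤n (Input.M₀ G pairs) W M) where
    open Input G pairs hiding (F)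

    private
      target-heap : ∀ i → target n 1≤n M₀ (suc i) ≡ H + (n * (W + suc i) + i)
      target-heap i = begin-equality
        F + (W + suc i) * suc n           ≡⟨ cong (F +_) (*-suc (W + suc i) n) ⟩
        F + (W + suc i + (W + suc i) * n) ≡⟨ cong₂ (λ y z → F + (y + z)) (+-suc W i) (*-comm (W + suc i) n) ⟩
        F + (suc (W + i) + n * (W + suc i)) ≡⟨ cong (F +_) (trans (cong (λ z → suc z + n * (W + suc i)) (+-comm W i)) (cong suc (trans (cong (_+ n * (W + suc i)) (+-comm i W)) (trans (+-assoc W i _) (cong (W +_) (+-comm i _)))))) ⟩
        F + suc (W + (n * (W + suc i) + i)) ≡⟨ +-suc F _ ⟩
        suc (F + (W + (n * (W + suc i) + i))) ≡⟨ cong suc (sym (+-assoc F W _)) ⟩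
        suc (F + W + (n * (W + suc i) + i)) ≡⟨ cong (λ z → suc (z + (n * (W + suc i) + i))) (+-comm F W) ⟩
        H + (n * (W + suc i) + i) ∎
        where open ≤-Reasoning

      heap-F : ∀ z → H + z ≡ F + (suc W + z)
      heap-F z = trans (cong (λ y → suc (y + z)) (+-comm W F)) (trans (cong suc (+-assoc F W z)) (sym (+-suc F (W + z))))

    prepared : ∀ {V} (X : Fin V) ε → lookup ε X ≡ X₀ → ∀ {h} → (∀ x → M (H + x) ≡ h x) →
               Prepared adjacent (exec (copy X ⨾ restore X W) ε h)
    prepared X ε eX {h} hp = edges , blank
      where
      h₁ = exec (copy X) ε h
      cp = copy-correct X ε eX h
      rs = restore-correct X ε eX h W {h₁} ≤-refl

      restored : ∀ {i} → i < W → exec (restore X W) ε h₁ (X₀ + suc i) ≡ M₀ (F + suc i)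
      restored {i} i<W = trans (proj₁ rs i<W) (trans (Copied.old cp (inj₁ low))
        (trans (sym (hp _)) (trans (cong M (sym (target-heap i)))
        (trans (proj₁ saved (s≤s z≤n) i<W) (cong M₀ (+-comm (suc i) F))))))
        where
        low : n * (W + suc i) + i < X₀
        low = +-mono-≤-< (≤-trans (*-monoʳ-≤ n (+-monoʳ-≤ W i<W)) (m≤n+m _ (n * n))) (<-≤-trans i<W (m≤m+n W W))

      original : ∀ {z} → (∀ {i} → 1 ≤ i → i ≤ W → suc W + z ≢ (W + i) * suc n) → h z ≡ M₀ (F + (suc W + z))
      original {z} f = trans (sym (hp z)) (trans (cong M (heap-F z))
        (proj₂ saved (≢-sym (<⇒≢ (m<m+n F (s≤s z≤n)))) (λ 1≤i i≤W e → f 1≤i i≤W (+-cancelˡ-≡ F _ _ e))))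

      split : ∀ z → z ≡ 0 ⊎ (∃[ i ] i < W × z ≡ suc i) ⊎ (∃[ y ] z ≡ suc W + y)
      split zero    = inj₁ refl
      split (suc i) with i <? W
      ... | yes i<W = inj₂ (inj₁ (i , i<W , refl))
      ... | no i≮W = inj₂ (inj₂ (i ∸ W , cong suc (sym (m+[n∸m]≡n (≮⇒≥ i≮W)))))

      edges : ∀ {u v} → u ≢ v → exec (restore X W) ε h₁ (X₀ + (toℕ u * n + toℕ v)) ≡ adjacent u v
      edges {u} {v} u≢v = trans (go _ refl) (M₀-adjacent u v)
        where
        u<n = Fin.toℕ<n u
        v<n = Fin.toℕ<n v
        go : ∀ z → toℕ u * n + toℕ v ≡ z → exec (restore X W) ε h₁ (X₀ + z) ≡ M₀ (F + z)
        go z e with split z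
        ... | inj₁ refl = contradiction
          (Fin.toℕ-injective (let a , b = digits-unique (toℕ u) 0 v<n 1≤n e in trans a (sym b))) u≢v
        ... | inj₂ (inj₁ (i , i<W , refl)) = restored i<W
        ... | inj₂ (inj₂ (y , refl)) = trans
          (proj₂ rs (λ {i} i<W eq → <⇒≢ (s≤s (≤-trans i<W (m≤m+n W y))) (sym (+-cancelˡ-≡ X₀ _ _ eq))))
          (trans (Copied.new cp (subst (_< n * n) e (digits-bound u<n v<n)))
          (trans (cong h (m+n∸m≡n (suc W) y))
          (original {y} (λ {i} _ _ eq → u≢v (Fin.toℕ-injective (diag i (trans e eq)))))))
          where
          -- The cell at offset `(W + i) * (n + 1)` is the diagonal entry of row `W + i` if there is
          -- such a row; otherwise it lies past the matrix.
          diag : ∀ i → toℕ u * n + toℕ v ≡ (W + i) * suc n → toℕ u ≡ toℕ v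
          diag i eq with W + i <? n
          ... | yes w<n = let a , b = digits-unique (toℕ u) (W + i) v<n w<n (trans eq (trans (*-suc (W + i) n) (+-comm (W + i) _)))
                          in trans a (sym b)
          ... | no w≮n = contradiction (digits-bound u<n v<n)
            (≤⇒≯ (≤-trans (*-monoˡ-≤ n (≮⇒≥ w≮n)) (≤-trans (*-monoʳ-≤ (W + i) (n≤1+n n)) (≤-reflexive (sym eq)))))

      blank : ∀ {x} → X₀ + n * n ≤ x → exec (restore X W) ε h₁ x ≡ 0
      blank {x} l with split (x ∸ X₀) | m+[n∸m]≡n (≤-trans (m≤m+n X₀ (n * n)) l)
      ... | inj₁ e | eq = contradiction (≤-trans l (≤-reflexive (trans (sym eq) (trans (cong (X₀ +_) e) (+-identityʳ X₀)))))
              (<⇒≱ (m<m+n X₀ (*-mono-≤ 1≤n 1≤n)))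
      -- If n is small compared to W, some rescued cells come from beyond the matrix; what is put
      -- back for them is the initial 0.
      ... | inj₂ (inj₁ (i , i<W , e)) | eq = trans
        (cong (exec (restore X W) ε h₁) (trans (sym eq) (cong (X₀ +_) e)))
        (trans (restored i<W) (M₀-beyond (subst (n * n ≤_) e
          (+-cancelˡ-≤ X₀ _ _ (subst (X₀ + n * n ≤_) (sym eq) l)))))
      ... | inj₂ (inj₂ (y , e)) | eq = trans
        (proj₂ rs (λ {i} i<W eq′ → <⇒≢ (s≤s (≤-trans i<W (m≤m+n W y)))
          (sym (trans (sym e) (+-cancelˡ-≡ X₀ _ _ (trans eq eq′))))))
        (trans (Copied.old cp (inj₂ l)) (trans (original {x} far)
          (M₀-beyond (≤-trans (≤-trans (m≤n+m (n * n) X₀) l) (m≤n+m x (suc W))))))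
        where
        far : ∀ {i} → 1 ≤ i → i ≤ W → suc W + x ≢ (W + i) * suc n
        far {i} 1≤i i≤W eq = <⇒≱ (s≤s (≤-trans bound (m≤n+m x W))) (≤-reflexive eq)
          where
          bound : (W + i) * suc n ≤ x
          bound = ≤-trans (*-monoˡ-≤ (suc n) (+-monoʳ-≤ W i≤W))
            (≤-trans (≤-reflexive (trans (*-suc (W + W) n) (trans (+-comm (W + W) _) (cong (_+ (W + W)) (*-comm (W + W) n)))))
            (≤-trans (+-monoˡ-≤ (W + W) (m≤n+m _ (n * n))) (≤-trans (m≤m+n X₀ (n * n)) l)))
module Machine (k : ℕ) (s : Stmt (k * 2 + 1)) (e : Expr (k * 2 + 1))
               (W : ℕ) (1≤W : 1 ≤ W) (room : 20 + (height s ⊔ heightₑ e) ≤ W) where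

  open Boot k W 1≤W
  open Compile one hc

  γ : Vec ℕ (k * 2 + 1)
  γ = Vec.tabulate (suc ∘ toℕ) Vec.++ F ∷ []

  X : Fin (k * 2 + 1)
  X = k * 2 ↑ʳ zero

  main : Stmt (k * 2 + 1)
  main = (copy X ⨾ restore X W) ⨾ s

  private
    i₁ = length (saves W)
    c₂ = compₑ offset [] d₀ (2 + i₁)
    i₂ = 2 + i₁ + length c₂
    c₃ = comp main γ d₀ (2 + i₂)
    i₃ = 2 + i₂ + length c₃
    c₄ = compₑ e γ d₀ i₃
    i₄ = i₃ + length c₄

    tail₁ tail₂ tail₃ tail₄ : List Instr
    tail₄ = jumpIfZero d₀ (2 + i₄) ∷ accept ∷ reject ∷ []
    tail₃ = c₃ ++ c₄ ++ tail₄
    tail₂ = const F 0 ∷ add F F d₀ ∷ tail₃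
    tail₁ = const one 1 ∷ const hc H ∷ c₂ ++ tail₂

  program : Program
  program = saves W ++ tail₁

  time : ℕ → ℕ
  time n = saveTime W + (2 + (costₑ offset + (2 + (cost main + (costₑ e + 2)))))
    where open Semantics n

  private
    top = height s ⊔ heightₑ e

    -- There are `W ∸ 2` registers from `d₀` up to `H`, which explains the 20 in `room`: the boot
    -- code gets along with 18.
    fits : ∀ {m} → m ≤ 18 + top → d₀ + m ≤ H
    fits l = s≤s (≤-trans (≤-reflexive (cong (2 +_) (+-comm F _))) (≤-trans (s≤s (s≤s (+-monoˡ-≤ F l))) (+-monoˡ-≤ F room)))

    18≤ : ∀ {m} → m ≤ 18 → m ≤ 18 + top
    18≤ l = ≤-trans l (m≤m+n 18 top)

    height-restore : ∀ {V} (X : Fin V) j → height (restore X j) ≤ 18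
    height-restore X zero    = z≤n
    height-restore X (suc j) = ⊔-lub (height-restore X j) (≤ᵇ⇒≤ 4 18 tt)

    height-main : height main ≤ 18 + top
    height-main = ⊔-lub (⊔-lub (18≤ (≤ᵇ⇒≤ 8 18 tt)) (18≤ (height-restore X W)))
      (≤-trans (m≤m⊔n (height s) (heightₑ e)) (m≤n+m top 18))

  module _ {n} (1≤n : 1 ≤ n) (G : Graph n) (pairs : Vec (Fin n × Fin n) k) where
    open Semantics n
    open Layout k W n 1≤W 1≤n
    open Input G pairs using (M₀; adjacent; terminals; M₀-terminals)

    ε : Vec ℕ (k * 2 + 1)
    ε = terminals Vec.++ X₀ ∷ []

    answers : ∃[ h ] Prepared adjacent h × (∀ t → time n ≤ t →
              run program t (initial (encode G pairs)) ≡
              just (if ⟦ e ⟧ ε (exec s ε h) ≡ᵇ 0 then false else true))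
    answers = exec (copy X ⨾ restore X W) ε h , prepared G pairs sv X ε eX {h} (λ _ → refl) , finish
      where
      p = program
      at₁ : At p i₁ tail₁
      at₁ = At-suffix (saves W) tail₁
      at-saves : At p 0 (saves W)
      at-saves = proj₁ (At-++ {p} (saves W) {tail₁} (At-suffix [] p))
      at₂ : At p (2 + i₁) (c₂ ++ tail₂)
      at₂ = proj₂ (proj₂ at₁)
      at₃ : At p (2 + i₁) c₂ × At p i₂ tail₂
      at₃ = At-++ {p} c₂ {tail₂} at₂
      at₄ : At p (2 + i₂) tail₃
      at₄ = proj₂ (proj₂ (proj₂ at₃))
      at₅ : At p (2 + i₂) c₃ × At p i₃ (c₄ ++ tail₄)
      at₅ = At-++ {p} c₃ {c₄ ++ tail₄} at₄
      at₆ : At p i₃ c₄ × At p i₄ tail₄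
      at₆ = At-++ {p} c₄ {tail₄} (proj₂ at₅)
      saved = saves-correct n 1≤n M₀ {p} W ≤-refl refl at-saves
      M₁ = proj₁ saved
      sv = proj₂ (proj₂ saved)
      h : Heap
      h x = M₁ (H + x)
      M₂ = (M₁ [ one ≔ 1 ]) [ hc ≔ H ]
      hc<H : hc < H
      hc<H = ≤-trans (≤-reflexive (sym (+-identityʳ d₀))) (fits {0} z≤n)
      one<H : one < H
      one<H = <-trans ≤-refl hc<H
      heap₂ : ∀ x → M₂ (H + x) ≡ h x
      heap₂ x = trans (≔-other (M₁ [ one ≔ 1 ]) H (≢-sym (<⇒≢ (<-≤-trans hc<H (m≤m+n H x)))))
        (≔-other M₁ 1 (≢-sym (<⇒≢ (<-≤-trans one<H (m≤m+n H x)))))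
      low : ∀ {a} → a < F → M₁ a ≡ M₀ a
      low {a} a<F = proj₂ sv (<⇒≢ a<F)
        (λ 1≤i _ → <⇒≢ (<-trans a<F (≤-<-trans (m≤n+m F W) (target-high n 1≤n M₀ 1≤i))))
      low₂ : ∀ {a} → a < F → M₂ a ≡ M₀ a
      low₂ {a} a<F = trans (≔-other (M₁ [ one ≔ 1 ]) H (<⇒≢ (<-trans a<F (<-trans (n<1+n F) (n<1+n (suc F))))))
        (trans (≔-other M₁ 1 (<⇒≢ (<-trans a<F (n<1+n F)))) (low a<F))
      F<d₀ : F < d₀
      F<d₀ = s≤s (≤-trans (n≤1+n F) (n≤1+n _))
      one≡1 : M₂ one ≡ 1
      one≡1 = trans (≔-other (M₁ [ one ≔ 1 ]) H (<⇒≢ (n<1+n one))) (≔-same M₁ one 1)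
      hc≡H : M₂ hc ≡ H
      hc≡H = ≔-same (M₁ [ one ≔ 1 ]) hc H
      regs₂ : Regs p n H [] d₀ [] h M₂
      regs₂ = record
        { 0<d = s≤s z≤n ; one<d = s≤s (n≤1+n _) ; hc<d = ≤-refl
        ; M0 = low₂ (s≤s z≤n) ; M1 = one≡1 ; MH = hc≡H
        ; γ<d = λ () ; vars = λ () ; heap = heap₂ }
      run₃ = correctₑ p n H offset (proj₁ at₃) regs₂ (fits (18≤ (≤ᵇ⇒≤ 5 18 tt)))
      open Result run₃ renaming (M′ to M₃; steps to steps₃; same to same₃; heap′ to heap₃; post to post₃)
      M₄ = M₃ [ F ≔ 0 ]
      M₅ = M₄ [ F ≔ M₄ F + M₄ d₀ ]
      other₅ : ∀ {a} → a ≢ F → M₅ a ≡ M₃ a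
      other₅ a≢F = trans (≔-other M₄ _ a≢F) (≔-other M₃ 0 a≢F)
      F₅ : M₅ F ≡ X₀
      F₅ = trans (≔-same M₄ F _) (trans (cong₂ _+_ (≔-same M₃ F 0)
        (trans (≔-other M₃ 0 (≢-sym (<⇒≢ F<d₀))) post₃)) (offset-value {h}))
      eX : lookup ε X ≡ X₀
      eX = Vec.lookup-++ʳ terminals (X₀ ∷ []) zero
      γ-cases : (P : ℕ → ℕ → Set) → P F X₀ → (∀ (i : Fin (k * 2)) → P (suc (toℕ i)) (lookup terminals i)) →
                ∀ x → P (lookup γ x) (lookup ε x)
      γ-cases P pF pt x with splitAt (k * 2) x | Fin.join-splitAt (k * 2) 1 x
      ... | inj₁ i    | refl = subst₂ P
        (sym (trans (Vec.lookup-++ˡ (Vec.tabulate (suc ∘ toℕ)) (F ∷ []) i) (Vec.lookup∘tabulate (suc ∘ toℕ) i)))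
        (sym (Vec.lookup-++ˡ terminals (X₀ ∷ []) i)) (pt i)
      ... | inj₂ zero | refl = subst₂ P
        (sym (Vec.lookup-++ʳ (Vec.tabulate {n = k * 2} (suc ∘ toℕ)) (F ∷ []) zero)) (sym eX) pF
      regs₅ : Regs p n H γ d₀ ε h M₅
      regs₅ = record
        { 0<d = s≤s z≤n ; one<d = s≤s (n≤1+n _) ; hc<d = ≤-refl
        ; M0 = trans (same₃ 0 (s≤s z≤n)) (Regs.M0 regs₂)
        ; M1 = trans (other₅ (≢-sym (<⇒≢ (n<1+n F)))) (trans (same₃ one (s≤s (n≤1+n _))) one≡1)
        ; MH = trans (other₅ (≢-sym (<⇒≢ (<-trans (n<1+n F) (n<1+n one))))) (trans (same₃ hc ≤-refl) hc≡H)
        ; γ<d = γ-cases (λ c _ → c < d₀) F<d₀ (λ i → <-trans (s≤s (Fin.toℕ<n i)) F<d₀)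
        ; vars = γ-cases (λ c v → M₅ c ≡ v) F₅ λ i → trans (other₅ (<⇒≢ (s≤s (Fin.toℕ<n i))))
            (trans (same₃ _ (<-trans (s≤s (Fin.toℕ<n i)) F<d₀)) (trans (low₂ (s≤s (Fin.toℕ<n i))) (M₀-terminals i)))
        ; heap = λ x → trans (other₅ (≢-sym (<⇒≢ (<-≤-trans F<d₀ (≤-trans hc<H (m≤m+n H x)))))) (heap₃ x) }
      run₅ = correct p n H main {h = h} (proj₁ at₅) regs₅ (fits height-main)
      open Result run₅ renaming (M′ to M₆; steps to steps₆; same to same₆; heap′ to heap₆; post to post₆)
      run₆ = correctₑ p n H e (proj₁ at₆) (Regs-same p n H same₆ heap₆ regs₅)
        (fits (≤-trans (m≤n⊔m (height s) (heightₑ e)) (m≤n+m top 18)))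
      open Result run₆ renaming (M′ to M₇; steps to steps₇; same to same₇; heap′ to heap₇; post to post₇)
      h′ = exec (copy X ⨾ restore X W) ε h
      v = ⟦ e ⟧ ε (exec s ε h′)
      final : ∀ r {w i M} → M d₀ ≡ w → fetch p i ≡ just (jumpIfZero d₀ (2 + i)) →
              fetch p (1 + i) ≡ just accept → fetch p (2 + i) ≡ just reject →
              run p (2 + r) ⟨ i , M ⟩ ≡ just (if w ≡ᵇ 0 then false else true)
      final r {w} m f₀ f₁ f₂ rewrite f₀ | m with w
      ... | zero  rewrite f₂ = refl
      ... | suc _ rewrite f₁ = refl
      last : ∀ r → run p (2 + r) ⟨ i₄ , M₇ ⟩ ≡ just (if v ≡ᵇ 0 then false else true)
      last r = final r post₇ (proj₁ (proj₂ at₆)) (proj₁ (proj₂ (proj₂ at₆))) (proj₁ (proj₂ (proj₂ (proj₂ at₆))))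
      f₁ : fetch p i₁ ≡ just (const one 1)
      f₁ = proj₁ at₁
      f₂ : fetch p (1 + i₁) ≡ just (const hc H)
      f₂ = proj₁ (proj₂ at₁)
      f₃ : fetch p i₂ ≡ just (const F 0)
      f₃ = proj₁ (proj₂ at₃)
      f₄ : fetch p (1 + i₂) ≡ just (add F F d₀)
      f₄ = proj₁ (proj₂ (proj₂ at₃))
      reached : p ⊢ initial (encode G pairs) ↝[ saveTime W + (2 + (costₑ offset + (2 + (cost main + costₑ e)))) ] ⟨ i₄ , M₇ ⟩
      reached = ↝-trans (proj₁ (proj₂ saved))
        (↝-trans {t = 2} (↝-trans (step f₁ refl) (step f₂ refl))
        (↝-trans (↝-at refl steps₃)
        (↝-trans {t = 2} (↝-trans (step f₃ refl) (step f₄ refl))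
        (↝-trans steps₆ steps₇))))
      finish : ∀ t → time n ≤ t → run p t (initial (encode G pairs)) ≡ just (if v ≡ᵇ 0 then false else true)
      finish t l = trans (cong (λ z → run p z (initial (encode G pairs))) (sym split))
        (trans (_⊢_↝[_]_.runs reached (2 + (t ∸ time n))) (last (t ∸ time n)))
        where
        A = saveTime W
        B = costₑ offset
        C = cost main
        D = costₑ e
        split : A + (2 + (B + (2 + (C + D)))) + (2 + (t ∸ time n)) ≡ t
        split = trans (solve 5 (λ a b c d r →
            (a :+ (′ 2 :+ (b :+ (′ 2 :+ (c :+ d))))) :+ (′ 2 :+ r) :=
            (a :+ (′ 2 :+ (b :+ (′ 2 :+ (c :+ (d :+ ′ 2)))))) :+ r) refl A B C D (t ∸ time n))
          (m+[n∸m]≡n l)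
          where open import Data.Nat.Solver using (module +-*-Solver)
                open +-*-Solver renaming (con to ′_)

-- Formulas about vertices and distances, and their translation

infixr 3 _∙_

_∙_ : ∀ {A B C : Set} → A ⇔ B → B ⇔ C → A ⇔ C
f ∙ g = mk⇔ (Equivalence.to g ∘ Equivalence.to f) (Equivalence.from f ∘ Equivalence.from g)

-- Truth values are coded by "≢ 0".

not≢0 : ∀ {a} → 1 ∸ a ≢ 0 ⇔ a ≡ 0
not≢0 {zero}  = mk⇔ (λ _ → refl) (λ _ ())
not≢0 {suc a} = mk⇔ (λ p → contradiction (0∸n≡0 a) p) (λ ())

≤≢0 : ∀ {a b} → 1 ∸ (a ∸ b) ≢ 0 ⇔ a ≤ b
≤≢0 {a} {b} = mk⇔ (λ p → m∸n≡0⇒m≤n (Equivalence.to not≢0 p)) (λ p → Equivalence.from not≢0 (m≤n⇒m∸n≡0 p))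

or≢0 : ∀ {a b} → a + b ≢ 0 ⇔ (a ≢ 0 ⊎ b ≢ 0)
or≢0 {zero}  = mk⇔ inj₂ [ (λ p → contradiction refl p) , id ]′
or≢0 {suc a} = mk⇔ (λ _ → inj₁ λ ()) (λ _ ())

and≢0 : ∀ {a b} → 1 ∸ ((1 ∸ a) + (1 ∸ b)) ≢ 0 ⇔ (a ≢ 0 × b ≢ 0)
and≢0 {zero}  {b}     = mk⇔ (λ p → contradiction (0∸n≡0 (1 ∸ b)) p) (λ p → contradiction refl (proj₁ p))
and≢0 {suc a} {zero}  = mk⇔ (λ p → contradiction (cong (λ z → 1 ∸ (z + 1)) (0∸n≡0 a)) p) (λ p → contradiction refl (proj₂ p))
and≢0 {suc a} {suc b} = mk⇔ (λ _ → (λ ()) , (λ ()))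
  (λ _ e → contradiction (trans (sym (cong₂ (λ y z → 1 ∸ (y + z)) (0∸n≡0 a) (0∸n≡0 b))) e) (λ ()))

∑≢0 : ∀ m {f : ℕ → ℕ} → ∑ m f ≢ 0 ⇔ (∃[ i ] f (toℕ {m} i) ≢ 0)
∑≢0 m {f} = mk⇔ (to m) (λ (i , p) → from m (Fin.toℕ<n i) p)
  where
  to : ∀ m → ∑ m f ≢ 0 → ∃[ i ] f (toℕ {m} i) ≢ 0
  to zero    p = contradiction refl p
  to (suc m) p with Equivalence.to (or≢0 {∑ m f}) p
  ... | inj₁ q = let i , r = to m q in inject₁ i , subst (λ z → f z ≢ 0) (sym (Fin.toℕ-inject₁ i)) r
  ... | inj₂ q = fromℕ m , subst (λ z → f z ≢ 0) (sym (Fin.toℕ-fromℕ m)) q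
  from : ∀ m {x} → x < m → f x ≢ 0 → ∑ m f ≢ 0
  from (suc m) (s≤s x≤m) p with m≤n⇒m<n∨m≡n x≤m
  ... | inj₁ x<m  = Equivalence.from or≢0 (inj₁ (from m x<m p))
  ... | inj₂ refl = Equivalence.from (or≢0 {∑ m f}) (inj₂ p)

∀≢0 : ∀ m {f : ℕ → ℕ} → 1 ∸ ∑ m (λ x → 1 ∸ f x) ≢ 0 ⇔ (∀ i → f (toℕ {m} i) ≢ 0)
∀≢0 m {f} = mk⇔
  (λ p i z → Equivalence.from (∑≢0 m {λ x → 1 ∸ f x}) (i , Equivalence.from (not≢0 {f (toℕ i)}) z) (Equivalence.to not≢0 p))
  (λ p → Equivalence.from not≢0 (decidable-stable (_ ≟ 0)
    (λ q → let i , r = Equivalence.to (∑≢0 m {λ x → 1 ∸ f x}) q in p i (Equivalence.to not≢0 r))))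
  where open import Relation.Nullary.Decidable using (decidable-stable)

ext : ∀ {A : Set} {B : Set} → B → (A → B) → Maybe A → B
ext b f nothing  = b
ext b f (just a) = f a

data Tm (A : Set) : Set where
  dist : A → A → Tm A
  val  : A → Tm A
  lit  : ℕ → Tm A
  size : Tm A
  _∔_  : Tm A → Tm A → Tm A

-- There is no negation: whatever the game has to deny is a strict inequality between distances,
-- which `lit 1` expresses.
data Fm (A : Set) : Set where
  edge  : A → A → Fm A
  _≼_  : Tm A → Tm A → Fm A
  _∧_   : Fm A → Fm A → Fm A
  _∨_   : Fm A → Fm A → Fm A
  all   : Fm (Maybe A) → Fm A
  ⋀ ⋁   : ∀ m → (Fin m → Fm A) → Fm A

infix  6 _≼_
infixr 5 _∧_
infixr 4 _∨_
infixl 7 _∔_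

module Meaning (n : ℕ) (D : Fin n → Fin n → ℕ) (E : Fin n → Fin n → Set) where

  ⟦_⟧ₜ : ∀ {A} → Tm A → (A → Fin n) → ℕ
  ⟦ dist a b ⟧ₜ ν = D (ν a) (ν b)
  ⟦ val a ⟧ₜ    ν = toℕ (ν a)
  ⟦ lit m ⟧ₜ    ν = m
  ⟦ size ⟧ₜ     ν = n
  ⟦ s ∔ t ⟧ₜ    ν = ⟦ s ⟧ₜ ν + ⟦ t ⟧ₜ ν

  ⟦_⟧ᶠ : ∀ {A} → Fm A → (A → Fin n) → Set
  ⟦ edge a b ⟧ᶠ ν = E (ν a) (ν b)
  ⟦ s ≼ t ⟧ᶠ   ν = ⟦ s ⟧ₜ ν ≤ ⟦ t ⟧ₜ ν
  ⟦ φ ∧ ψ ⟧ᶠ    ν = ⟦ φ ⟧ᶠ ν × ⟦ ψ ⟧ᶠ ν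
  ⟦ φ ∨ ψ ⟧ᶠ    ν = ⟦ φ ⟧ᶠ ν ⊎ ⟦ ψ ⟧ᶠ ν
  ⟦ all φ ⟧ᶠ    ν = ∀ z → ⟦ φ ⟧ᶠ (ext z ν)
  ⟦ ⋀ m φ ⟧ᶠ    ν = ∀ i → ⟦ φ i ⟧ᶠ ν
  ⟦ ⋁ m φ ⟧ᶠ    ν = ∃[ i ] ⟦ φ i ⟧ᶠ ν

  congₜ : ∀ {A} (t : Tm A) {ν ν′} → (∀ a → ν a ≡ ν′ a) → ⟦ t ⟧ₜ ν ≡ ⟦ t ⟧ₜ ν′
  congₜ (dist a b) e = cong₂ D (e a) (e b)
  congₜ (val a)    e = cong toℕ (e a)
  congₜ (lit m)    e = refl
  congₜ size       e = refl
  congₜ (s ∔ t)    e = cong₂ _+_ (congₜ s e) (congₜ t e)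

  ext-cong : ∀ {A : Set} {ν ν′ : A → Fin n} z → (∀ a → ν a ≡ ν′ a) → ∀ a → ext z ν a ≡ ext z ν′ a
  ext-cong z e nothing  = refl
  ext-cong z e (just a) = e a

  congᶠ : ∀ {A} (φ : Fm A) {ν ν′} → (∀ a → ν a ≡ ν′ a) → ⟦ φ ⟧ᶠ ν → ⟦ φ ⟧ᶠ ν′
  congᶠ (edge a b) e p = subst₂ E (e a) (e b) p
  congᶠ (s ≼ t)   e p = subst₂ _≤_ (congₜ s e) (congₜ t e) p
  congᶠ (φ ∧ ψ)    e (p , q) = congᶠ φ e p , congᶠ ψ e q
  congᶠ (φ ∨ ψ)    e (inj₁ p) = inj₁ (congᶠ φ e p)
  congᶠ (φ ∨ ψ)    e (inj₂ p) = inj₂ (congᶠ ψ e p)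
  congᶠ (all φ)    e p = λ z → congᶠ φ (ext-cong z e) (p z)
  congᶠ (⋀ m φ)    e p = λ i → congᶠ (φ i) e (p i)
  congᶠ (⋁ m φ)    e (i , p) = i , congᶠ (φ i) e p

andₑ : ∀ {V} → Expr V → Expr V → Expr V
andₑ a b = con 1 ⊖ ((con 1 ⊖ a) ⊕ (con 1 ⊖ b))

allₑ anyₑ : ∀ {V} m → (Fin m → Expr V) → Expr V
allₑ zero    f = con 1
allₑ (suc m) f = andₑ (f zero) (allₑ m (f ∘ suc))
anyₑ zero    f = con 0
anyₑ (suc m) f = f zero ⊕ anyₑ m (f ∘ suc)

-- The last variable of an expression in scope V + 1 holds the address of the
-- adjacency matrix; the other variables hold vertices.
module Translate (tD tE : ∀ {V} → Fin V → Fin V → Expr (V + 1)) where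

  trₜ : ∀ {A V} → Tm A → (A → Fin V) → Expr (V + 1)
  trₜ (dist a b) l = tD (l a) (l b)
  trₜ (val a)    l = var (l a ↑ˡ 1)
  trₜ (lit m)    l = con m
  trₜ size       l = sum<n (con 1)
  trₜ (s ∔ t)    l = trₜ s l ⊕ trₜ t l

  tr : ∀ {A V} → Fm A → (A → Fin V) → Expr (V + 1)
  tr (edge a b) l = tE (l a) (l b)
  tr (s ≼ t)    l = con 1 ⊖ (trₜ s l ⊖ trₜ t l)
  tr (φ ∧ ψ)    l = andₑ (tr φ l) (tr ψ l)
  tr (φ ∨ ψ)    l = tr φ l ⊕ tr ψ l
  tr (all φ)    l = con 1 ⊖ sum<n (con 1 ⊖ tr φ (ext zero (suc ∘ l)))
  tr (⋀ m φ)    l = allₑ m (λ i → tr (φ i) l)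
  tr (⋁ m φ)    l = anyₑ m (λ i → tr (φ i) l)

module Environment (n X₀ : ℕ) where
  open Semantics n

  env : ∀ {V} → Vec (Fin n) V → Vec ℕ (V + 1)
  env ν = Vec.map toℕ ν Vec.++ X₀ ∷ []

  env-lookup : ∀ {V} (ν : Vec (Fin n) V) i → lookup (env ν) (i ↑ˡ 1) ≡ toℕ (lookup ν i)
  env-lookup ν i = trans (Vec.lookup-++ˡ (Vec.map toℕ ν) (X₀ ∷ []) i) (Vec.lookup-map i toℕ ν)

  env-X : ∀ {V} (ν : Vec (Fin n) V) → lookup (env ν) (V ↑ʳ zero) ≡ X₀
  env-X ν = Vec.lookup-++ʳ (Vec.map toℕ ν) (X₀ ∷ []) zero

  module _ (tD tE : ∀ {V} → Fin V → Fin V → Expr (V + 1))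
           (D : Fin n → Fin n → ℕ) (E : Fin n → Fin n → Set) (h : Heap)
           (tD-ok : ∀ {V} (ν : Vec (Fin n) V) i j → ⟦ tD i j ⟧ (env ν) h ≡ D (lookup ν i) (lookup ν j))
           (tE-ok : ∀ {V} (ν : Vec (Fin n) V) i j → ⟦ tE i j ⟧ (env ν) h ≢ 0 ⇔ E (lookup ν i) (lookup ν j)) where
    open Translate tD tE
    open Meaning n D E

    trₜ-ok : ∀ {A V} (t : Tm A) (l : A → Fin V) (ν : Vec (Fin n) V) →
             ⟦ trₜ t l ⟧ (env ν) h ≡ ⟦ t ⟧ₜ (lookup ν ∘ l)
    trₜ-ok (dist a b) l ν = tD-ok ν (l a) (l b)
    trₜ-ok (val a)    l ν = env-lookup ν (l a)
    trₜ-ok (lit m)    l ν = refl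
    trₜ-ok size       l ν = trans (∑-const n 1) (*-identityʳ n)
    trₜ-ok (s ∔ t)    l ν = cong₂ _+_ (trₜ-ok s l ν) (trₜ-ok t l ν)

    allₑ-ok : ∀ {V} m (f : Fin m → Expr (V + 1)) ε → ⟦ allₑ m f ⟧ ε h ≢ 0 ⇔ (∀ i → ⟦ f i ⟧ ε h ≢ 0)
    allₑ-ok zero    f ε = mk⇔ (λ _ ()) (λ _ ())
    allₑ-ok (suc m) f ε = and≢0 {⟦ f zero ⟧ ε h} ∙ mk⇔
      (λ { (p , q) zero → p ; (p , q) (suc i) → Equivalence.to (allₑ-ok m (f ∘ suc) ε) q i })
      (λ p → p zero , Equivalence.from (allₑ-ok m (f ∘ suc) ε) (p ∘ suc))

    anyₑ-ok : ∀ {V} m (f : Fin m → Expr (V + 1)) ε → ⟦ anyₑ m f ⟧ ε h ≢ 0 ⇔ (∃[ i ] ⟦ f i ⟧ ε h ≢ 0)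
    anyₑ-ok zero    f ε = mk⇔ (λ p → contradiction refl p) λ ()
    anyₑ-ok (suc m) f ε = or≢0 {⟦ f zero ⟧ ε h} ∙ mk⇔
      [ (λ p → zero , p) , (λ p → let i , q = Equivalence.to (anyₑ-ok m (f ∘ suc) ε) p in suc i , q) ]′
      (λ { (zero , p) → inj₁ p ; (suc i , p) → inj₂ (Equivalence.from (anyₑ-ok m (f ∘ suc) ε) (i , p)) })

    tr-ok : ∀ {A V} (φ : Fm A) (l : A → Fin V) (ν : Vec (Fin n) V) →
            ⟦ tr φ l ⟧ (env ν) h ≢ 0 ⇔ ⟦ φ ⟧ᶠ (lookup ν ∘ l)
    tr-ok (edge a b) l ν = tE-ok ν (l a) (l b)
    tr-ok (s ≼ t)    l ν = subst₂ (λ y z → 1 ∸ (y ∸ z) ≢ 0 ⇔ ⟦ s ⟧ₜ (lookup ν ∘ l) ≤ ⟦ t ⟧ₜ (lookup ν ∘ l))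
      (sym (trₜ-ok s l ν)) (sym (trₜ-ok t l ν)) (≤≢0 {⟦ s ⟧ₜ (lookup ν ∘ l)})
    tr-ok (φ ∧ ψ)    l ν = and≢0 {⟦ tr φ l ⟧ (env ν) h} ∙ mk⇔
      (λ (p , q) → Equivalence.to (tr-ok φ l ν) p , Equivalence.to (tr-ok ψ l ν) q)
      (λ (p , q) → Equivalence.from (tr-ok φ l ν) p , Equivalence.from (tr-ok ψ l ν) q)
    tr-ok (φ ∨ ψ)    l ν = or≢0 {⟦ tr φ l ⟧ (env ν) h} ∙ mk⇔
      [ (λ p → inj₁ (Equivalence.to (tr-ok φ l ν) p)) , (λ p → inj₂ (Equivalence.to (tr-ok ψ l ν) p)) ]′
      [ (λ p → inj₁ (Equivalence.from (tr-ok φ l ν) p)) , (λ p → inj₂ (Equivalence.from (tr-ok ψ l ν) p)) ]′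
    tr-ok (all φ)    l ν = ∀≢0 n {λ x → ⟦ tr φ (ext zero (suc ∘ l)) ⟧ (x ∷ env ν) h} ∙ mk⇔
      (λ p z → congᶠ φ (assoc z) (Equivalence.to (tr-ok φ (ext zero (suc ∘ l)) (z ∷ ν)) (p z)))
      (λ p z → Equivalence.from (tr-ok φ (ext zero (suc ∘ l)) (z ∷ ν)) (congᶠ φ (sym ∘ assoc z) (p z)))
      where
      assoc : ∀ z a → lookup (z ∷ ν) (ext zero (suc ∘ l) a) ≡ ext z (lookup ν ∘ l) a
      assoc z nothing  = refl
      assoc z (just a) = refl
    tr-ok (⋀ m φ)    l ν = allₑ-ok m _ (env ν) ∙ mk⇔
      (λ p i → Equivalence.to (tr-ok (φ i) l ν) (p i)) (λ p i → Equivalence.from (tr-ok (φ i) l ν) (p i))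
    tr-ok (⋁ m φ)    l ν = anyₑ-ok m _ (env ν) ∙ mk⇔
      (λ (i , p) → i , Equivalence.to (tr-ok (φ i) l ν) p) (λ (i , p) → i , Equivalence.from (tr-ok (φ i) l ν) p)

-- Tables indexed by tuples of vertices, and saturation

data Var (N T : Set) : Set where
  old new : N → Var N T
  glob    : T → Var N T

sums : ∀ m {V} → Expr ((m + V) + 1) → Expr (V + 1)
sums zero    e = e
sums (suc m) e = sums m (sum<n e)

fors : ∀ m {V} → Stmt ((m + V) + 1) → Stmt (V + 1)
fors zero    s = s
fors (suc m) s = fors m (for<n s)

-- Horner's scheme in base n; the product with n is a sum of n equal terms.
idx : ∀ {m V} → (Fin m → Fin V) → Expr (V + 1)
idx {zero}  f = con 0
idx {suc m} {V} f = sum<n (idx {m} {suc V} (suc ∘ f ∘ suc)) ⊕ var (f zero ↑ˡ 1)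

enc : ∀ {n m} → Vec (Fin n) m → ℕ
enc []            = 0
enc {n} (x ∷ c)   = n * enc c + toℕ x

enc-injective : ∀ {n m} (c c′ : Vec (Fin n) m) → enc c ≡ enc c′ → c ≡ c′
enc-injective []      []        e = refl
enc-injective {n} (x ∷ c) (x′ ∷ c′) e
  with digits-unique (enc c) (enc c′) (Fin.toℕ<n x) (Fin.toℕ<n x′)
         (subst₂ (λ y z → y + toℕ x ≡ z + toℕ x′) (*-comm n (enc c)) (*-comm n (enc c′)) e)
... | p , q = cong₂ _∷_ (Fin.toℕ-injective q) (enc-injective c c′ p)

enc-bound : ∀ {n m} (c : Vec (Fin n) m) → enc c < n ^ m
enc-bound []                  = s≤s z≤n
enc-bound {n} {suc m} (x ∷ c) = subst₂ (λ y z → y + toℕ x < z) (*-comm (enc c) n) (*-comm (n ^ m) n)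
  (digits-bound (enc-bound c) (Fin.toℕ<n x))

module Loops (n X₀ : ℕ) where
  open Semantics n
  open Environment n X₀

  sums≢0 : ∀ m {V} (e : Expr ((m + V) + 1)) (ν : Vec (Fin n) V) h →
           ⟦ sums m e ⟧ (env ν) h ≢ 0 ⇔ (∃[ c ] ⟦ e ⟧ (env (c Vec.++ ν)) h ≢ 0)
  sums≢0 zero    e ν h = mk⇔ ([] ,_) (λ { ([] , p) → p })
  sums≢0 (suc m) e ν h = sums≢0 m (sum<n e) ν h ∙ mk⇔
    (λ (c , p) → let i , q = Equivalence.to (∑≢0 n {λ x → ⟦ e ⟧ (x ∷ env (c Vec.++ ν)) h}) p in i ∷ c , q)
    (λ { (i ∷ c , p) → c , Equivalence.from (∑≢0 n {λ x → ⟦ e ⟧ (x ∷ env (c Vec.++ ν)) h}) (i , p) })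

  iterate-all : ∀ {f : ℕ → Heap → Heap} (I : Heap → Set) (J : Fin n → Heap → Set) →
    (∀ i {h} → I h → I (f (toℕ i) h) × J i (f (toℕ i) h)) →
    (∀ i j {h} → I h → J i h → J i (f (toℕ j) h)) →
    ∀ {h} → I h → I (iterate n f h) × (∀ i → J i (iterate n f h))
  iterate-all {f} I J make keep {h} ih =
    let a , b = iterate-inv (λ x h → I h × (∀ i → toℕ i < x → J i h)) {f} n (ih , λ _ ()) step′
    in a , λ i → b i (Fin.toℕ<n i)
    where
    step′ : ∀ {x h} → x < n → (I h × (∀ i → toℕ i < x → J i h)) →
            I (f x h) × (∀ i → toℕ i < suc x → J i (f x h))
    step′ {x} {h} x<n (ih , js) = subst (λ z → I (f z h) × (∀ i → toℕ i < suc z → J i (f z h)))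
      (Fin.toℕ-fromℕ< x<n) (proj₁ (make j ih) , go)
      where
      j = fromℕ< x<n
      go : ∀ i → toℕ i < suc (toℕ j) → J i (f (toℕ j) h)
      go i (s≤s i≤j) with m≤n⇒m<n∨m≡n i≤j
      ... | inj₁ i<j = keep i j ih (js i (subst (toℕ i <_) (Fin.toℕ-fromℕ< x<n) i<j))
      ... | inj₂ i≡j rewrite Fin.toℕ-injective i≡j = proj₂ (make j ih)

  -- A rule for m nested loops: each tuple c establishes `J c` when its turn comes, and no other
  -- turn destroys it.
  fors-all : ∀ m {V} (s : Stmt ((m + V) + 1)) (ν : Vec (Fin n) V) (I : Heap → Set) (J : Vec (Fin n) m → Heap → Set) →
    (∀ c {h} → I h → I (exec s (env (c Vec.++ ν)) h) × J c (exec s (env (c Vec.++ ν)) h)) →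
    (∀ c c′ {h} → I h → J c h → J c (exec s (env (c′ Vec.++ ν)) h)) →
    ∀ {h} → I h → I (exec (fors m s) (env ν) h) × (∀ c → J c (exec (fors m s) (env ν) h))
  fors-all zero    s ν I J make keep ih = let a , b = make [] ih in a , λ { [] → b }
  fors-all (suc m) s ν I J make keep ih =
    let a , b = fors-all m (for<n s) ν I (λ c h → ∀ i → J (i ∷ c) h)
          (λ c ih → iterate-all I (λ i → J (i ∷ c)) (λ i → make (i ∷ c)) (λ i j → keep (i ∷ c) (j ∷ c)) ih)
          (λ c c′ {h} ih js i → proj₂ (iterate-inv (λ _ h → I h × J (i ∷ c) h) n (ih , js i)
            (λ { {x} {h₁} x<n (ih₁ , j₁) → subst (λ z → I (exec s (z ∷ env (c′ Vec.++ ν)) h₁) × J (i ∷ c) (exec s (z ∷ env (c′ Vec.++ ν)) h₁))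
              (Fin.toℕ-fromℕ< x<n)
              (proj₁ (make (fromℕ< x<n ∷ c′) ih₁) , keep (i ∷ c) (fromℕ< x<n ∷ c′) ih₁ j₁) })))
          ih
    in a , λ { (i ∷ c) → b c i }

  ∑-cong : ∀ m {f g : ℕ → ℕ} → (∀ {x} → x < m → f x ≡ g x) → ∑ m f ≡ ∑ m g
  ∑-cong zero    e = refl
  ∑-cong (suc m) e = cong₂ _+_ (∑-cong m (e ∘ m<n⇒m<1+n)) (e ≤-refl)

  idx-value : ∀ {m V} (f : Fin m → Fin V) (ν : Vec (Fin n) V) (c : Vec (Fin n) m) h →
              (∀ i → lookup ν (f i) ≡ lookup c i) → ⟦ idx f ⟧ (env ν) h ≡ enc c
  idx-value {zero}  f ν []      h e = refl
  idx-value {suc m} f ν (x ∷ c) h e = cong₂ _+_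
    (trans (∑-cong n (λ { {z} z<n → trans (cong (λ y → ⟦ idx {m} {suc _} (suc ∘ f ∘ suc) ⟧ (y ∷ env ν) h) (sym (Fin.toℕ-fromℕ< z<n)))
       (idx-value (suc ∘ f ∘ suc) (fromℕ< z<n ∷ ν) c h (e ∘ suc)) }))
       (∑-const n (enc c)))
    (trans (env-lookup ν (f zero)) (cong toℕ (e zero)))

module Reach (tD tE : ∀ {V} → Fin V → Fin V → Expr (V + 1))
             (m : ℕ) {N T : Set} (loc : N → Fin m) (init step : Fm (Var N T))
             (base : ∀ V → Expr (V + 1)) where
  open Translate tD tE

  cell : ∀ {V} → (Fin m → Fin V) → Expr (V + 1)
  cell {V} f = base V ⊕ idx f

  alone : ∀ {V} → (T → Fin V) → Var N T → Fin (m + V)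
  alone {V} l (old a)  = loc a ↑ˡ V
  alone {V} l (new a)  = loc a ↑ˡ V
  alone     l (glob t) = m ↑ʳ l t

  both : ∀ {V} → (T → Fin V) → Var N T → Fin (m + (m + V))
  both {V} l (old a)  = loc a ↑ˡ (m + V)
  both {V} l (new a)  = m ↑ʳ (loc a ↑ˡ V)
  both     l (glob t) = m ↑ʳ (m ↑ʳ l t)

  -- The old mark is one of the summands, so marks never disappear. Only being nonzero counts; the
  -- size of the sum is irrelevant.
  update : ∀ {V} → (T → Fin V) → Stmt ((m + V) + 1)
  update {V} l = put (cell (_↑ˡ V)) (get (cell (_↑ˡ V)) ⊕ (tr init (alone l) ⊕
    sums m (andₑ (get (cell (_↑ˡ (m + V)))) (tr step (both l)))))

  round : ∀ {V} → (T → Fin V) → Stmt (suc V + 1)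
  round {V} l = fors m {suc V} (update {suc V} (suc ∘ l))

  -- A loop offers n rounds, so `K * n` rounds are K loops in a row, with K depending on k only.
  rounds : ∀ {V} → ℕ → (T → Fin V) → Stmt (V + 1)
  rounds zero    l = skip
  rounds (suc K) l = rounds K l ⨾ for<n (round l)

  some : ∀ {V} → Fm (Var N T) → (T → Fin V) → Expr (V + 1)
  some {V} φ l = sums m (andₑ (get (cell (_↑ˡ V))) (tr φ (alone l)))

  module Correct (n X₀ : ℕ) (D : Fin n → Fin n → ℕ) (E : Fin n → Fin n → Set) (b : ℕ) (h₀ : Heap) where
    open Semantics n
    open Environment n X₀
    open Meaning n D E
    open Loops n X₀

    Agree : Heap → Set
    Agree h = ∀ {x} → x < b → h x ≡ h₀ x

    Config′ : Set
    Config′ = Vec (Fin n) m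

    module _ (base-ok : ∀ {V} (ν : Vec (Fin n) V) h → ⟦ base V ⟧ (env ν) h ≡ b)
      (tD-ok : ∀ {V} (ν : Vec (Fin n) V) i j {h} → Agree h → ⟦ tD i j ⟧ (env ν) h ≡ D (lookup ν i) (lookup ν j))
      (tE-ok : ∀ {V} (ν : Vec (Fin n) V) i j {h} → Agree h → ⟦ tE i j ⟧ (env ν) h ≢ 0 ⇔ E (lookup ν i) (lookup ν j))
      (fresh : ∀ {x} → b ≤ x → h₀ x ≡ 0) (τ : T → Fin n) where

      view : Config′ → Config′ → Var N T → Fin n
      view c′ c (old a)  = lookup c′ (loc a)
      view c′ c (new a)  = lookup c (loc a)
      view c′ c (glob t) = τ t

      Init : Config′ → Set
      Init c = ⟦ init ⟧ᶠ (view c c)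

      Step : Config′ → Config′ → Set
      Step c′ c = ⟦ step ⟧ᶠ (view c′ c)

      data ReachIn : ℕ → Config′ → Set where
        start : ∀ {r c} → Init c → ReachIn r c
        more  : ∀ {r c c′} → ReachIn r c′ → Step c′ c → ReachIn (suc r) c

      Marked : Heap → Config′ → Set
      Marked h c = h (b + enc c) ≢ 0

      record Sound (h : Heap) : Set where
        field
          agree  : Agree h
          above  : ∀ {x} → b + n ^ m ≤ x → h x ≡ 0
          reached : ∀ c → Marked h c → ∃[ r ] ReachIn r c
      open Sound

      Done : ℕ → Heap → Set
      Done r h = ∀ {r′ c} → r′ < r → ReachIn r′ c → Marked h c

      module _ {V} (l : T → Fin V) (ν : Vec (Fin n) V) (l-ok : ∀ t → lookup ν (l t) ≡ τ t) where

        here-view : ∀ c a → lookup (c Vec.++ ν) (alone l a) ≡ view c c a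
        here-view c (old a)  = Vec.lookup-++ˡ c ν (loc a)
        here-view c (new a)  = Vec.lookup-++ˡ c ν (loc a)
        here-view c (glob t) = trans (Vec.lookup-++ʳ c ν (l t)) (l-ok t)

        both-view : ∀ c′ c a → lookup (c′ Vec.++ (c Vec.++ ν)) (both l a) ≡ view c′ c a
        both-view c′ c (old a)  = Vec.lookup-++ˡ c′ (c Vec.++ ν) (loc a)
        both-view c′ c (new a)  = trans (Vec.lookup-++ʳ c′ (c Vec.++ ν) (loc a ↑ˡ V)) (Vec.lookup-++ˡ c ν (loc a))
        both-view c′ c (glob t) = trans (Vec.lookup-++ʳ c′ (c Vec.++ ν) (m ↑ʳ l t))
          (trans (Vec.lookup-++ʳ c ν (l t)) (l-ok t))

        cell-ok : ∀ c {V} (ν : Vec (Fin n) V) h → ⟦ cell (_↑ˡ V) ⟧ (env (c Vec.++ ν)) h ≡ b + enc c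
        cell-ok c ν h = cong₂ _+_ (base-ok (c Vec.++ ν) h) (idx-value _ (c Vec.++ ν) c h (Vec.lookup-++ˡ c ν))

        here-ok : ∀ φ c {h} → Agree h → ⟦ tr φ (alone l) ⟧ (env (c Vec.++ ν)) h ≢ 0 ⇔ ⟦ φ ⟧ᶠ (view c c)
        here-ok φ c {h} ag = tr-ok tD tE D E h (λ ν i j → tD-ok ν i j ag) (λ ν i j → tE-ok ν i j ag) φ (alone l) (c Vec.++ ν)
          ∙ mk⇔ (congᶠ φ (here-view c)) (congᶠ φ (sym ∘ here-view c))

        both-ok : ∀ φ c′ c {h} → Agree h → ⟦ tr φ (both l) ⟧ (env (c′ Vec.++ (c Vec.++ ν))) h ≢ 0 ⇔ ⟦ φ ⟧ᶠ (view c′ c)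
        both-ok φ c′ c {h} ag = tr-ok tD tE D E h (λ ν i j → tD-ok ν i j ag) (λ ν i j → tE-ok ν i j ag) φ (both l) (c′ Vec.++ (c Vec.++ ν))
          ∙ mk⇔ (congᶠ φ (both-view c′ c)) (congᶠ φ (sym ∘ both-view c′ c))

        Next : Heap → Config′ → Set
        Next h c = Marked h c ⊎ Init c ⊎ (∃[ c′ ] Marked h c′ × Step c′ c)

        value : Config′ → Heap → ℕ
        value c h = h (b + enc c) + (⟦ tr init (alone l) ⟧ (env (c Vec.++ ν)) h +
          ⟦ sums m (andₑ (get (cell (_↑ˡ (m + V)))) (tr step (both l))) ⟧ (env (c Vec.++ ν)) h)

        value-ok : ∀ c {h} → Agree h → value c h ≢ 0 ⇔ Next h c
        value-ok c {h} ag = or≢0 {h (b + enc c)} ∙ sum-map (or≢0 {⟦ tr init (alone l) ⟧ (env (c Vec.++ ν)) h}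
          ∙ sum-map′ (here-ok init c ag) (sums≢0 m (andₑ (get (cell (_↑ˡ (m + V)))) (tr step (both l))) (c Vec.++ ν) h ∙ mk⇔
            (λ (c′ , p) → let q , r = Equivalence.to (and≢0 {h (⟦ cell (_↑ˡ (m + V)) ⟧ (env (c′ Vec.++ (c Vec.++ ν))) h)}) p in
              c′ , subst (λ z → h z ≢ 0) (cell-ok c′ (c Vec.++ ν) h) q , Equivalence.to (both-ok step c′ c ag) r)
            (λ (c′ , q , r) → c′ , Equivalence.from (and≢0 {h (⟦ cell (_↑ˡ (m + V)) ⟧ (env (c′ Vec.++ (c Vec.++ ν))) h)})
              (subst (λ z → h z ≢ 0) (sym (cell-ok c′ (c Vec.++ ν) h)) q , Equivalence.from (both-ok step c′ c ag) r))))
          where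
          sum-map : ∀ {A B C : Set} → B ⇔ C → (A ⊎ B) ⇔ (A ⊎ C)
          sum-map f = mk⇔ [ inj₁ , inj₂ ∘ Equivalence.to f ]′ [ inj₁ , inj₂ ∘ Equivalence.from f ]′
          sum-map′ : ∀ {A A′ B C : Set} → A ⇔ A′ → B ⇔ C → (A ⊎ B) ⇔ (A′ ⊎ C)
          sum-map′ e f = mk⇔ [ inj₁ ∘ Equivalence.to e , inj₂ ∘ Equivalence.to f ]′ [ inj₁ ∘ Equivalence.from e , inj₂ ∘ Equivalence.from f ]′

        update-ok : ∀ c h → exec (update l) (env (c Vec.++ ν)) h ≡ h [ b + enc c ≔ value c h ]
        update-ok c h rewrite cell-ok c ν h = refl

        -- Along a round the marks only grow, so the premises of a step
        -- available at its beginning are still there when c is treated.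
        round-ok : ∀ r {h} → Sound h → Done r h →
                   Sound (exec (fors m (update l)) (env ν) h) × Done (suc r) (exec (fors m (update l)) (env ν) h)
        round-ok r {h} so dn =
          let (so′ , dn′) , nx = fors-all m (update l) ν (λ h → Sound h × Done r h)
                (λ c h → ∀ {r′} → r′ < suc r → ReachIn r′ c → Marked h c) new′ keep (so , dn)
          in so′ , λ {r′} {c} → nx c {r′}
          where
          put-other : ∀ c c′ {h} → c ≢ c′ → (h [ b + enc c′ ≔ value c′ h ]) (b + enc c) ≡ h (b + enc c)
          put-other c c′ {h} c≢c′ = ≔-other h _ (λ e → c≢c′ (enc-injective c c′ (+-cancelˡ-≡ b _ _ e)))
          grow : ∀ c c′ {h} → Agree h → Marked h c → Marked (h [ b + enc c′ ≔ value c′ h ]) c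
          grow c c′ {h} ag mk with Vec.≡-dec Fin._≟_ c c′
          ... | yes refl = λ z → Equivalence.from (value-ok c ag) (inj₁ mk) (trans (sym (≔-same h _ _)) z)
          ... | no c≢c′  = λ z → mk (trans (sym (put-other c c′ {h} c≢c′)) z)
          sound′ : ∀ c {h} → Sound h → Sound (h [ b + enc c ≔ value c h ])
          sound′ c {h} so .agree {x} x<b = trans (≔-other h _ (<⇒≢ (<-≤-trans x<b (m≤m+n b _)))) (so .agree x<b)
          sound′ c {h} so .above {x} l = trans (≔-other h _ (≢-sym (<⇒≢ (<-≤-trans (+-monoʳ-< b (enc-bound c)) l)))) (so .above l)
          sound′ c {h} so .reached c₁ mk with Vec.≡-dec Fin._≟_ c₁ c
          ... | no c≢ = so .reached c₁ (λ z → mk (trans (put-other c₁ c {h} c≢) z))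
          ... | yes refl with Equivalence.to (value-ok c (so .agree)) (λ z → mk (trans (≔-same h _ _) z))
          ...   | inj₁ mk′ = so .reached c mk′
          ...   | inj₂ (inj₁ i) = 0 , start i
          ...   | inj₂ (inj₂ (c′ , mk′ , st)) = let r , re = so .reached c′ mk′ in suc r , more re st
          new′ : ∀ c {h} → Sound h × Done r h →
                 (Sound (exec (update l) (env (c Vec.++ ν)) h) × Done r (exec (update l) (env (c Vec.++ ν)) h)) ×
                 (∀ {r′} → r′ < suc r → ReachIn r′ c → Marked (exec (update l) (env (c Vec.++ ν)) h) c)
          new′ c {h} (so , dn) = subst (λ H → (Sound H × Done r H) × (∀ {r′} → r′ < suc r → ReachIn r′ c → Marked H c))
            (sym (update-ok c h))
            ((sound′ c so , (λ {r′} {c₁} r′<r re → grow c₁ c (so .agree) (dn r′<r re))) , goal)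
            where
            mark : Next h c → Marked (h [ b + enc c ≔ value c h ]) c
            mark nx z = Equivalence.from (value-ok c (so .agree)) nx (trans (sym (≔-same h _ _)) z)
            goal : ∀ {r′} → r′ < suc r → ReachIn r′ c → Marked (h [ b + enc c ≔ value c h ]) c
            goal _ (start i) = mark (inj₂ (inj₁ i))
            goal (s≤s r′<r) (more re st) = mark (inj₂ (inj₂ (_ , dn r′<r re , st)))
          keep : ∀ c c′ {h} → Sound h × Done r h → (∀ {r′} → r′ < suc r → ReachIn r′ c → Marked h c) →
                 ∀ {r′} → r′ < suc r → ReachIn r′ c → Marked (exec (update l) (env (c′ Vec.++ ν)) h) c
          keep c c′ {h} (so , _) mk l′ re =
            subst (λ H → Marked H c) (sym (update-ok c′ h)) (grow c c′ (so .agree) (mk l′ re))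

      rounds-ok : ∀ {V} (l : T → Fin V) ν → (∀ t → lookup ν (l t) ≡ τ t) → ∀ K →
                  Sound (exec (rounds K l) (env ν) h₀) × Done (K * n) (exec (rounds K l) (env ν) h₀)
      rounds-ok l ν l-ok zero = record
        { agree = λ _ → refl ; above = λ l → fresh (≤-trans (m≤m+n b _) l)
        ; reached = λ c mk → contradiction (fresh (m≤m+n b _)) mk } , λ ()
      rounds-ok {V} l ν l-ok (suc K) =
        let so , dn = iterate-inv (λ x h → Sound h × Done (K * n + x) h)
              {λ x → exec (round l) (x ∷ env ν)} n
              (let so , dn = rounds-ok l ν l-ok K in so , subst (λ z → Done z (exec (rounds K l) (env ν) h₀)) (sym (+-identityʳ _)) dn)
              (λ { {x} {h} x<n (so , dn) → subst (λ z → Sound (exec (round l) (z ∷ env ν) h) ×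
                      Done (K * n + suc x) (exec (round l) (z ∷ env ν) h)) (Fin.toℕ-fromℕ< x<n)
                  (let so′ , dn′ = round-ok {suc V} (suc ∘ l) (fromℕ< x<n ∷ ν) l-ok (K * n + x) so dn
                   in so′ , subst (λ z → Done z (exec (round l) (toℕ (fromℕ< x<n) ∷ env ν) h)) (sym (+-suc (K * n) x)) dn′) })
        in so , subst (λ z → Done z (exec (rounds (suc K) l) (env ν) h₀)) (+-comm (K * n) n) dn

      some-ok : ∀ {V} (φ : Fm (Var N T)) (l : T → Fin V) ν → (∀ t → lookup ν (l t) ≡ τ t) → ∀ {h} → Agree h →
                ⟦ some φ l ⟧ (env ν) h ≢ 0 ⇔ (∃[ c ] Marked h c × ⟦ φ ⟧ᶠ (view c c))
      some-ok {V} φ l ν l-ok {h} ag = sums≢0 m (andₑ (get (cell (_↑ˡ V))) (tr φ (alone l))) ν h ∙ mk⇔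
        (λ (c , p) → let q , r = Equivalence.to (and≢0 {h (⟦ cell (_↑ˡ V) ⟧ (env (c Vec.++ ν)) h)}) p in
          c , subst (λ z → h z ≢ 0) (cell-ok l ν l-ok c ν h) q , Equivalence.to (here-ok l ν l-ok φ c ag) r)
        (λ (c , q , r) → c , Equivalence.from (and≢0 {h (⟦ cell (_↑ˡ V) ⟧ (env (c Vec.++ ν)) h)})
          (subst (λ z → h z ≢ 0) (sym (cell-ok l ν l-ok c ν h)) q , Equivalence.from (here-ok l ν l-ok φ c ag) r))

-- Walks and the truncated distance

module _ {n} (G : Graph n) where
  open Graph G

  snoc : ∀ {u v w} → Walk G u v → v ~ w → Walk G u w
  snoc halt       f = f ◅ halt
  snoc (e ◅ w) f = e ◅ snoc w f

  length-snoc : ∀ {u v w} (p : Walk G u v) (f : v ~ w) → walkLength G (snoc p f) ≡ suc (walkLength G p)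
  length-snoc halt       f = refl
  length-snoc (e ◅ p) f = cong suc (length-snoc p f)

  reverse : ∀ {u v} → Walk G u v → Walk G v u
  reverse halt       = halt
  reverse (e ◅ w) = snoc (reverse w) (~-sym e)

  length-reverse : ∀ {u v} (w : Walk G u v) → walkLength G (reverse w) ≡ walkLength G w
  length-reverse halt       = refl
  length-reverse (e ◅ w) = trans (length-snoc (reverse w) _) (cong suc (length-reverse w))

  length-◅◅ : ∀ {u v w} (p : Walk G u v) (q : Walk G v w) → walkLength G (p ◅◅ q) ≡ walkLength G p + walkLength G q
  length-◅◅ halt       q = refl
  length-◅◅ (e ◅ p) q = cong suc (length-◅◅ p q)

  ∈-snoc : ∀ {u v w z} (p : Walk G u v) (f : v ~ w) → z ∈ walkVertices G (snoc p f) → z ∈ walkVertices G p ⊎ z ≡ w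
  ∈-snoc halt       f (here e)         = inj₁ (here e)
  ∈-snoc halt       f (there (here e)) = inj₂ e
  ∈-snoc (e ◅ p) f (here q)         = inj₁ (here q)
  ∈-snoc (e ◅ p) f (there q) with ∈-snoc p f q
  ... | inj₁ r = inj₁ (there r)
  ... | inj₂ r = inj₂ r

  start∈ : ∀ {u v} (w : Walk G u v) → u ∈ walkVertices G w
  start∈ halt       = here refl
  start∈ (e ◅ w) = here refl

  ∈-reverse : ∀ {u v z} (w : Walk G u v) → z ∈ walkVertices G (reverse w) → z ∈ walkVertices G w
  ∈-reverse halt       q = q
  ∈-reverse (e ◅ w) q with ∈-snoc (reverse w) (~-sym e) q
  ... | inj₁ r = there (∈-reverse w r)
  ... | inj₂ refl = here refl

  ∈-◅◅ : ∀ {u v w z} (p : Walk G u v) (q : Walk G v w) → z ∈ walkVertices G (p ◅◅ q) →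
         z ∈ walkVertices G p ⊎ z ∈ walkVertices G q
  ∈-◅◅ halt       q r         = inj₂ r
  ∈-◅◅ (e ◅ p) q (here r)  = inj₁ (here r)
  ∈-◅◅ (e ◅ p) q (there r) with ∈-◅◅ p q r
  ... | inj₁ s = inj₁ (there s)
  ... | inj₂ s = inj₂ s

  -- D is the distance, cut off at n; in particular it is n between
  -- vertices in different components.
  record IsDist (D : Fin n → Fin n → ℕ) : Set where
    field
      D≤n      : ∀ u v → D u v ≤ n
      shortest : ∀ {u v} (w : Walk G u v) → D u v ≤ walkLength G w
      realised : ∀ {u v} → D u v < n → Σ[ w ∈ Walk G u v ] walkLength G w ≡ D u v

    D-refl : ∀ u → D u u ≡ 0
    D-refl u = n≤0⇒n≡0 (shortest halt)

    D-sym≤ : ∀ u v → D u v ≤ D v u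
    D-sym≤ u v with D v u <? n
    ... | yes l = let w , e = realised l in ≤-trans (shortest (reverse w)) (≤-reflexive (trans (length-reverse w) e))
    ... | no l  = ≤-trans (D≤n u v) (≮⇒≥ l)

    D-sym : ∀ u v → D u v ≡ D v u
    D-sym u v = ≤-antisym (D-sym≤ u v) (D-sym≤ v u)

    -- Truncation is harmless: a summand that reaches n bounds every distance.
    triangle : ∀ u v w → D u w ≤ D u v + D v w
    triangle u v w with D u v <? n | D v w <? n
    ... | no l  | _     = ≤-trans (D≤n u w) (≤-trans (≮⇒≥ l) (m≤m+n _ _))
    ... | yes _ | no l  = ≤-trans (D≤n u w) (≤-trans (≮⇒≥ l) (m≤n+m _ _))
    ... | yes l | yes l′ = let p , e = realised l ; q , e′ = realised l′ in
      ≤-trans (shortest (p ◅◅ q)) (≤-reflexive (trans (length-◅◅ p q) (cong₂ _+_ e e′)))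

    D≡0 : ∀ {u v} → D u v ≤ 0 → u ≡ v
    D≡0 {u} {v} l with realised (≤-<-trans l (≤-<-trans z≤n (Fin.toℕ<n u)))
    ... | halt     , e = refl
    ... | _ ◅ w , e = contradiction (trans e (n≤0⇒n≡0 l)) λ ()

    D-edge : ∀ {u v} → u ~ v → D u v ≤ 1
    D-edge e = shortest (e ◅ halt)

    -- A distance is known to be realised only if it is below n. For n = 1 the value 1 could be the
    -- cut-off, but then there is only one vertex.
    D≤1 : ∀ {u v} → D u v ≤ 1 → u ≡ v ⊎ u ~ v
    D≤1 {u} {v} l with n ≟ 1
    D≤1 {zero} {zero} l | yes refl = inj₁ refl
    ... | no n≢1 with realised (≤-<-trans l (≤∧≢⇒< (≤-trans (s≤s z≤n) (Fin.toℕ<n u)) (≢-sym n≢1)))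
    ...   | halt         , e = inj₁ refl
    ...   | f ◅ halt     , e = inj₂ f
    ...   | _ ◅ _ ◅ w , e = contradiction (≤-trans (≤-reflexive e) l) λ { (s≤s ()) }

-- Computing the distances

∑-≤ : ∀ {f g : ℕ → ℕ} m → (∀ {x} → x < m → f x ≤ g x) → ∑ m f ≤ ∑ m g
∑-≤ zero    l = z≤n
∑-≤ (suc m) l = +-mono-≤ (∑-≤ m (l ∘ m<n⇒m<1+n)) (l ≤-refl)

-- For an upward closed condition, the number of failures below n is the least witness, or n if
-- there is none. So a minimum becomes a sum, and the cut-off at n arises by itself.
module Counting (n : ℕ) (f : ℕ → ℕ) (up : ∀ {x y} → x ≤ y → y < n → f x ≢ 0 → f y ≢ 0) where

  count : ℕ → ℕ
  count m = ∑ m (λ x → 1 ∸ f x)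

  count≤ : ∀ m → count m ≤ m
  count≤ m = ≤-trans (∑-≤ m (λ {x} _ → m∸n≤m 1 (f x))) (≤-reflexive (trans (∑-const m 1) (*-identityʳ m)))

  count-bound : ∀ m {l} → m ≤ n → f l ≢ 0 → count m ≤ l
  count-bound m {l} m≤n p with m ≤? l
  ... | yes m≤l = ≤-trans (count≤ m) m≤l
  count-bound zero    {l} m≤n p | no m≰l = z≤n
  count-bound (suc m) {l} m<n p | no m≰l = ≤-trans
    (+-monoʳ-≤ (count m) (≤-reflexive (gone (up (s≤s⁻¹ (≰⇒> m≰l)) m<n p))))
    (≤-trans (≤-reflexive (+-identityʳ (count m))) (count-bound m (<⇒≤ m<n) p))
    where
    gone : ∀ {a} → a ≢ 0 → 1 ∸ a ≡ 0
    gone {zero}  q = contradiction refl q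
    gone {suc a} q = 0∸n≡0 a

  count-attained : count n < n → f (count n) ≢ 0
  count-attained l z = <⇒≱ ≤-refl (≤-trans full (mono l))
    where
    open import Relation.Nullary.Decidable using (decidable-stable)
    ones : ∀ j → j ≤ suc (count n) → ∑ j (λ x → 1 ∸ f x) ≡ j
    ones zero    _ = refl
    ones (suc j) (s≤s j≤) = trans (cong₂ _+_ (ones j (m≤n⇒m≤1+n j≤))
      (cong (1 ∸_) (decidable-stable (_ ≟ 0) (λ q → up j≤ l q z)))) (+-comm j 1)
    full : suc (count n) ≤ count (suc (count n))
    full = ≤-reflexive (sym (ones (suc (count n)) ≤-refl))
    mono : ∀ {i j} → i ≤ j → count i ≤ count j
    mono {i} {j} i≤j with m≤n⇒m<n∨m≡n i≤j
    ... | inj₂ refl = ≤-refl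
    mono {i} {suc j} i≤j | inj₁ (s≤s l) = ≤-trans (mono l) (m≤m+n _ _)

module DistPhase (k : ℕ) where

  noD : ∀ {V} → Fin V → Fin V → Expr (V + 1)
  noD _ _ = con 0

  address : ∀ {V} → Fin V → Fin V → Expr (V + 1)
  address {V} i j = var (V ↑ʳ zero) ⊕ (sum<n {V + 1} (var (suc i ↑ˡ 1)) ⊕ var (j ↑ˡ 1))

  -- The first conjunct tests that the vertices differ, because the stored diagonal is arbitrary.
  tE : ∀ {V} → Fin V → Fin V → Expr (V + 1)
  tE i j = andₑ ((var (i ↑ˡ 1) ⊖ var (j ↑ˡ 1)) ⊕ (var (j ↑ˡ 1) ⊖ var (i ↑ˡ 1))) (get (address i j))

  base : ∀ V → Expr (V + 1)
  base V = var (V ↑ʳ zero) ⊕ sum<n (sum<n (con 1))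

  pattern X = zero
  pattern U = suc zero
  pattern Z = suc (suc zero)

  same : Var (Fin 3) ⊥ → Var (Fin 3) ⊥ → Fm (Var (Fin 3) ⊥)
  same a b = val a ≼ val b ∧ val b ≼ val a

  -- A configuration (x, u, z) is reachable if there is a walk from u to z
  -- of length at most x.
  init stepᶠ : Fm (Var (Fin 3) ⊥)
  init  = same (new U) (new Z)
  stepᶠ = (val (old X) ∔ lit 1 ≼ val (new X)) ∧ same (old Z) (new Z) ∧ edge (new U) (old U)

  open Reach noD tE 3 {T = ⊥} id init stepᶠ base public

  phase : Stmt (k * 2 + 1)
  phase = rounds 1 (λ ())

  corner : ∀ {V} → Fin V → Fin V → Fin 3 → Fin (suc V)
  corner i j X = zero
  corner i j U = suc i
  corner i j Z = suc j

  -- Counts the lengths x below n for which no walk of length at most x has been marked.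
  tD : ∀ {V} → Fin V → Fin V → Expr (V + 1)
  tD {V} i j = sum<n (con 1 ⊖ get (cell {suc V} (corner i j)))

  module _ {n} (G : Graph n) (X₀ : ℕ) (h₀ : Heap)
           (edges : ∀ {u v} → u ≢ v → h₀ (X₀ + (toℕ u * n + toℕ v)) ≡ (if does (Graph._~?_ G u v) then 1 else 0))
           (blank : ∀ {x} → X₀ + n * n ≤ x → h₀ x ≡ 0) where
    open Graph G
    open Semantics n
    open Environment n X₀
    open Correct n X₀ (λ _ _ → 0) _~_ (X₀ + n * n) h₀

    private
      base-ok : ∀ {V} (ν : Vec (Fin n) V) h → ⟦ base V ⟧ (env ν) h ≡ X₀ + n * n
      base-ok ν h = cong₂ _+_ (env-X ν) (trans (∑-const n (∑ n (λ _ → 1)))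
        (cong (n *_) (trans (∑-const n 1) (*-identityʳ n))))

    tE-ok : ∀ {V} (ν : Vec (Fin n) V) i j {h} → Agree h → ⟦ tE i j ⟧ (env ν) h ≢ 0 ⇔ (lookup ν i ~ lookup ν j)
    tE-ok {V} ν i j {h} ag
      rewrite env-X ν | env-lookup ν i | env-lookup ν j | ∑-const n (toℕ (lookup ν i)) | *-comm n (toℕ (lookup ν i))
      = and≢0 {(a ∸ b) + (b ∸ a)} ∙ mk⇔ (λ (p , q) → to (u≢v p) (λ z → q (trans (val-ok (u≢v p)) z)))
          (λ e → let p = λ q → ~-irrefl q e in
            (λ z → p (Fin.toℕ-injective (≤-antisym (m∸n≡0⇒m≤n (m+n≡0⇒m≡0 (a ∸ b) z)) (m∸n≡0⇒m≤n (m+n≡0⇒n≡0 (a ∸ b) z))))) ,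
            λ z → from e (trans (sym (val-ok p)) z))
      where
      u = lookup ν i
      v = lookup ν j
      a = toℕ u
      b = toℕ v
      u≢v : (a ∸ b) + (b ∸ a) ≢ 0 → u ≢ v
      u≢v p e = p (cong₂ _+_ (m≤n⇒m∸n≡0 (≤-reflexive (cong toℕ e))) (m≤n⇒m∸n≡0 (≤-reflexive (cong toℕ (sym e)))))
      val-ok : u ≢ v → h (X₀ + (a * n + b)) ≡ (if does (u ~? v) then 1 else 0)
      val-ok p = trans (ag (+-monoʳ-< X₀ (digits-bound (Fin.toℕ<n u) (Fin.toℕ<n v)))) (edges p)
      to : u ≢ v → (if does (u ~? v) then 1 else 0) ≢ 0 → u ~ v
      to _ p with u ~? v
      ... | yes e = e
      ... | no _  = contradiction refl p
      from : u ~ v → (if does (u ~? v) then 1 else 0) ≢ 0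
      from e with u ~? v
      ... | yes _ = λ ()
      ... | no ¬e = contradiction e ¬e

    private
      τ : ⊥ → Fin n
      τ ()

      ok = rounds-ok base-ok (λ _ _ _ _ → refl) tE-ok blank τ

    module _ (ν : Vec (Fin n) (k * 2)) where

      heap : Heap
      heap = exec phase (env ν) h₀

      private
        sd = ok {k * 2} (λ ()) ν (λ ()) 1
        open Sound (proj₁ sd)

        mark : ℕ → Fin n → Fin n → ℕ
        mark x u v = heap (X₀ + n * n + (n * (n * (n * 0 + toℕ v) + toℕ u) + x))

        Re : ℕ → Fin n → Fin n → Fin n → Set
        Re r x u v = ReachIn base-ok (λ _ _ _ _ → refl) tE-ok blank τ r (x ∷ u ∷ v ∷ [])

        to-walk : ∀ {r x u v} → Re r x u v → Σ[ w ∈ Walk G u v ] walkLength G w ≤ toℕ x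
        to-walk (start (p , q)) with Fin.toℕ-injective (≤-antisym p q)
        ... | refl = halt , z≤n
        to-walk (more {c′ = x′ ∷ u′ ∷ v′ ∷ []} re (l , (p , q) , e)) with Fin.toℕ-injective (≤-antisym p q)
        ... | refl = let w , l′ = to-walk re in
          e ◅ w , ≤-trans (s≤s l′) (≤-trans (≤-reflexive (+-comm 1 (toℕ x′))) l)

        from-walk : ∀ {x u v} (w : Walk G u v) → walkLength G w ≤ toℕ x → Re (walkLength G w) x u v
        from-walk halt l = start (≤-refl , ≤-refl)
        from-walk {suc x} (e ◅ w) (s≤s l) = more (from-walk {inject₁ x} w (subst (walkLength G w ≤_) (sym (Fin.toℕ-inject₁ x)) l))
          (≤-reflexive (trans (+-comm _ 1) (cong suc (Fin.toℕ-inject₁ x))) , (≤-refl , ≤-refl) , e)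

        marks-walk : ∀ x u v → mark (toℕ {n} x) u v ≢ 0 → Σ[ w ∈ Walk G u v ] walkLength G w ≤ toℕ x
        marks-walk x u v p = to-walk (proj₂ (reached (x ∷ u ∷ v ∷ []) p))

        walk-marks : ∀ x u v (w : Walk G u v) → walkLength G w ≤ toℕ {n} x → mark (toℕ x) u v ≢ 0
        walk-marks x u v w l = proj₂ sd (≤-<-trans l (<-≤-trans (Fin.toℕ<n x) (≤-reflexive (sym (+-identityʳ n))))) (from-walk w l)

      Dist : Fin n → Fin n → ℕ
      Dist u v = ∑ n (λ x → 1 ∸ mark x u v)

      private
        at : ∀ {x} (x<n : x < n) {u v} → mark x u v ≢ 0 ⇔ (Σ[ w ∈ Walk G u v ] walkLength G w ≤ x)
        at {x} x<n {u} {v} = subst (λ y → mark y u v ≢ 0 ⇔ (Σ[ w ∈ Walk G u v ] walkLength G w ≤ y)) (Fin.toℕ-fromℕ< x<n)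
          (mk⇔ (marks-walk (fromℕ< x<n) u v) (λ (w , l) → walk-marks (fromℕ< x<n) u v w l))

        mark-up : ∀ u v {x y} → x ≤ y → y < n → mark x u v ≢ 0 → mark y u v ≢ 0
        mark-up u v x≤y y<n p = Equivalence.from (at y<n)
          (let w , l = Equivalence.to (at (≤-<-trans x≤y y<n)) p in w , ≤-trans l x≤y)

        module C u v = Counting n (λ x → mark x u v) (mark-up u v)

      isDist : IsDist G Dist
      isDist = record { D≤n = λ u v → C.count≤ u v n ; shortest = sh ; realised = re }
        where
        sh : ∀ {u v} (w : Walk G u v) → Dist u v ≤ walkLength G w
        sh {u} {v} w with walkLength G w <? n
        ... | yes l = C.count-bound u v n ≤-refl (Equivalence.from (at l) (w , ≤-refl))
        ... | no l  = ≤-trans (C.count≤ u v n) (≮⇒≥ l)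
        re : ∀ {u v} → Dist u v < n → Σ[ w ∈ Walk G u v ] walkLength G w ≡ Dist u v
        re {u} {v} l = let w , l′ = Equivalence.to (at l) (C.count-attained u v l) in w , ≤-antisym l′ (sh w)

      tD-ok : ∀ {V} (ν′ : Vec (Fin n) V) i j {h} → (∀ {x} → x < X₀ + n * n + n ^ 3 → h x ≡ heap x) →
              ⟦ tD i j ⟧ (env ν′) h ≡ Dist (lookup ν′ i) (lookup ν′ j)
      tD-ok {V} ν′ i j {h} ag = ∑-cong′ n λ {x} x<n → cong (1 ∸_)
        (trans (cong h (trans (cong (λ y → ⟦ cell {suc V} f ⟧ (y ∷ env ν′) h) (sym (Fin.toℕ-fromℕ< x<n)))
           (cong₂ _+_ (base-ok (fromℕ< x<n ∷ ν′) h)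
             (idx-value′ f (fromℕ< x<n ∷ ν′) (fromℕ< x<n ∷ lookup ν′ i ∷ lookup ν′ j ∷ []) h
               λ { X → refl ; U → refl ; Z → refl }))))
        (trans (ag (+-monoʳ-< (X₀ + n * n) (enc-bound (fromℕ< x<n ∷ lookup ν′ i ∷ lookup ν′ j ∷ []))))
          (cong (λ y → mark y (lookup ν′ i) (lookup ν′ j)) (Fin.toℕ-fromℕ< x<n))))
        where
        open Loops n X₀ using () renaming (idx-value to idx-value′; ∑-cong to ∑-cong′)
        f = corner i j

      heap-blank : ∀ {x} → X₀ + n * n + n ^ 3 ≤ x → heap x ≡ 0
      heap-blank = above

      heap-agree : ∀ {x} → x < X₀ + n * n → heap x ≡ h₀ x
      heap-agree = agree

-- Affine conditions and their signs

record Aff : Set where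
  no-eta-equality
  field
    up  : Bool
    fn  : ℤ → ℤ
    -- This characterises the maps `± x + c`, with `up` as the sign. Keeping the property instead of
    -- the constant spares a normal form for compositions.
    iso : ∀ x y → fn x ℤ.- fn y ≡ (if up then x ℤ.- y else y ℤ.- x)

open Aff public

idA : Aff
idA = record { up = true ; fn = id ; iso = λ x y → refl }

abstract
  shift-iso : ∀ x y c → (x ℤ.+ c) ℤ.- (y ℤ.+ c) ≡ x ℤ.- y
  shift-iso = ℤ.solve-∀

  mirror-iso : ∀ x y c → (c ℤ.- x) ℤ.- (c ℤ.- y) ≡ y ℤ.- x
  mirror-iso = ℤ.solve-∀

shift mirror : ℤ → Aff
shift c  = record { up = true ; fn = λ x → x ℤ.+ c ; iso = λ x y → shift-iso x y c }
mirror c = record { up = false ; fn = λ x → c ℤ.- x ; iso = λ x y → mirror-iso x y c }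

_⊙_ : Aff → Aff → Aff
A ⊙ B = record { up = if up A then up B else not′ (up B) ; fn = fn A ∘ fn B ; iso = λ x y → comp′ x y (up A) (up B) (iso A _ _) (iso B x y) }
  where
  not′ : Bool → Bool
  not′ b = if b then false else true
  flip : ∀ {x y z w : ℤ} → x ℤ.- y ≡ z ℤ.- w → y ℤ.- x ≡ w ℤ.- z
  flip {x} {y} {z} {w} e = trans (sym (neg x y)) (trans (cong ℤ.-_ e) (neg z w))
    where
    neg : ∀ x y → ℤ.- (x ℤ.- y) ≡ y ℤ.- x
    neg = ℤ.solve-∀
  comp′ : ∀ x y a b → fn A (fn B x) ℤ.- fn A (fn B y) ≡ (if a then fn B x ℤ.- fn B y else fn B y ℤ.- fn B x) →
          fn B x ℤ.- fn B y ≡ (if b then x ℤ.- y else y ℤ.- x) →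
          fn A (fn B x) ℤ.- fn A (fn B y) ≡ (if (if a then b else not′ b) then x ℤ.- y else y ℤ.- x)
  comp′ x y true  true  e f = trans e f
  comp′ x y true  false e f = trans e f
  comp′ x y false true  e f = trans e (flip {fn B x} {fn B y} {x} {y} f)
  comp′ x y false false e f = trans e (flip {fn B x} {fn B y} {y} {x} f)

-- Nondecreasing as long as the first coordinate runs at full speed.
cut : Aff → Aff → ℤ → ℤ → ℤ
cut A B p q = if up A then fn A p ℤ.- fn B q else fn B q ℤ.- fn A p

cut-zero : ∀ A B {p q} → fn A p ≡ fn B q → cut A B p q ≡ ℤ.0ℤ
cut-zero A B e with up A
... | true  = ℤ.i≡j⇒i-j≡0 e
... | false = ℤ.i≡j⇒i-j≡0 (sym e)

zero-cut : ∀ A B {p q} → cut A B p q ≡ ℤ.0ℤ → fn A p ≡ fn B q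
zero-cut A B e with up A
... | true  = ℤ.i-j≡0⇒i≡j _ _ e
... | false = sym (ℤ.i-j≡0⇒i≡j _ _ e)

private
  cross-≤ : ∀ p x q y → y ℤ.- x ℤ.≤ q ℤ.- p → p ℤ.- x ℤ.≤ q ℤ.- y
  cross-≤ p x q y l = subst₂ ℤ._≤_ (e₁ p x y) (e₂ p q y) (ℤ.+-monoʳ-≤ (p ℤ.- y) l)
    where
    e₁ : ∀ p x y → (p ℤ.- y) ℤ.+ (y ℤ.- x) ≡ p ℤ.- x
    e₁ = ℤ.solve-∀
    e₂ : ∀ p q y → (p ℤ.- y) ℤ.+ (q ℤ.- p) ≡ q ℤ.- y
    e₂ = ℤ.solve-∀

  diff≤ : ∀ {a b m} → b ≤ a + m → ⁺ b ℤ.- ⁺ a ℤ.≤ ⁺ m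
  diff≤ {a} {b} {m} l = subst (⁺ b ℤ.- ⁺ a ℤ.≤_) (e (⁺ a) (⁺ m)) (ℤ.+-monoˡ-≤ (ℤ.- (⁺ a)) (ℤ.+≤+ l))
    where
    e : ∀ a m → (a ℤ.+ m) ℤ.- a ≡ m
    e = ℤ.solve-∀

  fn-diff : ∀ A {a b m} → b ≤ a + m → a ≤ b + m → fn A (⁺ b) ℤ.- fn A (⁺ a) ℤ.≤ ⁺ m
  fn-diff A {a} {b} l l′ rewrite iso A (⁺ b) (⁺ a) with up A
  ... | true  = diff≤ l
  ... | false = diff≤ {b} {a} l′

-- `fn A` moves by exactly m in the direction of its sign, `fn B` by at most m either way, and `cut`
-- orients the difference so that the first motion is upwards.
cut-mono : ∀ A B p {m a b} → b ≤ a + m → a ≤ b + m → cut A B (⁺ p) (⁺ a) ℤ.≤ cut A B (⁺ (p + m)) (⁺ b)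
cut-mono A B p {m} {a} {b} l l′ with up A | iso A (⁺ (p + m)) (⁺ p) | iso A (⁺ p) (⁺ (p + m))
... | true  | e | _ = cross-≤ (fn A (⁺ p)) (fn B (⁺ a)) (fn A (⁺ (p + m))) (fn B (⁺ b))
  (ℤ.≤-trans (fn-diff B l l′) (ℤ.≤-reflexive (sym (trans e (lemma (⁺ p) (⁺ m))))))
  where
  lemma : ∀ p m → (p ℤ.+ m) ℤ.- p ≡ m
  lemma = ℤ.solve-∀
... | false | e | f = ℤ.≤-trans (ℤ.≤-reflexive (neg (fn B (⁺ a)) (fn A (⁺ p)))) (ℤ.≤-trans
  (cross-≤ (ℤ.- fn A (⁺ p)) (ℤ.- fn B (⁺ a)) (ℤ.- fn A (⁺ (p + m))) (ℤ.- fn B (⁺ b))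
    (ℤ.≤-trans (ℤ.≤-reflexive (neg′ (fn B (⁺ b)) (fn B (⁺ a)))) (ℤ.≤-trans (fn-diff B {b} {a} l′ l)
      (ℤ.≤-reflexive (sym (trans (neg′ (fn A (⁺ (p + m))) (fn A (⁺ p))) (trans f (lemma (⁺ p) (⁺ m)))))))))
  (ℤ.≤-reflexive (sym (neg (fn B (⁺ b)) (fn A (⁺ (p + m)))))))
  where
  lemma : ∀ p m → (p ℤ.+ m) ℤ.- p ≡ m
  lemma = ℤ.solve-∀
  neg : ∀ x y → x ℤ.- y ≡ (ℤ.- y) ℤ.- (ℤ.- x)
  neg = ℤ.solve-∀
  neg′ : ∀ x y → (ℤ.- x) ℤ.- (ℤ.- y) ≡ y ℤ.- x
  neg′ = ℤ.solve-∀

-- The sign as a natural number, so that many signs can be added up: a sum of nondecreasing terms is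
-- constant only if each term is.
rk : ℤ → ℕ
rk -[1+ _ ]    = 0
rk (⁺ zero)    = 1
rk (⁺ (suc _)) = 2

rk≤2 : ∀ z → rk z ≤ 2
rk≤2 -[1+ _ ]    = z≤n
rk≤2 (⁺ zero)    = s≤s z≤n
rk≤2 (⁺ (suc _)) = ≤-refl

rk-mono : ∀ {x y} → x ℤ.≤ y → rk x ≤ rk y
rk-mono (ℤ.-≤- _) = z≤n
rk-mono ℤ.-≤+ = z≤n
rk-mono {⁺ zero} {⁺ zero}  (ℤ.+≤+ l) = ≤-refl
rk-mono {⁺ zero} {⁺ suc y} (ℤ.+≤+ l) = s≤s z≤n
rk-mono {⁺ suc x} {⁺ suc y} (ℤ.+≤+ l) = ≤-refl

rk-zero : ∀ {z} → rk z ≡ 1 → z ≡ ℤ.0ℤ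
rk-zero {⁺ zero} e = refl

rk-squeeze : ∀ {x y z} → x ℤ.≤ y → y ℤ.≤ z → rk x ≡ rk z → rk y ≡ rk x
rk-squeeze l l′ e = ≤-antisym (≤-trans (rk-mono l′) (≤-reflexive (sym e))) (rk-mono l)

-- Separating a rising from a falling curve

record Separation (L L′ : ℕ) (u w u′ w′ : ℕ → ℕ) : Set where
  field
    c c₁ c₂ : ℕ
    -- With u as abscissa and w as height: left of the vertical line `c`, the first curve stays
    -- below height `c₁` and the second above it; to the right, the second stays below `c₂` and the
    -- first above it. A point caught between both curves is thus on one of three lines.
    low     : ∀ {a} → a ≤ L → u a < c → w a ≤ c₁
    low′    : ∀ {b} → b ≤ L′ → u′ b < c → c₁ ≤ w′ b
    high′   : ∀ {b} → b ≤ L′ → c < u′ b → w′ b ≤ c₂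
    high    : ∀ {a} → a ≤ L → c < u a → c₂ ≤ w a

module Crossing (L L′ : ℕ) (u w u′ w′ : ℕ → ℕ)
  (u-mono  : ∀ {a b} → a ≤ b → b ≤ L → u a ≤ u b)
  (w-mono  : ∀ {a b} → a ≤ b → b ≤ L → w a ≤ w b)
  (u′-anti : ∀ {a b} → a ≤ b → b ≤ L′ → u′ b ≤ u′ a)
  (w′-mono : ∀ {a b} → a ≤ b → b ≤ L′ → w′ a ≤ w′ b) where

  Below : ℕ → Set
  Below c = ∀ {a b} → a ≤ L → b ≤ L′ → u a < c → u′ b < c → w a ≤ w′ b

  below? : ∀ c → Below c ⊎ (∃[ a ] ∃[ b ] a ≤ L × b ≤ L′ × u a < c × u′ b < c × w′ b < w a)
  below? c with anyUpTo? (λ a → anyUpTo? (λ b → (u a <? c) ×-dec (u′ b <? c) ×-dec (w′ b <? w a)) (suc L′)) (suc L)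
    where open import Relation.Nullary.Decidable using (_×-dec_)
  ... | yes (a , s≤s l , b , s≤s l′ , p , q , r) = inj₂ (a , b , l , l′ , p , q , r)
  ... | no f = inj₁ λ {a} {b} l l′ p q → ≮⇒≥ λ r → f (a , s≤s l , b , s≤s l′ , p , q , r)

  -- If nothing satisfies `Q`, the default 0 is still the least upper bound, so `c₁` and `c₂` exist
  -- also when a side is empty.
  maximum : ∀ L (w : ℕ → ℕ) {Q : ℕ → Set} → (∀ a → Dec (Q a)) →
            ∃[ m ] (∀ {a} → a ≤ L → Q a → w a ≤ m) × (∀ {v} → (∀ {a} → a ≤ L → Q a → w a ≤ v) → m ≤ v)
  maximum zero w Q? with Q? 0
  ... | yes q = w 0 , (λ { z≤n _ → ≤-refl }) , λ f → f z≤n q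
  ... | no ¬q = 0 , (λ { z≤n q → contradiction q ¬q }) , λ _ → z≤n
  maximum (suc L) w Q? with maximum L w Q? | Q? (suc L)
  ... | m , f , g | yes q = m ⊔ w (suc L) ,
    (λ l r → case m≤n⇒m<n∨m≡n l of λ { (inj₁ (s≤s l)) → ≤-trans (f l r) (m≤m⊔n m _) ; (inj₂ refl) → m≤n⊔m m _ }) ,
    λ h → ⊔-lub (g (λ l → h (m≤n⇒m≤1+n l))) (h ≤-refl q)
  ... | m , f , g | no ¬q = m ,
    (λ l r → case m≤n⇒m<n∨m≡n l of λ { (inj₁ (s≤s l)) → f l r ; (inj₂ refl) → contradiction r ¬q }) ,
    λ h → g (λ l → h (m≤n⇒m≤1+n l))

  private
    separation-at : ∀ c → Below c → (∀ {a b} → a ≤ L → b ≤ L′ → c < u a → c < u′ b → w′ b ≤ w a) → Separation L L′ u w u′ w′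
    separation-at c lo hi = record
      { c = c ; c₁ = proj₁ m₁ ; c₂ = proj₁ m₂
      ; low = proj₁ (proj₂ m₁) ; low′ = λ l p → proj₂ (proj₂ m₁) (λ l₁ q → lo l₁ l q p)
      ; high′ = proj₁ (proj₂ m₂) ; high = λ l p → proj₂ (proj₂ m₂) (λ l₁ q → hi l l₁ p q) }
      where
      m₁ = maximum L w (λ a → u a <? c)
      m₂ = maximum L′ w′ (λ b → c <? u′ b)

    search : ∀ c → Separation L L′ u w u′ w′ ⊎ Below c
    search zero = inj₂ (λ _ _ ())
    search (suc c) with search c
    ... | inj₁ s = inj₁ s
    ... | inj₂ lo with below? (suc c)
    ...   | inj₁ lo′ = inj₂ lo′
    ...   | inj₂ (a , b , a≤L , b≤L′ , s≤s p , s≤s q , r) = inj₁ (separation-at c lo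
      -- To the right of `c`, the point a′ comes after a and b′ comes before b, because u rises on
      -- the first curve and falls on the second. Hence w′ b′ ≤ w′ b < w a ≤ w a′.
      λ {a′} {b′} l l′ p′ q′ → ≤-trans
        (w′-mono (≮⇒≥ λ b<b′ → <⇒≱ (≤-<-trans q q′) (u′-anti (<⇒≤ b<b′) l′)) b≤L′)
        (≤-trans (<⇒≤ r) (w-mono (≮⇒≥ λ a′<a → <⇒≱ (≤-<-trans p p′) (u-mono (<⇒≤ a′<a) a≤L)) l)))

  abstract
    -- c is the largest level at which the first curve passes below the second
    -- one, so the two curves change order there.
    separation : Separation L L′ u w u′ w′
    separation with search (suc (u L))
    ... | inj₁ s  = s
    -- The order never changes; at this level the first curve has no point to the right.
    ... | inj₂ lo = separation-at (suc (u L)) lo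
      λ l _ p _ → contradiction (u-mono l ≤-refl) (<⇒≱ (<-trans (n<1+n _) p))

-- Lines in subsets of the coordinates

record Line (k : ℕ) : Set where
  field
    root      : Fin k
    -- `just B` at l stands for the equation "B (d l) = d root"; `nothing` leaves coordinate l free.
    -- The root coordinate thus parametrises the line.
    part      : Vec (Maybe Aff) k
    root-part : lookup part root ≡ just idA

open Line public

support : ∀ {m} → Vec (Maybe Aff) m → ℕ
support []            = 0
support (just _ ∷ v)  = suc (support v)
support (nothing ∷ v) = support v

support≤ : ∀ {m} (v : Vec (Maybe Aff) m) → support v ≤ m
support≤ []            = z≤n
support≤ (just _ ∷ v)  = s≤s (support≤ v)
support≤ (nothing ∷ v) = m≤n⇒m≤1+n (support≤ v)

support-update : ∀ {m} (v : Vec (Maybe Aff) m) j {A} → lookup v j ≡ nothing →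
                 support (v Vec.[ j ]≔ just A) ≡ suc (support v)
support-update (nothing ∷ v) zero    e = refl
support-update (just _ ∷ v)  (suc j) e = cong suc (support-update v j e)
support-update (nothing ∷ v) (suc j) e = support-update v j e

single : ∀ {k} → Fin k → Line k
single {k} i = record
  { root = i ; part = Vec.replicate k nothing Vec.[ i ]≔ just idA
  ; root-part = Vec.lookup∘update i (Vec.replicate k nothing) (just idA) }

support-single : ∀ {k} (i : Fin k) → support (part (single i)) ≡ 1
support-single {k} i = trans (support-update (Vec.replicate k nothing) i (Vec.lookup-replicate i nothing))
  (cong suc (empty k))
  where
  empty : ∀ m → support (Vec.replicate m nothing) ≡ 0
  empty zero    = refl
  empty (suc m) = empty m

extend : ∀ {k} (ℓ : Line k) (j : Fin k) → lookup (part ℓ) j ≡ nothing → Aff → Line k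
extend ℓ j e A = record
  { root = root ℓ ; part = part ℓ Vec.[ j ]≔ just A
  ; root-part = trans (Vec.lookup∘update′ root≢j (part ℓ) (just A)) (root-part ℓ) }
  where
  root≢j : root ℓ ≢ j
  root≢j refl with trans (sym e) (root-part ℓ)
  ... | ()

attach′ : ∀ {k} (ℓ : Line k) j → Aff → Maybe Aff → ∀ m → lookup (part ℓ) j ≡ m → List (Line k)
attach′ ℓ j B (just A) nothing e = extend ℓ j e (A ⊙ B) ∷ []
attach′ ℓ j B _        _       e = []

-- The line ℓ together with the condition d i = B (d j).
attach : ∀ {k} → Line k → Fin k → Fin k → Aff → List (Line k)
attach ℓ i j B = attach′ ℓ j B (lookup (part ℓ) i) (lookup (part ℓ) j) refl

module Lines (k : ℕ) (bases : Fin k → Fin k → List Aff) where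

  attachments : Line k → List (Line k)
  attachments ℓ = concatMap (λ i → concatMap (λ j → concatMap (attach ℓ i j) (bases i j)) (allFin k)) (allFin k)

  level : ℕ → List (Line k)
  level zero    = map single (allFin k)
  level (suc t) = concatMap attachments (level t)

  -- Longer lines come first.
  levels : ℕ → List (Line k)
  levels zero    = level zero
  levels (suc t) = level (suc t) ++ levels t

  𝓛 : List (Line k)
  𝓛 = levels k

  ∈-concat : ∀ {A B : Set} (f : A → List B) {x y xs} → x ∈ xs → y ∈ f x → y ∈ concatMap f xs
  ∈-concat f {y = y} x∈ y∈ = ∈-concatMap⁺ f (Any.map (λ { refl → y∈ }) x∈)

  attach-here : ∀ (ℓ : Line k) i j B {A} → lookup (part ℓ) i ≡ just A → (e : lookup (part ℓ) j ≡ nothing) →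
                extend ℓ j e (A ⊙ B) ∈ attach ℓ i j B
  attach-here ℓ i j B {A} a e = go _ _ refl a e
    where
    open import Axiom.UniquenessOfIdentityProofs.WithK using (uip)
    go : ∀ m m′ (e′ : lookup (part ℓ) j ≡ m′) → m ≡ just A → m′ ≡ nothing →
         extend ℓ j e (A ⊙ B) ∈ attach′ ℓ j B m m′ e′
    go _ _ e′ refl refl = here (cong (λ z → extend ℓ j z (A ⊙ B)) (uip e e′))

  attach∈ : ∀ {ℓ t i j A B} → ℓ ∈ level t → lookup (part ℓ) i ≡ just A → (e : lookup (part ℓ) j ≡ nothing) →
            B ∈ bases i j → extend ℓ j e (A ⊙ B) ∈ level (suc t)
  attach∈ {ℓ} {t} {i} {j} {A} {B} ℓ∈ a e B∈ = ∈-concat attachments ℓ∈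
    (∈-concat _ (∈-allFin {k} i) (∈-concat _ (∈-allFin {k} j) (∈-concat (attach ℓ i j) B∈ (attach-here ℓ i j B a e))))

  attach-support : ∀ {ℓ ℓ′ : Line k} {i j B} → ℓ′ ∈ attach ℓ i j B → support (part ℓ′) ≡ suc (support (part ℓ))
  attach-support {ℓ} {ℓ′} {i} {j} {B} = go (lookup (part ℓ) i) (lookup (part ℓ) j) refl
    where
    go : ∀ m m′ (e : lookup (part ℓ) j ≡ m′) → ℓ′ ∈ attach′ ℓ j B m m′ e → support (part ℓ′) ≡ suc (support (part ℓ))
    go (just A) nothing e (here refl) = support-update (part ℓ) j e

  level-support : ∀ t {ℓ} → ℓ ∈ level t → support (part ℓ) ≡ suc t
  level-support zero ℓ∈ with ∈-map⁻ single ℓ∈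
  ... | i , _ , refl = support-single i
  level-support (suc t) ℓ∈ with find (∈-concatMap⁻ attachments {xs = level t} ℓ∈)
  ... | ℓ , ℓ∈′ , m with find (∈-concatMap⁻ (λ i → concatMap (λ j → concatMap (attach ℓ i j) (bases i j)) (allFin k)) {xs = allFin k} m)
  ... | i , _ , m with find (∈-concatMap⁻ (λ j → concatMap (attach ℓ i j) (bases i j)) {xs = allFin k} m)
  ... | j , _ , m with find (∈-concatMap⁻ (attach ℓ i j) {xs = bases i j} m)
  ... | B , _ , m = trans (attach-support {ℓ} {i = i} {j} {B} m) (cong suc (level-support t ℓ∈′))

  level⊆ : ∀ {t s ℓ} → t ≤ s → ℓ ∈ level t → ℓ ∈ levels s
  level⊆ {zero} {zero} l ℓ∈ = ℓ∈
  level⊆ {t} {suc s} l ℓ∈ with m≤n⇒m<n∨m≡n l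
  ... | inj₁ (s≤s l′) = ∈-++⁺ʳ (level (suc s)) (level⊆ l′ ℓ∈)
  ... | inj₂ refl     = ∈-++⁺ˡ ℓ∈

  -- A line with a free coordinate is not yet on the last level, so its prolongations belong to `𝓛`
  -- as well. This makes maximality usable in `carry`.
  full : ∀ {t ℓ j} → ℓ ∈ level t → lookup (part ℓ) j ≡ nothing → suc t < k
  full {t} {ℓ} {j} ℓ∈ e = ≤-trans (s≤s (≤-reflexive (sym (level-support t ℓ∈))))
    (≤-trans (≤-reflexive (sym (support-update (part ℓ) j {idA} e))) (support≤ (part ℓ Vec.[ j ]≔ just idA)))

  module _ (three : ∀ i j → length (bases i j) ≤ 3) where

    length-concatMap : ∀ {A B : Set} (f : A → List B) m xs → (∀ x → length (f x) ≤ m) →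
                       length (concatMap f xs) ≤ length xs * m
    length-concatMap f m []       l = z≤n
    length-concatMap f m (x ∷ xs) l = ≤-trans (≤-reflexive (List.length-++ (f x)))
      (+-mono-≤ (l x) (length-concatMap f m xs l))

    attach≤ : ∀ (ℓ : Line k) i j B → length (attach ℓ i j B) ≤ 1
    attach≤ ℓ i j B = go (lookup (part ℓ) i) (lookup (part ℓ) j) refl
      where
      go : ∀ m m′ (e : lookup (part ℓ) j ≡ m′) → length (attach′ ℓ j B m m′ e) ≤ 1
      go (just A) nothing  e = ≤-refl
      go (just A) (just _) e = z≤n
      go nothing  _        e = z≤n

    attachments≤ : ∀ ℓ → length (attachments ℓ) ≤ k * (k * 3)
    attachments≤ ℓ = ≤-trans (length-concatMap (λ i → concatMap (λ j → concatMap (attach ℓ i j) (bases i j)) (allFin k)) (k * 3) (allFin k) λ i →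
      ≤-trans (length-concatMap (λ j → concatMap (attach ℓ i j) (bases i j)) 3 (allFin k) λ j →
        ≤-trans (length-concatMap (attach ℓ i j) 1 (bases i j) (attach≤ ℓ i j))
          (≤-trans (≤-reflexive (*-identityʳ _)) (three i j)))
        (≤-reflexive (cong (_* 3) (List.length-tabulate {n = k} id))))
      (≤-reflexive (cong (_* (k * 3)) (List.length-tabulate {n = k} id)))

    level≤ : ∀ t → length (level t) ≤ k * (k * (k * 3)) ^ t
    level≤ zero    = ≤-reflexive (trans (List.length-map single (allFin k)) (trans (List.length-tabulate {n = k} id) (sym (*-identityʳ k))))
    level≤ (suc t) = ≤-trans (length-concatMap attachments (k * (k * 3)) (level t) attachments≤)
      (≤-trans (*-monoˡ-≤ (k * (k * 3)) (level≤ t)) (≤-reflexive (trans (*-assoc k _ _) (cong (k *_) (*-comm ((k * (k * 3)) ^ t) _)))))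

    levels≤ : ∀ t → 1 ≤ k → length (levels t) ≤ suc t * (k * (k * (k * 3)) ^ t)
    levels≤ zero    _   = ≤-trans (level≤ 0) (≤-reflexive (sym (+-identityʳ _)))
    levels≤ (suc t) 1≤k = ≤-trans (≤-reflexive (List.length-++ (level (suc t))))
      (+-mono-≤ (level≤ (suc t)) (≤-trans (levels≤ t 1≤k) (*-monoʳ-≤ (suc t) (*-monoʳ-≤ k
        (≤-trans (≤-reflexive (sym (*-identityˡ _))) (*-monoˡ-≤ ((k * (k * 3)) ^ t) (*-mono-≤ 1≤k (*-mono-≤ 1≤k (s≤s {n = 2} z≤n)))))))))

-- First hits, sums of ranks, and level sets

first : ∀ {A : Set} {P : A → Set} → (∀ x → Dec (P x)) → List A → Maybe A
first P? []       = nothing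
first P? (x ∷ xs) with P? x
... | yes _ = just x
... | no _  = first P? xs

first-∈ : ∀ {A : Set} {P : A → Set} (P? : ∀ x → Dec (P x)) xs {x} → first P? xs ≡ just x → x ∈ xs × P x
first-∈ P? (y ∷ xs) e with P? y
first-∈ P? (y ∷ xs) refl | yes p = here refl , p
... | no _ = let m , p = first-∈ P? xs e in there m , p

first-none : ∀ {A : Set} {P : A → Set} (P? : ∀ x → Dec (P x)) xs → first P? xs ≡ nothing → ∀ {x} → x ∈ xs → ¬ P x
first-none P? (y ∷ xs) e m p with P? y
first-none P? (y ∷ xs) e (here refl) p | no ¬p = ¬p p
first-none P? (y ∷ xs) e (there m)   p | no ¬p = first-none P? xs e m p

first-++ : ∀ {A : Set} {P : A → Set} (P? : ∀ x → Dec (P x)) xs ys →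
           (∃[ x ] first P? (xs ++ ys) ≡ just x × first P? xs ≡ just x) ⊎
           (first P? (xs ++ ys) ≡ first P? ys × first P? xs ≡ nothing)
first-++ P? []       ys = inj₂ (refl , refl)
first-++ P? (x ∷ xs) ys with P? x
... | yes _ = inj₁ (x , refl , refl)
... | no _  = first-++ P? xs ys

-- Both searches traverse the same list. The earlier hit passes the other test too, so neither can
-- be earlier.
first-agree : ∀ {A : Set} {P Q : A → Set} (P? : ∀ x → Dec (P x)) (Q? : ∀ x → Dec (Q x)) xs →
              (∀ {x} → first P? xs ≡ just x → Q x) → (∀ {x} → first Q? xs ≡ just x → P x) →
              first P? xs ≡ first Q? xs
first-agree P? Q? []       f g = refl
first-agree P? Q? (x ∷ xs) f g with P? x | Q? x
... | yes p | yes q = refl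
... | yes p | no ¬q = contradiction (f refl) ¬q
... | no ¬p | yes q = contradiction (g refl) ¬p
... | no ¬p | no ¬q = first-agree P? Q? xs f g

module _ {A : Set} (f g : A → ℕ) where

  sum-≤ : ∀ xs → (∀ {x} → x ∈ xs → f x ≤ g x) → sum (map f xs) ≤ sum (map g xs)
  sum-≤ []       l = z≤n
  sum-≤ (x ∷ xs) l = +-mono-≤ (l (here refl)) (sum-≤ xs (l ∘ there))

  -- A single strict inequality would make the sums differ, as no other term can compensate for it.
  sum-≡ : ∀ xs → (∀ {x} → x ∈ xs → f x ≤ g x) → sum (map f xs) ≡ sum (map g xs) → ∀ {x} → x ∈ xs → f x ≡ g x
  sum-≡ (x ∷ xs) l e m with m≤n⇒m<n∨m≡n (l {x} (here refl))
  ... | inj₁ lt = contradiction e (<⇒≢ (+-mono-<-≤ lt (sum-≤ xs (l ∘ there))))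
  sum-≡ (x ∷ xs) l e (here refl) | inj₂ eq = eq
  sum-≡ (x ∷ xs) l e (there m)   | inj₂ eq = sum-≡ xs (l ∘ there) (+-cancelˡ-≡ (f x) _ _ (trans e (cong (_+ sum (map g xs)) (sym eq)))) m

sum-bound : ∀ {A : Set} (f : A → ℕ) {c} xs → (∀ x → f x ≤ c) → sum (map f xs) ≤ length xs * c
sum-bound f []       l = z≤n
sum-bound f (x ∷ xs) l = +-mono-≤ (l x) (sum-bound f xs l)

rk-< : ∀ {a c} → a < c → rk (⁺ a ℤ.- ⁺ c) ≡ 0
rk-< {a} {c} l rewrite ℤ.m-n≡m⊖n a c | ℤ.⊖-< l with c ∸ a | m<n⇒0<n∸m l
... | suc _ | _ = refl

rk-> : ∀ {a c} → c < a → rk (⁺ a ℤ.- ⁺ c) ≡ 2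
rk-> {a} {c} l rewrite ℤ.m-n≡m⊖n a c | ℤ.⊖-≥ (<⇒≤ l) with a ∸ c | m<n⇒0<n∸m l
... | suc _ | _ = refl

rk-≡ : ∀ a → rk (⁺ a ℤ.- ⁺ a) ≡ 1
rk-≡ a rewrite ℤ.+-inverseʳ (⁺ a) = refl

rk-<⁻ : ∀ {a c} → rk (⁺ a ℤ.- ⁺ c) ≡ 0 → a < c
rk-<⁻ {a} {c} e with <-cmp a c
... | tri< l _ _    = l
... | tri≈ _ refl _ = contradiction (trans (sym (rk-≡ a)) e) λ ()
... | tri> _ _ l    = contradiction (trans (sym (rk-> l)) e) λ ()

rk->⁻ : ∀ {a c} → rk (⁺ a ℤ.- ⁺ c) ≡ 2 → c < a
rk->⁻ {a} {c} e with <-cmp a c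
... | tri< l _ _    = contradiction (trans (sym (rk-< l)) e) λ ()
... | tri≈ _ refl _ = contradiction (trans (sym (rk-≡ a)) e) λ ()
... | tri> _ _ l    = l

module Splitting (f : ℕ → ℕ) (L : ℕ) (mono : ∀ {a b} → a ≤ b → b ≤ L → f a ≤ f b) where

  last-equal : ∀ r b → b + r ≡ L → ∃[ e ] b ≤ e × e ≤ L × f b ≡ f e × (e ≡ L ⊎ (e < L × f b < f (suc e)))
  last-equal zero    b refl = b + 0 , m≤m+n b 0 , ≤-refl , cong f (sym (+-identityʳ b)) , inj₁ refl
  last-equal (suc r) b e with f b ≟ f (suc b)
  ... | yes p = let x , l , l′ , q , z = last-equal r (suc b) (trans (sym (+-suc b r)) e) in
    x , <⇒≤ l , l′ , trans p q , [ inj₁ , (λ (y , z) → inj₂ (y , subst (_< f (suc x)) (sym p) z)) ]′ z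
  ... | no ¬p = b , ≤-refl , <⇒≤ b<L , refl , inj₂ (b<L , ≤∧≢⇒< (mono (n≤1+n b) b<L) ¬p)
    where
    b<L : b < L
    b<L = <-≤-trans (m<m+n b (s≤s z≤n)) (≤-reflexive e)

  record Split (r b : ℕ) : Set where
    field
      lo hi  : Fin (suc r) → ℕ
      start  : lo zero ≡ b
      finish : hi (fromℕ r) ≡ L
      lo≤hi  : ∀ i → lo i ≤ hi i
      hi≤L   : ∀ i → hi i ≤ L
      level  : ∀ i → f (lo i) ≡ f (hi i)
      link   : ∀ i → lo (suc i) ≡ hi (inject₁ i) ⊎ lo (suc i) ≡ suc (hi (inject₁ i))

  cons : ∀ {r b e b′} → b ≤ e → e ≤ L → f b ≡ f e → b′ ≡ e ⊎ b′ ≡ suc e → Split r b′ → Split (suc r) b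
  cons {b = b} {e} l l′ q k s = record
    { lo = λ { zero → b ; (suc i) → lo i } ; hi = λ { zero → e ; (suc i) → hi i }
    ; start = refl ; finish = finish
    ; lo≤hi = λ { zero → l ; (suc i) → lo≤hi i } ; hi≤L = λ { zero → l′ ; (suc i) → hi≤L i }
    ; level = λ { zero → q ; (suc i) → level i }
    ; link = λ { zero → [ (λ p → inj₁ (trans start p)) , (λ p → inj₂ (trans start p)) ]′ k ; (suc i) → link i } }
    where open Split s

  -- The blocks are the level sets of f, of levels m, …, m + r; an empty
  -- one is replaced by a repetition of the current position.
  split : ∀ r m b → b ≤ L → b ≡ L ⊎ m ≤ f b → f L ≤ m + r → Split r b
  split zero m b b≤L c l = record
    { lo = λ _ → b ; hi = λ _ → L ; start = refl ; finish = refl ; lo≤hi = λ _ → b≤L ; hi≤L = λ _ → ≤-refl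
    ; level = λ _ → [ cong f , (λ p → ≤-antisym (mono b≤L ≤-refl) (≤-trans (≤-trans l (≤-reflexive (+-identityʳ m))) p)) ]′ c
    ; link = λ () }
  split (suc r) m b b≤L c l with f b ≤? m
  ... | no m< = cons ≤-refl b≤L refl (inj₁ refl) (split r (suc m) b b≤L (inj₂ (≰⇒> m<)) (≤-trans l (≤-reflexive (+-suc m r))))
  ... | yes fb≤m with last-equal (L ∸ b) b (m+[n∸m]≡n b≤L)
  ...   | e , b≤e , e≤L , q , inj₁ e≡L = cons b≤e e≤L q (inj₁ refl) (split r (suc m) e e≤L (inj₁ e≡L) (≤-trans l (≤-reflexive (+-suc m r))))
  ...   | e , b≤e , e≤L , q , inj₂ (e<L , lt) = cons b≤e e≤L q (inj₂ refl)
    (split r (suc m) (suc e) e<L (inj₂ ([ (λ b≡L → contradiction (≤-<-trans b≤e e<L) (<-irrefl b≡L)) , (λ p → ≤-<-trans p lt) ]′ c))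
      (≤-trans l (≤-reflexive (+-suc m r))))

-- Shortest paths in distance coordinates

module Geodesics (n k : ℕ) (D : Fin n → Fin n → ℕ) (D≤n : ∀ u v → D u v ≤ n) (D-refl : ∀ u → D u u ≡ 0)
  (D-sym : ∀ u v → D u v ≡ D v u) (triangle : ∀ u v w → D u w ≤ D u v + D v w)
  (γ : Fin k → ℕ → Fin n) (L : Fin k → ℕ)
  (geodesic : ∀ i {a b} → a ≤ b → b ≤ L i → D (γ i a) (γ i b) ≡ b ∸ a) where

  s : Fin k → Fin n
  s i = γ i 0

  d : Fin k → Fin n → ℕ
  d i v = D (s i) v

  -- x lies between `s i` and y. The vertices need not be on path i, so the notion also covers the
  -- metric intervals between vertices of the path.
  Forward : Fin k → Fin n → Fin n → Set
  Forward i x y = d i y ≡ d i x + D x y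

  In : Fin n → Fin n → Fin n → Set
  In x y z = D x z + D z y ≤ D x y

  forward : ∀ i {a b} → a ≤ b → b ≤ L i → Forward i (γ i a) (γ i b)
  forward i {a} {b} l l′ = trans (geodesic i z≤n l′) (trans (sym (m+[n∸m]≡n l))
    (sym (cong₂ _+_ (geodesic i z≤n (≤-trans l l′)) (geodesic i l l′))))

  -- The triangle inequalities from `s i` through x, z and y add up to an equality, so each of them
  -- is one.
  in-forward : ∀ {i x y z} → Forward i x y → In x y z → Forward i x z × Forward i z y
  in-forward {i} {x} {y} {z} f l =
    ≤-antisym (triangle (s i) x z) (+-cancelʳ-≤ (D z y) _ _ (≤-trans (≤-trans (≤-reflexive (+-assoc (d i x) (D x z) (D z y))) big) (triangle (s i) z y))) ,
    ≤-antisym (triangle (s i) z y) (≤-trans (+-monoˡ-≤ (D z y) (triangle (s i) x z)) (≤-trans (≤-reflexive (+-assoc (d i x) (D x z) (D z y))) big))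
    where
    big : d i x + (D x z + D z y) ≤ d i y
    big = ≤-trans (+-monoʳ-≤ (d i x) l) (≤-reflexive (sym f))

  F : Aff → Aff → Fin k → Fin k → Fin n → ℤ
  F A B i l v = cut A B (⁺ d i v) (⁺ d l v)

  F-mono : ∀ A B {i} l {x y} → Forward i x y → F A B i l x ℤ.≤ F A B i l y
  F-mono A B {i} l {x} {y} f rewrite f = cut-mono A B (d i x) (triangle (s l) x y)
    (≤-trans (triangle (s l) y x) (≤-reflexive (cong (d l y +_) (D-sym y x))))

  Decided : Aff → Aff → Fin k → Fin k → Fin n → Fin n → Set
  Decided A B i l x y = rk (F A B i l x) ≡ rk (F A B i l y)

  decided-in : ∀ {A B i l x y z} → Forward i x y → In x y z → Decided A B i l x y → rk (F A B i l z) ≡ rk (F A B i l x)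
  decided-in {A} {B} {i} {l} f m e = rk-squeeze (F-mono A B l (proj₁ (in-forward f m))) (F-mono A B l (proj₂ (in-forward f m))) e

  -- If intervals on two pieces decided by the conditions Bs meet, then the
  -- first piece lies on one of these conditions.
  Suffices : Fin k → Fin k → List Aff → Set
  Suffices i j Bs = ∀ {a b a′ b′ z} → a ≤ b → b ≤ L i → a′ ≤ b′ → b′ ≤ L j →
    (∀ B → B ∈ Bs → Decided idA B i j (γ i a) (γ i b)) →
    (∀ B → B ∈ Bs → Decided B idA j i (γ j a′) (γ j b′)) →
    In (γ i a) (γ i b) z → In (γ j a′) (γ j b′) z →
    ∃[ B ] B ∈ Bs × ⁺ d i (γ i a) ≡ fn B (⁺ d j (γ i a)) × ⁺ d i (γ i b) ≡ fn B (⁺ d j (γ i b))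

-- Three conditions for two paths

module Conditions (n k : ℕ) (D : Fin n → Fin n → ℕ) (D≤n : ∀ u v → D u v ≤ n) (D-refl : ∀ u → D u u ≡ 0)
  (D-sym : ∀ u v → D u v ≡ D v u) (triangle : ∀ u v w → D u w ≤ D u v + D v w)
  (γ : Fin k → ℕ → Fin n) (L : Fin k → ℕ)
  (geodesic : ∀ i {a b} → a ≤ b → b ≤ L i → D (γ i a) (γ i b) ≡ b ∸ a) where
  open Geodesics n k D D≤n D-refl D-sym triangle γ L geodesic

  W : Fin k → Fin k → Fin n → ℕ
  W i j v = d i v + d j v

  -- The difference of the two coordinates, shifted by n to stay in ℕ; this is where the distance
  -- has to be bounded. It rises along path i and falls along path j, whereas `W` rises along both.
  U : Fin k → Fin k → Fin n → ℕ
  U i j v = d i v + (n ∸ d j v)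

  private
    back : ∀ j x y → d j x ≤ d j y + D x y
    back j x y = ≤-trans (triangle (s j) y x) (≤-reflexive (cong (d j y +_) (D-sym y x)))

  W-mono : ∀ {i} j {x y} → Forward i x y → W i j x ≤ W i j y
  W-mono {i} j {x} {y} f = ≤-trans (+-monoʳ-≤ (d i x) (back j x y))
    (≤-reflexive (trans (cong (d i x +_) (+-comm (d j y) (D x y))) (trans (sym (+-assoc (d i x) (D x y) (d j y))) (cong (_+ d j y) (sym f)))))

  W-mono′ : ∀ i {j x y} → Forward j x y → W i j x ≤ W i j y
  W-mono′ i {j} {x} {y} f = subst₂ _≤_ (+-comm (d j x) (d i x)) (+-comm (d j y) (d i y)) (W-mono i f)

  U-mono : ∀ {i} j {x y} → Forward i x y → U i j x ≤ U i j y
  U-mono {i} j {x} {y} f = ≤-trans (+-monoʳ-≤ (d i x) rest)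
    (≤-reflexive (trans (sym (+-assoc (d i x) (D x y) _)) (cong (_+ (n ∸ d j y)) (sym f))))
    where
    rest : n ∸ d j x ≤ D x y + (n ∸ d j y)
    rest = ≤-trans (m≤n+o⇒m∸n≤o n (d j x) (≤-trans (m≤n+m∸n n (d j y)) (≤-trans (+-monoˡ-≤ _ (triangle (s j) x y))
      (≤-reflexive (+-assoc (d j x) (D x y) _))))) ≤-refl

  U-anti : ∀ i {j x y} → Forward j x y → U i j y ≤ U i j x
  U-anti i {j} {x} {y} f = ≤-trans (+-monoˡ-≤ (n ∸ d j y) (triangle (s i) x y))
    (≤-reflexive (trans (+-assoc (d i x) (D x y) _) (cong (d i x +_)
      (trans (cong (λ z → D x y + (n ∸ z)) f) (trans (sym (+-∸-assoc (D x y) {n} {d j x + D x y} (subst (_≤ n) f (D≤n (s j) y))))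
        (trans (cong ((D x y + n) ∸_) (+-comm (d j x) (D x y))) ([m+n]∸[m+o]≡n∸o (D x y) n (d j x))))))))

  abstract
    separate : ∀ i j → Separation (L i) (L j) (U i j ∘ γ i) (W i j ∘ γ i) (U i j ∘ γ j) (W i j ∘ γ j)
    separate i j = Crossing.separation (L i) (L j) (U i j ∘ γ i) (W i j ∘ γ i) (U i j ∘ γ j) (W i j ∘ γ j)
      (λ l l′ → U-mono j (forward i l l′)) (λ l l′ → W-mono j (forward i l l′))
      (λ l l′ → U-anti i (forward j l l′)) (λ l l′ → W-mono′ i (forward j l l′))

  module Sep (i j : Fin k) = Separation (separate i j)

  -- The lines U = c, W = c₁ and W = c₂ of the separation, each solved for `d i`; subtracting n
  -- undoes the shift in `U`.
  parallel rising falling : Fin k → Fin k → Aff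
  parallel i j = shift (⁺ Sep.c i j ℤ.- ⁺ n)
  rising   i j = mirror (⁺ Sep.c₁ i j)
  falling  i j = mirror (⁺ Sep.c₂ i j)

  bases : Fin k → Fin k → List Aff
  bases i j = parallel i j ∷ rising i j ∷ falling i j ∷ []

  private
    U-cast : ∀ i j v → ⁺ U i j v ≡ ⁺ d i v ℤ.+ (⁺ n ℤ.- ⁺ d j v)
    U-cast i j v = trans (ℤ.pos-+ (d i v) (n ∸ d j v)) (cong (λ z → ⁺ d i v ℤ.+ z)
      (trans (sym (ℤ.⊖-≥ (D≤n (s j) v))) (sym (ℤ.m-n≡m⊖n n (d j v)))))

    F-parallel : ∀ i j v → F idA (parallel i j) i j v ≡ ⁺ U i j v ℤ.- ⁺ Sep.c i j
    F-parallel i j v = trans (e (⁺ d i v) (⁺ d j v) (⁺ n) (⁺ Sep.c i j)) (cong (ℤ._- ⁺ Sep.c i j) (sym (U-cast i j v)))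
      where
      e : ∀ p q n c → p ℤ.- (q ℤ.+ (c ℤ.- n)) ≡ (p ℤ.+ (n ℤ.- q)) ℤ.- c
      e = ℤ.solve-∀

    F-parallel′ : ∀ i j v → F (parallel i j) idA j i v ≡ ⁺ Sep.c i j ℤ.- ⁺ U i j v
    F-parallel′ i j v = trans (e (⁺ d i v) (⁺ d j v) (⁺ n) (⁺ Sep.c i j)) (cong (λ y → ⁺ Sep.c i j ℤ.- y) (sym (U-cast i j v)))
      where
      e : ∀ p q n c → (q ℤ.+ (c ℤ.- n)) ℤ.- p ≡ c ℤ.- (p ℤ.+ (n ℤ.- q))
      e = ℤ.solve-∀

    F-mirror : ∀ i j v c → F idA (mirror (⁺ c)) i j v ≡ ⁺ W i j v ℤ.- ⁺ c
    F-mirror i j v c = trans (e (⁺ d i v) (⁺ d j v) (⁺ c)) (cong (ℤ._- ⁺ c) (sym (ℤ.pos-+ (d i v) (d j v))))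
      where
      e : ∀ p q c → p ℤ.- (c ℤ.- q) ≡ (p ℤ.+ q) ℤ.- c
      e = ℤ.solve-∀

  module Base (i j : Fin k) {a b a′ b′ z} (l₁ : a ≤ b) (l₂ : b ≤ L i) (l₁′ : a′ ≤ b′) (l₂′ : b′ ≤ L j)
    (decP : Decided idA (parallel i j) i j (γ i a) (γ i b))
    (decR : Decided idA (rising i j) i j (γ i a) (γ i b))
    (decF : Decided idA (falling i j) i j (γ i a) (γ i b))
    (decP′ : Decided (parallel i j) idA j i (γ j a′) (γ j b′))
    (m : In (γ i a) (γ i b) z) (m′ : In (γ j a′) (γ j b′) z) where

    private
      f : Forward i (γ i a) (γ i b)
      f = forward i l₁ l₂
      f′ : Forward j (γ j a′) (γ j b′)
      f′ = forward j l₁′ l₂′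

    On-base : Aff → Set
    On-base B = ⁺ d i (γ i a) ≡ fn B (⁺ d j (γ i a)) × ⁺ d i (γ i b) ≡ fn B (⁺ d j (γ i b))

    -- A condition that vanishes at z vanishes at both ends, because its sign is constant on the
    -- piece and z lies in the interval of the piece.
    on-base : ∀ B → Decided idA B i j (γ i a) (γ i b) → rk (F idA B i j z) ≡ 1 → On-base B
    on-base B dec r =
      zero-cut idA B {⁺ d i (γ i a)} {⁺ d j (γ i a)} (rk-zero q) ,
      zero-cut idA B {⁺ d i (γ i b)} {⁺ d j (γ i b)} (rk-zero (trans (sym dec) q))
      where
      q : rk (F idA B i j (γ i a)) ≡ 1
      q = trans (sym (decided-in {idA} {B} f m dec)) r

    private
      rankP : ∀ v → rk (F idA (parallel i j) i j v) ≡ rk (⁺ U i j v ℤ.- ⁺ Sep.c i j)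
      rankP v = cong rk (F-parallel i j v)

      rankP′ : ∀ v → rk (F (parallel i j) idA j i v) ≡ rk (⁺ Sep.c i j ℤ.- ⁺ U i j v)
      rankP′ v = cong rk (F-parallel′ i j v)

      rank-mirror : ∀ c → W i j z ≡ c → rk (F idA (mirror (⁺ c)) i j z) ≡ 1
      rank-mirror c e = trans (cong rk (F-mirror i j z c)) (trans (cong (λ y → rk (⁺ y ℤ.- ⁺ c)) e) (rk-≡ c))

      startP : ∀ {r} → rk (⁺ U i j z ℤ.- ⁺ Sep.c i j) ≡ r → rk (⁺ U i j (γ i a) ℤ.- ⁺ Sep.c i j) ≡ r
      startP e = trans (sym (rankP (γ i a))) (trans (sym (decided-in {idA} {parallel i j} f m decP)) (trans (rankP z) e))

      endP : ∀ {r} → rk (⁺ U i j z ℤ.- ⁺ Sep.c i j) ≡ r → rk (⁺ U i j (γ i b) ℤ.- ⁺ Sep.c i j) ≡ r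
      endP e = trans (sym (rankP (γ i b))) (trans (sym decP) (trans (rankP (γ i a)) (startP e)))

      startP′ : ∀ {r} → rk (⁺ Sep.c i j ℤ.- ⁺ U i j z) ≡ r → rk (⁺ Sep.c i j ℤ.- ⁺ U i j (γ j a′)) ≡ r
      startP′ e = trans (sym (rankP′ (γ j a′))) (trans (sym (decided-in {parallel i j} {idA} f′ m′ decP′)) (trans (rankP′ z) e))

      endP′ : ∀ {r} → rk (⁺ Sep.c i j ℤ.- ⁺ U i j z) ≡ r → rk (⁺ Sep.c i j ℤ.- ⁺ U i j (γ j b′)) ≡ r
      endP′ e = trans (sym (rankP′ (γ j b′))) (trans (sym decP′) (trans (rankP′ (γ j a′)) (startP′ e)))

    -- By the sign of U - c at z, which decidedness carries to the ends of both pieces. There the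
    -- separation bounds `W` from above on one piece and from below on the other; as `W` is monotone
    -- through z on each, it equals `c₁` or `c₂` at z.
    base : On-base (parallel i j) ⊎ On-base (rising i j) ⊎ On-base (falling i j)
    base with <-cmp (U i j z) (Sep.c i j)
    ... | tri≈ _ e _ = inj₁ (on-base (parallel i j) decP
          (trans (rankP z) (trans (cong (λ y → rk (⁺ y ℤ.- ⁺ Sep.c i j)) e) (rk-≡ (Sep.c i j)))))
    ... | tri< lt _ _ = inj₂ (inj₁ (on-base (rising i j) decR (rank-mirror (Sep.c₁ i j) (≤-antisym
          (≤-trans (W-mono j (proj₂ (in-forward f m))) (Sep.low i j l₂ (rk-<⁻ (endP (rk-< lt)))))
          (≤-trans (Sep.low′ i j (≤-trans l₁′ l₂′) (rk->⁻ (startP′ (rk-> lt)))) (W-mono′ i (proj₁ (in-forward f′ m′))))))))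
    ... | tri> _ _ gt = inj₂ (inj₂ (on-base (falling i j) decF (rank-mirror (Sep.c₂ i j) (≤-antisym
          (≤-trans (W-mono′ i (proj₂ (in-forward f′ m′))) (Sep.high′ i j l₂′ (rk-<⁻ (endP′ (rk-< gt)))))
          (≤-trans (Sep.high i j (≤-trans l₁ l₂) (rk->⁻ (startP (rk-> gt)))) (W-mono j (proj₁ (in-forward f m))))))))

  bases-suffice : ∀ i j → Suffices i j (bases i j)
  bases-suffice i j l₁ l₂ l₁′ l₂′ dec dec′ m m′
    with Base.base i j l₁ l₂ l₁′ l₂′ (dec _ (here refl)) (dec _ (there (here refl))) (dec _ (there (there (here refl))))
           (dec′ _ (here refl)) m m′
  ... | inj₁ (q , q′)        = parallel i j , here refl , q , q′
  ... | inj₂ (inj₁ (q , q′)) = rising i j , there (here refl) , q , q′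
  ... | inj₂ (inj₂ (q , q′)) = falling i j , there (there (here refl)) , q , q′


-- Segments and their references

module Cutting (n k : ℕ) (D : Fin n → Fin n → ℕ) (D≤n : ∀ u v → D u v ≤ n) (D-refl : ∀ u → D u u ≡ 0)
  (D-sym : ∀ u v → D u v ≡ D v u) (triangle : ∀ u v w → D u w ≤ D u v + D v w)
  (γ : Fin k → ℕ → Fin n) (L : Fin k → ℕ)
  (geodesic : ∀ i {a b} → a ≤ b → b ≤ L i → D (γ i a) (γ i b) ≡ b ∸ a) where

  open Geodesics n k D D≤n D-refl D-sym triangle γ L geodesic

  module Pieces (bases : Fin k → Fin k → List Aff) (three : ∀ i j → length (bases i j) ≤ 3)
                (suffice : ∀ i j → Suffices i j (bases i j)) where

    open Lines k bases

    cutAt : Fin k → Fin k → Maybe Aff → Maybe Aff → List (Fin n → ℤ)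
    cutAt i l (just A) (just B) = F A B i l ∷ []
    cutAt i l _        _        = []

    cutsAt : Fin k → Line k → List (Fin n → ℤ)
    cutsAt i ℓ = concatMap (λ l → cutAt i l (lookup (part ℓ) i) (lookup (part ℓ) l)) (allFin k)

    cuts : Fin k → List (Fin n → ℤ)
    cuts i = concatMap (cutsAt i) 𝓛

    -- One number for all signs: along path i every term is nondecreasing, so where `ρ` is constant
    -- each condition is decided, and the number of segments is bounded by the range of `ρ`.
    ρ : Fin k → Fin n → ℕ
    ρ i v = sum (map (λ f → rk (f v)) (cuts i))

    cut∈ : ∀ {ℓ i l A B} → ℓ ∈ 𝓛 → lookup (part ℓ) i ≡ just A → lookup (part ℓ) l ≡ just B → F A B i l ∈ cuts i
    cut∈ {ℓ} {i} {l} {A} {B} ℓ∈ a b = ∈-concat (cutsAt i) ℓ∈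
      (∈-concat (λ l → cutAt i l (lookup (part ℓ) i) (lookup (part ℓ) l)) (∈-allFin {k} l) (go _ _ a b))
      where
      go : ∀ m m′ → m ≡ just A → m′ ≡ just B → F A B i l ∈ cutAt i l m m′
      go _ _ refl refl = here refl

    cuts-mono : ∀ {i f x y} → f ∈ cuts i → Forward i x y → f x ℤ.≤ f y
    cuts-mono {i} {f} {x} {y} f∈ fw with find (∈-concatMap⁻ (cutsAt i) {xs = 𝓛} f∈)
    ... | ℓ , _ , m with find (∈-concatMap⁻ (λ l → cutAt i l (lookup (part ℓ) i) (lookup (part ℓ) l)) {xs = allFin k} m)
    ... | l , _ , m = go (lookup (part ℓ) i) (lookup (part ℓ) l) m
      where
      go : ∀ p q → f ∈ cutAt i l p q → f x ℤ.≤ f y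
      go (just A) (just B) (here refl) = F-mono A B l fw

    -- Number of lines, times conditions per line that compare coordinate i with another, times the
    -- largest rank.
    R : ℕ
    R = suc k * (k * (k * (k * 3)) ^ k) * (k * 1) * 2

    ρ≤R : 1 ≤ k → ∀ i v → ρ i v ≤ R
    ρ≤R 1≤k i v = ≤-trans (sum-bound (λ f → rk (f v)) (cuts i) (λ f → rk≤2 (f v)))
      (*-monoˡ-≤ 2 (≤-trans (length-concatMap three (cutsAt i) (k * 1) 𝓛 λ ℓ →
        ≤-trans (length-concatMap three (λ l → cutAt i l (lookup (part ℓ) i) (lookup (part ℓ) l)) 1 (allFin k)
          (λ l → at-most-one (lookup (part ℓ) i) (lookup (part ℓ) l)))
          (≤-reflexive (cong (_* 1) (List.length-tabulate {n = k} id))))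
        (*-monoˡ-≤ (k * 1) (levels≤ three k 1≤k))))
      where
      at-most-one : ∀ {i l} p q → length (cutAt i l p q) ≤ 1
      at-most-one (just A) (just B) = ≤-refl
      at-most-one (just A) nothing  = z≤n
      at-most-one nothing  _        = z≤n

    ρ-mono : ∀ {i x y} → Forward i x y → ρ i x ≤ ρ i y
    ρ-mono {i} fw = sum-≤ _ _ (cuts i) (λ f∈ → rk-mono (cuts-mono f∈ fw))

    On : Line k → Fin n → Set
    On ℓ v = ∀ l {B} → lookup (part ℓ) l ≡ just B → fn B (⁺ d l v) ≡ ⁺ d (root ℓ) v

    On? : ∀ ℓ v → Dec (On ℓ v)
    On? ℓ v = Fin.all? (λ l → go l (lookup (part ℓ) l) refl)
      where
      go : ∀ l m → lookup (part ℓ) l ≡ m → Dec (∀ {B} → lookup (part ℓ) l ≡ just B → fn B (⁺ d l v) ≡ ⁺ d (root ℓ) v)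
      go l nothing  e = yes λ b → case trans (sym e) b of λ ()
      go l (just B) e with fn B (⁺ d l v) ℤ.≟ ⁺ d (root ℓ) v
      ... | yes p = yes λ b → case trans (sym e) b of λ { refl → p }
      ... | no ¬p = no λ f → ¬p (f e)

    record Contains (i : Fin k) (x y : Fin n) (ℓ : Line k) : Set where
      constructor contains
      field
        fun    : Aff
        member : lookup (part ℓ) i ≡ just fun
        onˣ    : On ℓ x
        onʸ    : On ℓ y

    Contains? : ∀ i x y ℓ → Dec (Contains i x y ℓ)
    Contains? i x y ℓ with lookup (part ℓ) i in e | On? ℓ x | On? ℓ y
    ... | just A  | yes p | yes q = yes (contains A e p q)
    ... | just A  | no ¬p | _     = no λ c → ¬p (Contains.onˣ c)
    ... | just A  | yes _ | no ¬q = no λ c → ¬q (Contains.onʸ c)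
    ... | nothing | _     | _     = no λ c → case trans (sym e) (Contains.member c) of λ ()

    pick : Fin k → Fin n → Fin n → Maybe (Line k)
    pick i x y = first (Contains? i x y) 𝓛

    -- The choice looks at one piece only; two pieces agree because `𝓛` has a fixed order. The
    -- default is never taken, since `single i` contains every piece of path i.
    reference : Fin k → Fin n → Fin n → Fin k
    reference i x y = maybe root i (pick i x y)

    On-single : ∀ i v → On (single i) v
    On-single i v l {B} e with i Fin.≟ l
    ... | yes refl with trans (sym (Vec.lookup∘update i (Vec.replicate k nothing) (just idA))) e
    ...   | refl = refl
    On-single i v l {B} e | no i≢l with trans (sym (trans (Vec.lookup∘update′ (≢-sym i≢l) (Vec.replicate k nothing) (just idA)) (Vec.lookup-replicate l nothing))) e
    ...   | ()

    picked : ∀ i x y → ∃[ ℓ ] pick i x y ≡ just ℓ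
    picked i x y = go (pick i x y) refl
      where
      go : ∀ m → pick i x y ≡ m → ∃[ ℓ ] pick i x y ≡ just ℓ
      go (just ℓ) e = ℓ , e
      go nothing  e = contradiction
        (contains idA (Vec.lookup∘update i (Vec.replicate k nothing) (just idA)) (On-single i x) (On-single i y))
        (first-none (Contains? i x y) 𝓛 e (level⊆ {0} {k} z≤n (∈-map⁺ single (∈-allFin i))))

    -- The line that is picked cannot be prolonged.
    pick-maximal : ∀ i x y {ℓ} t → first (Contains? i x y) (levels t) ≡ just ℓ →
      ∃[ t′ ] t′ ≤ t × ℓ ∈ level t′ × Contains i x y ℓ × (∀ {ℓ′} → suc t′ ≤ t → ℓ′ ∈ level (suc t′) → ¬ Contains i x y ℓ′)
    pick-maximal i x y zero e = let m , c = first-∈ (Contains? i x y) (level 0) e in 0 , z≤n , m , c , λ ()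
    pick-maximal i x y (suc t) e with first-++ (Contains? i x y) (level (suc t)) (levels t)
    ... | inj₁ (ℓ₁ , e₁ , e₂) with trans (sym e) e₁
    ...   | refl = let m , c = first-∈ (Contains? i x y) (level (suc t)) e₂ in suc t , ≤-refl , m , c , λ l → contradiction l (<⇒≱ ≤-refl)
    pick-maximal i x y (suc t) e | inj₂ (e₁ , none) with pick-maximal i x y t (trans (sym e₁) e)
    ... | t′ , t′≤t , m , c , f = t′ , m≤n⇒m≤1+n t′≤t , m , c , λ {ℓ′} l m′ → case m≤n⇒m<n∨m≡n t′≤t of
      λ { (inj₁ lt) → f lt m′ ; (inj₂ refl) → first-none (Contains? i x y) (level (suc t)) none m′ }

    record Piece (i : Fin k) (x y : Fin n) : Set where
      field
        {a b} : ℕ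
        a≤b   : a ≤ b
        b≤L   : b ≤ L i
        x≡    : x ≡ γ i a
        y≡    : y ≡ γ i b
        same  : ρ i x ≡ ρ i y

      fw : Forward i x y
      fw = subst₂ (Forward i) (sym x≡) (sym y≡) (forward i a≤b b≤L)

      decided : ∀ {f} → f ∈ cuts i → rk (f x) ≡ rk (f y)
      decided = sum-≡ _ _ (cuts i) (λ f∈ → rk-mono (cuts-mono f∈ fw)) same

    -- Each condition of ℓ, compared with coordinate i, is monotone from x through z to y and zero
    -- at both ends.
    On-in : ∀ {i x y z ℓ} → Forward i x y → In x y z → Contains i x y ℓ → On ℓ z
    On-in {i} {x} {y} {z} {ℓ} fw m (contains A a onx ony) l {B} b =
      trans (zero-at b) (sym (zero-at (root-part ℓ)))
      where
      zero-at : ∀ {l B} → lookup (part ℓ) l ≡ just B → fn B (⁺ d l z) ≡ fn A (⁺ d i z)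
      zero-at {l} {B} b = sym (zero-cut A B {⁺ d i z} {⁺ d l z} (ℤ.≤-antisym
        (ℤ.≤-trans (F-mono A B l (proj₂ (in-forward fw m)))
          (ℤ.≤-reflexive (cut-zero A B (trans (ony i a) (sym (ony l b))))))
        (ℤ.≤-trans (ℤ.≤-reflexive (sym (cut-zero A B (trans (onx i a) (sym (onx l b))))))
          (F-mono A B l (proj₁ (in-forward fw m))))))

    -- Here the cutting pays off: a condition of ℓ that is zero at z has constant sign on the piece,
    -- so it is zero at the ends.
    On-out : ∀ {j x y z ℓ A} → Piece j x y → In x y z → ℓ ∈ 𝓛 → lookup (part ℓ) j ≡ just A → On ℓ z →
             Contains j x y ℓ
    On-out {j} {x} {y} {z} {ℓ} {A} P m ℓ∈ a onz = contains A a
      (λ l b → trans (proj₁ (zero-at b)) (sym (proj₁ (zero-at (root-part ℓ)))))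
      (λ l b → trans (proj₂ (zero-at b)) (sym (proj₂ (zero-at (root-part ℓ)))))
      where
      open Piece P using (fw; decided)
      zero-at : ∀ {l B} → lookup (part ℓ) l ≡ just B → fn B (⁺ d l x) ≡ fn A (⁺ d j x) × fn B (⁺ d l y) ≡ fn A (⁺ d j y)
      zero-at {l} {B} b =
        sym (zero-cut A B {⁺ d j x} {⁺ d l x} (rk-zero q)) ,
        sym (zero-cut A B {⁺ d j y} {⁺ d l y} (rk-zero (trans (sym dec) q)))
        where
        dec : Decided A B j l x y
        dec = decided (cut∈ ℓ∈ a b)
        q : rk (F A B j l x) ≡ 1
        q = trans (sym (decided-in {A} {B} fw m dec)) (cong rk (cut-zero A B (trans (onz j a) (sym (onz l b)))))

    On-extend : ∀ {i j x ℓ A B} → On ℓ x → lookup (part ℓ) i ≡ just A → (e : lookup (part ℓ) j ≡ nothing) →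
                ⁺ d i x ≡ fn B (⁺ d j x) → On (extend ℓ j e (A ⊙ B)) x
    On-extend {i} {j} {x} {ℓ} {A} {B} on a e q l {C} c with j Fin.≟ l
    ... | yes refl with trans (sym (Vec.lookup∘update j (part ℓ) (just (A ⊙ B)))) c
    ...   | refl = trans (cong (fn A) (sym q)) (on i a)
    On-extend {i} {j} {x} {ℓ} {A} {B} on a e q l {C} c | no j≢l =
      on l (trans (sym (Vec.lookup∘update′ (≢-sym j≢l) (part ℓ) (just (A ⊙ B)))) c)

    -- If ℓ ties coordinate j, then z lies on ℓ by `On-in`, and so does the other piece by `On-out`.
    -- If j is free, one of the three conditions holds on the first piece and prolongs ℓ to a longer
    -- line containing it, contrary to the choice of ℓ.
    carry : ∀ {i j x y x′ y′ z} → i ≢ j → Piece i x y → Piece j x′ y′ → In x y z → In x′ y′ z →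
            ∀ {ℓ} → pick i x y ≡ just ℓ → Contains j x′ y′ ℓ
    carry {i} {j} {x} {y} {x′} {y′} {z} i≢j P@record { a≤b = l₁ ; b≤L = l₂ ; x≡ = refl ; y≡ = refl }
          P′@record { a≤b = l₁′ ; b≤L = l₂′ ; x≡ = refl ; y≡ = refl } m m′ {ℓ} e
      with pick-maximal i x y k e
    ... | t , t≤k , ℓ∈ , c@(contains A a onx ony) , max = go (lookup (part ℓ) j) refl
      where
      e₀ : lookup (part (single i)) j ≡ nothing
      e₀ = trans (Vec.lookup∘update′ (≢-sym i≢j) (Vec.replicate k nothing) (just idA)) (Vec.lookup-replicate j nothing)
      -- The two-coordinate lines place the conditions of `bases i j` among the cuts of both paths,
      -- so both pieces are decided for them.
      pair : Aff → Line k
      pair B = extend (single i) j e₀ (idA ⊙ B)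
      pair∈ : ∀ {B} → B ∈ bases i j → pair B ∈ 𝓛
      pair∈ {B} B∈ = level⊆ {1} {k} (≤-trans (s≤s z≤n) (Fin.toℕ<n i))
        (attach∈ {single i} {0} {i} {j} {idA} {B} (∈-map⁺ single (∈-allFin i)) (Vec.lookup∘update i (Vec.replicate k nothing) (just idA)) e₀ B∈)
      pair-i : ∀ B → lookup (part (pair B)) i ≡ just idA
      pair-i B = trans (Vec.lookup∘update′ i≢j (part (single i)) (just (idA ⊙ B))) (Vec.lookup∘update i (Vec.replicate k nothing) (just idA))
      pair-j : ∀ B → lookup (part (pair B)) j ≡ just (idA ⊙ B)
      pair-j B = Vec.lookup∘update j (part (single i)) (just (idA ⊙ B))
      go : ∀ p → lookup (part ℓ) j ≡ p → Contains j x′ y′ ℓ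
      go (just B) b = On-out P′ m′ (level⊆ t≤k ℓ∈) b (On-in (Piece.fw P) m c)
      go nothing  e = let B , B∈ , q , q′ = suffice i j l₁ l₂ l₁′ l₂′
                            (λ B B∈ → Piece.decided P (cut∈ (pair∈ B∈) (pair-i B) (pair-j B)))
                            (λ B B∈ → Piece.decided P′ (cut∈ (pair∈ B∈) (pair-j B) (pair-i B))) m m′ in
        ⊥-elim (max (<⇒≤ (full {t} {ℓ} {j} ℓ∈ e)) (attach∈ {ℓ} {t} {i} {j} {A} {B} ℓ∈ a e B∈)
        (contains A (trans (Vec.lookup∘update′ i≢j (part ℓ) (just (A ⊙ B))) a)
          (On-extend {i} {j} {x} {ℓ} {A} {B} onx a e q) (On-extend {i} {j} {y} {ℓ} {A} {B} ony a e q′)))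

    reference-agree : ∀ {i j x y x′ y′ z} → i ≢ j → Piece i x y → Piece j x′ y′ → In x y z → In x′ y′ z →
                      reference i x y ≡ reference j x′ y′
    reference-agree {i} {j} {x} {y} {x′} {y′} i≢j P P′ m m′ =
      trans (cong (maybe root i) agree) (let ℓ , e = picked j x′ y′ in
        trans (cong (maybe root i) e) (sym (cong (maybe root j) e)))
      where
      agree : pick i x y ≡ pick j x′ y′
      agree = first-agree (Contains? i x y) (Contains? j x′ y′) 𝓛 (carry i≢j P P′ m m′) (carry (≢-sym i≢j) P′ P m′ m)

    -- On the picked line the root coordinate is an isometric function of `d i`, and `d i` runs at
    -- full speed on the piece. The sign of that function says which end is nearer to the root.
    reference-straight : ∀ {i x y} → Piece i x y → let r = reference i x y in
                         d r y ≡ d r x + D x y ⊎ d r x ≡ d r y + D x y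
    reference-straight {i} {x} {y} P = let ℓ , e = picked i x y in go ℓ e (first-∈ (Contains? i x y) 𝓛 e)
      where
      open Piece P using (fw; decided)
      lemma : ∀ {p q m p′ q′} → q ≡ p + m → ⁺ q′ ℤ.- ⁺ p′ ≡ ⁺ q ℤ.- ⁺ p → q′ ≡ p′ + m
      lemma {p} {q} {m} {p′} {q′} refl e = ℤ.+-injective (trans (e₁ (⁺ q′) (⁺ p′)) (trans (cong (ℤ._+ ⁺ p′) e)
        (trans (e₂ (⁺ p) (⁺ m) (⁺ p′)) refl)))
        where
        e₁ : ∀ q p → q ≡ (q ℤ.- p) ℤ.+ p
        e₁ = ℤ.solve-∀
        e₂ : ∀ p m p′ → ((p ℤ.+ m) ℤ.- p) ℤ.+ p′ ≡ p′ ℤ.+ m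
        e₂ = ℤ.solve-∀
      go : ∀ ℓ → pick i x y ≡ just ℓ → ℓ ∈ 𝓛 × Contains i x y ℓ →
           let r = reference i x y in d r y ≡ d r x + D x y ⊎ d r x ≡ d r y + D x y
      go ℓ e (_ , contains A a onx ony) rewrite e with up A | iso A (⁺ d i y) (⁺ d i x) | iso A (⁺ d i x) (⁺ d i y)
      ... | true  | f | _ = inj₁ (lemma {d i x} {m = D x y} {d (root ℓ) x} fw (trans (cong₂ ℤ._-_ (sym (ony i a)) (sym (onx i a))) f))
      ... | false | _ | f = inj₂ (lemma {d i x} {m = D x y} {d (root ℓ) y} fw (trans (cong₂ ℤ._-_ (sym (onx i a)) (sym (ony i a))) f))

-- The pebble game as formulas

flat-lookup : ∀ {A : Set} {k} (ps : Vec (A × A) k) i →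
              lookup (flat ps) (combine i zero) ≡ proj₁ (lookup ps i) ×
              lookup (flat ps) (combine i (suc zero)) ≡ proj₂ (lookup ps i)
flat-lookup (p ∷ ps) zero    = refl , refl
flat-lookup (p ∷ ps) (suc i) = flat-lookup ps i

-- Path i is cut into segments (i , m) with ends x and y.  The pebble p of a
-- segment walks from u to v, where {u , v} = {x , y}, away from the reference
-- vertex r.
data Field : Set where
  fx fy fu fv fr fp : Field

-- Each path has suc R segments.
module Formulas (k R : ℕ) where

  record Name : Set where
    constructor ⟨_,_,_⟩ⁿ
    field
      fld : Field
      pth : Fin k
      seg : Fin (suc R)

  V : Set
  V = Var Name (Fin (k * 2))

  src tgt : Fin k → V
  src i = glob (combine i zero)
  tgt i = glob (combine i (suc zero))

  _at_,_ : Field → Fin k → Fin (suc R) → V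
  f at i , m = new ⟨ f , i , m ⟩ⁿ

  was : Field → Fin k → Fin (suc R) → V
  was f i m = old ⟨ f , i , m ⟩ⁿ

  eq neq : V → V → Fm V
  eq a b  = dist a b ≼ lit 0
  neq a b = lit 1 ≼ dist a b

  same : ∀ {m} → Fin m → Fin m → Fm V
  same i j = lit (toℕ i) ≼ lit (toℕ j) ∧ lit (toℕ j) ≼ lit (toℕ i)

  ⋀⋀ : (Fin k → Fin (suc R) → Fm V) → Fm V
  ⋀⋀ φ = ⋀ k λ i → ⋀ (suc R) λ m → φ i m

  outside : V → V → Fm (Maybe V)
  outside a b = dist (just a) (just b) ∔ lit 1 ≼ dist (just a) nothing ∔ dist nothing (just b)

  end : Fin k → V → Fm V
  end i a = eq a (src i) ∨ eq a (tgt i)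

  -- Staying below `size` excludes the cut-off, so that the terminals are connected.
  okPath : Fin k → Fm V
  okPath i = (dist (src i) (tgt i) ∔ lit 1 ≼ size) ∧
    eq (src i) (fx at i , zero) ∧ eq (fy at i , fromℕ R) (tgt i)

  okLink : Fin k → Fin R → Fm V
  okLink i m = (dist (fy at i , inject₁ m) (fx at i , suc m) ≼ lit 1) ∧
    (dist (src i) (fy at i , inject₁ m) ∔ dist (fy at i , inject₁ m) (fx at i , suc m) ≼ dist (src i) (fx at i , suc m))

  okSeg : Fin k → Fin (suc R) → Fm V
  okSeg i m =
    (dist (src i) (fx at i , m) ∔ dist (fx at i , m) (fy at i , m) ≼ dist (src i) (fy at i , m)) ∧
    ((eq (fu at i , m) (fx at i , m) ∧ eq (fv at i , m) (fy at i , m)) ∨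
     (eq (fu at i , m) (fy at i , m) ∧ eq (fv at i , m) (fx at i , m))) ∧
    (dist (fr at i , m) (fu at i , m) ∔ dist (fu at i , m) (fv at i , m) ≼ dist (fr at i , m) (fv at i , m)) ∧
    (dist (fu at i , m) (fp at i , m) ∔ dist (fp at i , m) (fv at i , m) ≼ dist (fu at i , m) (fv at i , m))

  -- The first conjunct concerns the guessed frame: equal references, or metric intervals without a
  -- common vertex. The second constrains the current positions, and only for equal references.
  okPair : Fin k → Fin (suc R) → Fin k → Fin (suc R) → Fm V
  okPair i m i′ m′ = same i i′ ∨
    ((eq (fr at i , m) (fr at i′ , m′) ∨
      all (outside (fu at i , m) (fv at i , m) ∨ outside (fu at i′ , m′) (fv at i′ , m′))) ∧
     (neq (fr at i , m) (fr at i′ , m′) ∨ neq (fp at i , m) (fp at i′ , m′) ∨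
      (end i (fp at i , m) ∧ end i′ (fp at i , m))))

  ok : Fm V
  ok = ⋀ k okPath ∧ (⋀ k λ i → ⋀ R λ m → okLink i m) ∧ ⋀⋀ okSeg ∧ ⋀⋀ λ i m → ⋀⋀ λ i′ m′ → okPair i m i′ m′

  static : Fin k → Fin (suc R) → Fm V
  static i m = eq (was fx i m) (fx at i , m) ∧ eq (was fy i m) (fy at i , m) ∧ eq (was fu i m) (fu at i , m) ∧
               eq (was fv i m) (fv at i , m) ∧ eq (was fr i m) (fr at i , m)

  -- Pebbles that have arrived hold up nobody, and those on segments of the same path are ignored,
  -- as such segments may share vertices.
  wait : Fin k → Fin (suc R) → Fin k → Fin (suc R) → Fm V
  wait i m i′ m′ = same i i′ ∨ neq (fr at i , m) (fr at i′ , m′) ∨ eq (was fp i′ m′) (fv at i′ , m′) ∨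
                   (dist (fr at i , m) (was fp i m) ≼ dist (fr at i , m) (was fp i′ m′))

  move : Fin k → Fin (suc R) → Fm V
  move i m = (⋀⋀ λ i′ m′ → (same i i′ ∧ same m m′) ∨ eq (was fp i′ m′) (fp at i′ , m′)) ∧
    (dist (was fp i m) (fp at i , m) ≼ lit 1) ∧
    (dist (fr at i , m) (was fp i m) ∔ lit 1 ≼ dist (fr at i , m) (fp at i , m)) ∧
    (⋀⋀ λ i′ m′ → wait i m i′ m′)

  initᶠ stepᶠ acceptᶠ : Fm V
  initᶠ   = ok ∧ ⋀⋀ λ i m → eq (fp at i , m) (fu at i , m)
  stepᶠ   = ok ∧ ⋀⋀ static ∧ (⋁ k λ i → ⋁ (suc R) λ m → move i m)
  acceptᶠ = ⋀⋀ λ i m → eq (fp at i , m) (fv at i , m)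

-- Soundness: an accepted play gives disjoint shortest paths

module _ {n} (G : Graph n) {D : Fin n → Fin n → ℕ} (isDist : IsDist G D) where
  open Graph G
  open IsDist isDist

  -- The walk is kept backwards, from the pebble to its start, so that a move prepends one edge.
  record Trail (u v r p : Fin n) : Set where
    field
      walk   : Walk G p u
      len    : walkLength G walk + D r u ≡ D r p
      inside : ∀ {z} → z ∈ walkVertices G walk → D u z + D z v ≤ D u v

  open Trail

  nil : ∀ {u v r p} → p ≡ u → Σ[ t ∈ Trail u v r p ] (∀ {z} → z ∈ walkVertices G (walk t) → z ≡ p)
  nil {u} {v} refl = record { walk = halt ; len = refl ; inside = λ { (here refl) → ≤-reflexive (cong (_+ D u v) (D-refl u)) } } ,
    λ { (here e) → e }

  transfer : ∀ {u v r p u′ v′ r′ p′} → u ≡ u′ → v ≡ v′ → r ≡ r′ → p ≡ p′ → (t : Trail u v r p) →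
             Σ[ t′ ∈ Trail u′ v′ r′ p′ ] (∀ {z} → z ∈ walkVertices G (walk t′) → z ∈ walkVertices G (walk t))
  transfer refl refl refl refl t = t , id

  push : ∀ {u v r p p′} → p′ ~ p → D r p′ ≡ suc (D r p) → D u p′ + D p′ v ≤ D u v → (t : Trail u v r p) →
         Σ[ t′ ∈ Trail u v r p′ ] (∀ {z} → z ∈ walkVertices G (walk t′) → z ∈ walkVertices G (walk t) ⊎ z ≡ p′)
  push e l i t = record { walk = e ◅ walk t ; len = trans (cong suc (len t)) (sym l)
      ; inside = λ { (here refl) → i ; (there q) → inside t q } } ,
    λ { (here q) → inj₂ q ; (there q) → inj₁ q }

  suffix : ∀ {a b z} (w : Walk G a b) → z ∈ walkVertices G w → D z b ≤ walkLength G w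
  suffix {b = b} halt (here refl) = ≤-reflexive (D-refl b)
  suffix (e ◅ w) (here refl) = shortest (e ◅ w)
  suffix (e ◅ w) (there q)   = m≤n⇒m≤1+n (suffix w q)

  -- If the first vertex occurred again, the suffix from there would be shorter than the distance.
  geodesic-simple : ∀ {a b} (w : Walk G a b) → walkLength G w ≤ D a b → Unique (walkVertices G w)
  geodesic-simple halt l = All.[] ∷ []
  geodesic-simple {a} {b} (_◅_ {j = c} e w) l =
    All.tabulate (λ {z} q → λ { refl → <⇒≱ l (suffix w q) }) ∷
    geodesic-simple w (s≤s⁻¹ (≤-trans l (≤-trans (triangle a c b) (+-monoˡ-≤ (D c b) (D-edge e)))))

  module Game (k R : ℕ) (τ : Fin (k * 2) → Fin n) where
    open Formulas k R hiding (V)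
    open Meaning n D _~_

    s t : Fin k → Fin n
    s i = τ (combine i zero)
    t i = τ (combine i (suc zero))

    State : Set
    State = Name → Fin n

    val₂ : State → State → Formulas.V k R → Fin n
    val₂ c′ c (old a)  = c′ a
    val₂ c′ c (new a)  = c a
    val₂ c′ c (glob z) = τ z

    Init Accept : State → Set
    Init c   = ⟦ initᶠ ⟧ᶠ (val₂ c c)
    Accept c = ⟦ acceptᶠ ⟧ᶠ (val₂ c c)

    Step : State → State → Set
    Step c′ c = ⟦ stepᶠ ⟧ᶠ (val₂ c′ c)

    Ends : Fin k → Fin n → Set
    Ends i z = z ≡ s i ⊎ z ≡ t i

    ends : ∀ {i z} → (D z (s i) ≤ 0 ⊎ D z (t i) ≤ 0) → Ends i z
    ends = [ inj₁ ∘ D≡0 , inj₂ ∘ D≡0 ]′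

    -- The configuration c, with the vertices visited so far by each pebble.
    record Trails (c : State) : Set where
      _·_,_ : Field → Fin k → Fin (suc R) → Fin n
      f · i , m = c ⟨ f , i , m ⟩ⁿ
      field
        okay  : ⟦ ok ⟧ᶠ (val₂ c c)
        trail : ∀ i m → Trail (fu · i , m) (fv · i , m) (fr · i , m) (fp · i , m)
      On : Fin k → Fin (suc R) → Fin n → Set
      On i m z = z ∈ walkVertices G (walk (trail i m))
      field
        apart : ∀ {i m i′ m′ z} → i ≢ i′ → fr · i , m ≡ fr · i′ , m′ → On i m z → On i′ m′ z → Ends i z × Ends i′ z
        -- The invariant behind the rule of waiting: an unfinished pebble is at least as far from r
        -- as every vertex that pebbles of other paths with the same r have left. Its next vertex is
        -- farther still, so it can collide only with a current position.
        sched : ∀ {i m i′ m′} → i ≢ i′ → fr · i , m ≡ fr · i′ , m′ → fp · i , m ≡ fv · i , m ⊎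
                (∀ {z} → On i′ m′ z → z ≡ fp · i′ , m′ ⊎ D (fr · i , m) z ≤ D (fr · i , m) (fp · i , m))

    not-same : ∀ {m} {i j : Fin m} → i ≢ j → ¬ (toℕ i ≤ toℕ j × toℕ j ≤ toℕ i)
    not-same i≢j (l , l′) = i≢j (Fin.toℕ-injective (≤-antisym l l′))

    1≤D : ∀ {a b} → a ≡ b → ¬ (1 ≤ D a b)
    1≤D {a} refl l = contradiction (≤-trans l (≤-reflexive (D-refl a))) λ ()

    clash : ∀ {c′ c i m i′ m′} → ⟦ ok ⟧ᶠ (val₂ c′ c) → i ≢ i′ → c ⟨ fr , i , m ⟩ⁿ ≡ c ⟨ fr , i′ , m′ ⟩ⁿ →
            c ⟨ fp , i , m ⟩ⁿ ≡ c ⟨ fp , i′ , m′ ⟩ⁿ → Ends i (c ⟨ fp , i , m ⟩ⁿ) × Ends i′ (c ⟨ fp , i , m ⟩ⁿ)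
    clash {i = i} {m} {i′} {m′} (_ , _ , _ , pr) i≢ re pe with pr i m i′ m′
    ... | inj₁ q                      = contradiction q (not-same i≢)
    ... | inj₂ (_ , inj₁ q)           = contradiction q (1≤D re)
    ... | inj₂ (_ , inj₂ (inj₁ q))    = contradiction q (1≤D pe)
    ... | inj₂ (_ , inj₂ (inj₂ (q , q′))) = ends q , ends q′

    start : ∀ {c} → Init c → Trails c
    start {c} (o , pu) = record
      { okay = o
      ; trail = λ i m → proj₁ (new′ i m)
      ; apart = λ {i} {m} {i′} {m′} {z} i≢ re a b → let e = proj₂ (new′ i m) a ; e′ = proj₂ (new′ i′ m′) b in
          subst (λ z → Ends i z × Ends i′ z) (sym e) (clash {c} {c} {i} {m} {i′} {m′} o i≢ re (trans (sym e) e′))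
      ; sched = λ {i} {m} {i′} {m′} i≢ re → inj₂ λ b → inj₁ (proj₂ (new′ i′ m′) b) }
      where
      new′ : ∀ i m → Σ[ tr ∈ Trail (c ⟨ fu , i , m ⟩ⁿ) (c ⟨ fv , i , m ⟩ⁿ) (c ⟨ fr , i , m ⟩ⁿ) (c ⟨ fp , i , m ⟩ⁿ) ]
             (∀ {z} → z ∈ walkVertices G (walk tr) → z ≡ c ⟨ fp , i , m ⟩ⁿ)
      new′ i m = nil (D≡0 (pu i m))

    advance : ∀ {c′ c} → Trails c′ → Step c′ c → Trails c
    advance {c′} {c} T (o , st , i₀ , m₀ , stay , adj , far , wt) = record
      { okay = o ; trail = λ i m → proj₁ (grow i m) ; apart = apart′
      ; sched = λ {i} {m} {i′} {m′} → sched″ {i} {m} {i′} {m′} _ (proj₂ (grow i′ m′)) }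
      where
      open Trails T
      ue : ∀ i m → c′ ⟨ fu , i , m ⟩ⁿ ≡ c ⟨ fu , i , m ⟩ⁿ
      ue i m = D≡0 (proj₁ (proj₂ (proj₂ (st i m))))
      ve : ∀ i m → c′ ⟨ fv , i , m ⟩ⁿ ≡ c ⟨ fv , i , m ⟩ⁿ
      ve i m = D≡0 (proj₁ (proj₂ (proj₂ (proj₂ (st i m)))))
      re : ∀ i m → c′ ⟨ fr , i , m ⟩ⁿ ≡ c ⟨ fr , i , m ⟩ⁿ
      re i m = D≡0 (proj₂ (proj₂ (proj₂ (proj₂ (st i m)))))
      pe : ∀ i m → ¬ (i ≡ i₀ × m ≡ m₀) → c′ ⟨ fp , i , m ⟩ⁿ ≡ c ⟨ fp , i , m ⟩ⁿ
      pe i m ne with stay i m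
      ... | inj₁ ((a , b) , (a′ , b′)) = contradiction
        (Fin.toℕ-injective (≤-antisym b a) , Fin.toℕ-injective (≤-antisym b′ a′)) ne
      ... | inj₂ q = D≡0 q
      pe₁ : ∀ {i m i′} → i ≢ i′ → i′ ≡ i₀ → c′ ⟨ fp , i , m ⟩ⁿ ≡ c ⟨ fp , i , m ⟩ⁿ
      pe₁ i≢ e = pe _ _ λ (q , _) → i≢ (trans q (sym e))
      moved? : ∀ i m → Dec (i ≡ i₀ × m ≡ m₀)
      moved? i m = (i Fin.≟ i₀) ×-dec (m Fin.≟ m₀)
        where open import Relation.Nullary.Decidable using (_×-dec_)
      q₀ r₀ w₀ : Fin n
      q₀ = c′ ⟨ fp , i₀ , m₀ ⟩ⁿ
      r₀ = c ⟨ fr , i₀ , m₀ ⟩ⁿ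
      w₀ = c ⟨ fp , i₀ , m₀ ⟩ⁿ
      edge₀ : w₀ ~ q₀
      edge₀ with D≤1 adj
      ... | inj₂ e = ~-sym e
      ... | inj₁ e = contradiction (≤-trans (≤-reflexive (+-comm 1 (D r₀ q₀))) (≤-trans far (≤-reflexive (cong (D r₀) (sym e))))) (<⇒≱ ≤-refl)
      far₀ : D r₀ q₀ < D r₀ w₀
      far₀ = ≤-trans (≤-reflexive (+-comm 1 (D r₀ q₀))) far
      level₀ : D r₀ w₀ ≡ suc (D r₀ q₀)
      level₀ = ≤-antisym (≤-trans (triangle r₀ q₀ w₀) (≤-trans (+-monoʳ-≤ _ adj) (≤-reflexive (+-comm _ 1)))) far₀
      in₀ : D (c ⟨ fu , i₀ , m₀ ⟩ⁿ) w₀ + D w₀ (c ⟨ fv , i₀ , m₀ ⟩ⁿ) ≤ D (c ⟨ fu , i₀ , m₀ ⟩ⁿ) (c ⟨ fv , i₀ , m₀ ⟩ⁿ)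
      in₀ = proj₂ (proj₂ (proj₂ (proj₁ (proj₂ (proj₂ o)) i₀ m₀)))
      -- A pebble on v cannot move: its next vertex would have to lie between u and v and yet be
      -- farther from r than v.
      unfinished : ∀ {i m} → i ≡ i₀ → m ≡ m₀ → c′ ⟨ fp , i , m ⟩ⁿ ≢ c′ ⟨ fv , i , m ⟩ⁿ
      unfinished refl refl e = <⇒≱ far₀ (≤-trans (≤-trans (triangle r₀ (c ⟨ fu , i₀ , m₀ ⟩ⁿ) w₀)
        (≤-trans (+-monoʳ-≤ _ (≤-trans (m≤m+n _ _) in₀)) (proj₁ (proj₂ (proj₂ (proj₁ (proj₂ (proj₂ o)) i₀ m₀))))))
        (≤-reflexive (cong (D r₀) (sym (trans e (ve i₀ m₀))))))
      grow : ∀ i m → Σ[ tr ∈ Trail (c ⟨ fu , i , m ⟩ⁿ) (c ⟨ fv , i , m ⟩ⁿ) (c ⟨ fr , i , m ⟩ⁿ) (c ⟨ fp , i , m ⟩ⁿ) ]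
             (∀ {z} → z ∈ walkVertices G (walk tr) → On i m z ⊎ (i ≡ i₀ × m ≡ m₀ × z ≡ c ⟨ fp , i , m ⟩ⁿ))
      grow i m with moved? i m
      ... | no ne = let tr , f = transfer (ue i m) (ve i m) (re i m) (pe i m ne) (trail i m) in tr , λ q → inj₁ (f q)
      ... | yes (refl , refl) =
        let tr , f = transfer (ue i m) (ve i m) (re i m) refl (trail i m)
            tr′ , f′ = push edge₀ level₀ in₀ tr
        in tr′ , λ q → [ (λ q → inj₁ (f q)) , (λ e → inj₂ (refl , refl , e)) ]′ (f′ q)
      -- Either z is the current position of the other pebble, which `okPair` allows only at common
      -- ends, or z is no farther from r than the vertex just left, which a move forbids.
      meet : ∀ {i m i′ m′ z} → i ≢ i′ → c ⟨ fr , i , m ⟩ⁿ ≡ c ⟨ fr , i′ , m′ ⟩ⁿ → i ≡ i₀ → m ≡ m₀ →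
             z ≡ c ⟨ fp , i , m ⟩ⁿ → On i′ m′ z → Ends i z × Ends i′ z
      meet {i} {m} {i′} {m′} i≢ rr refl refl refl b
        with sched {i} {m} {i′} {m′} i≢ (trans (re i m) (trans rr (sym (re i′ m′))))
      ... | inj₁ fin = contradiction fin (unfinished refl refl)
      ... | inj₂ f with f b
      ...   | inj₁ e = clash {c′} {c} {i} {m} {i′} {m′} o i≢ rr (trans e (pe₁ (≢-sym i≢) refl))
      ...   | inj₂ l = contradiction (subst (λ z → D z w₀ ≤ D z q₀) (re i m) l) (<⇒≱ far₀)
      apart′ : ∀ {i m i′ m′ z} → i ≢ i′ → c ⟨ fr , i , m ⟩ⁿ ≡ c ⟨ fr , i′ , m′ ⟩ⁿ →
               z ∈ walkVertices G (walk (proj₁ (grow i m))) → z ∈ walkVertices G (walk (proj₁ (grow i′ m′))) → Ends i z × Ends i′ z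
      apart′ {i} {m} {i′} {m′} i≢ rr a b with proj₂ (grow i m) a | proj₂ (grow i′ m′) b
      ... | inj₁ a′ | inj₁ b′ = apart i≢ (trans (re i m) (trans rr (sym (re i′ m′)))) a′ b′
      ... | inj₂ (e , e′ , ez) | inj₁ b′ = meet i≢ rr e e′ ez b′
      ... | inj₁ a′ | inj₂ (e , e′ , ez) = let q , q′ = meet (≢-sym i≢) (sym rr) e e′ ez a′ in q′ , q
      ... | inj₂ (e , _) | inj₂ (e′ , _) = contradiction (trans e (sym e′)) i≢
      sched″ : ∀ {i m i′ m′} (N : Fin n → Set) → (∀ {z} → N z → On i′ m′ z ⊎ (i′ ≡ i₀ × m′ ≡ m₀ × z ≡ c ⟨ fp , i′ , m′ ⟩ⁿ)) →
               i ≢ i′ → c ⟨ fr , i , m ⟩ⁿ ≡ c ⟨ fr , i′ , m′ ⟩ⁿ → c ⟨ fp , i , m ⟩ⁿ ≡ c ⟨ fv , i , m ⟩ⁿ ⊎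
               (∀ {z} → N z → z ≡ c ⟨ fp , i′ , m′ ⟩ⁿ ⊎
                 D (c ⟨ fr , i , m ⟩ⁿ) z ≤ D (c ⟨ fr , i , m ⟩ⁿ) (c ⟨ fp , i , m ⟩ⁿ))
      sched″ {i} {m} {i′} {m′} N g i≢ rr
        with sched {i} {m} {i′} {m′} i≢ (trans (re i m) (trans rr (sym (re i′ m′)))) | moved? i m | moved? i′ m′
      ... | inj₁ fin | yes (e , e′) | _ = contradiction fin (unfinished e e′)
      ... | inj₁ fin | no ne | _ = inj₁ (trans (sym (pe i m ne)) (trans fin (ve i m)))
      ... | inj₂ f | yes (refl , _) | yes (e , _) = contradiction (sym e) i≢
      ... | inj₂ f | yes (refl , refl) | no ne = inj₂ λ b → case g b of λ
        { (inj₂ (e , _)) → contradiction (sym e) i≢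
        ; (inj₁ b′) → [ (λ q → inj₁ (trans q (pe i′ m′ ne))) ,
            (λ l → inj₂ (≤-trans (subst (λ z → D z _ ≤ D z q₀) (re i m) l) (<⇒≤ far₀))) ]′ (f b′) }
      ... | inj₂ f | no ne | no ne′ = inj₂ λ b → case g b of λ
        { (inj₂ (e , e′ , _)) → contradiction (e , e′) ne′
        ; (inj₁ b′) → [ (λ q → inj₁ (trans q (pe i′ m′ ne′))) ,
            (λ l → inj₂ (subst₂ (λ z w → D z _ ≤ D z w) (re i m) (pe i m ne) l)) ]′ (f b′) }
      -- The other pebble moves, and q₀ becomes a vertex it has left. This is the place for `wait`:
      -- the resting pebble is finished, or at least as far from r as q₀.
      ... | inj₂ f | no ne | yes (refl , refl) with wt i m
      ...   | inj₁ q = contradiction q (not-same (≢-sym i≢))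
      ...   | inj₂ (inj₁ q) = contradiction q (1≤D (sym rr))
      ...   | inj₂ (inj₂ (inj₁ q)) = inj₁ (trans (sym (pe i m ne)) (D≡0 q))
      ...   | inj₂ (inj₂ (inj₂ l)) = inj₂ λ b → case g b of λ
        { (inj₂ (_ , _ , e)) → inj₁ e
        ; (inj₁ b′) → inj₂ ([ (λ q → subst₂ (λ a z → D a z ≤ D a (c ⟨ fp , i , m ⟩ⁿ)) (sym rr) (sym q)
              (subst (λ w → D r₀ q₀ ≤ D r₀ w) (pe i m ne) l)) ,
            (λ l → subst₂ (λ z w → D z _ ≤ D z w) (re i m) (pe i m ne) l) ]′ (f b′)) }

    module Extract {c} (T : Trails c) (acc : Accept c) where
      open Trails T

      segment : ∀ i m → Σ[ w ∈ Walk G (fx · i , m) (fy · i , m) ] walkLength G w ≤ D (fx · i , m) (fy · i , m) ×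
                (∀ {z} → z ∈ walkVertices G w → On i m z)
      segment i m = orient (trail i m) (D≡0 (acc i m)) (proj₁ (proj₂ okm)) (proj₁ (proj₂ (proj₂ okm)))
        where
        okm = proj₁ (proj₂ (proj₂ okay)) i m
        -- A trail leads from v back to u, so it is reversed exactly when u is the x end. It is
        -- shortest because it gains D r v - D r u, at most D u v, by steps of one.
        orient : ∀ {u v r p x y} (tr : Trail u v r p) → p ≡ v →
          (D u x ≤ 0 × D v y ≤ 0) ⊎ (D u y ≤ 0 × D v x ≤ 0) → D r u + D u v ≤ D r v →
          Σ[ w ∈ Walk G x y ] walkLength G w ≤ D x y × (∀ {z} → z ∈ walkVertices G w → z ∈ walkVertices G (walk tr))
        orient {u} {v} {r} tr refl o l with o
        ... | inj₁ (a , b) with D≡0 a | D≡0 b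
        ...   | refl | refl = reverse G (walk tr) , ≤-trans (≤-reflexive (length-reverse G (walk tr))) short , ∈-reverse G (walk tr)
          where
          short : walkLength G (walk tr) ≤ D u v
          short = +-cancelʳ-≤ (D r u) _ _ (≤-trans (≤-reflexive (len tr)) (≤-trans (triangle r u v) (≤-reflexive (+-comm (D r u) (D u v)))))
        orient {u} {v} {r} tr refl o l | inj₂ (a , b) with D≡0 a | D≡0 b
        ...   | refl | refl = walk tr , ≤-trans short (≤-reflexive (D-sym u v)) , id
          where
          short : walkLength G (walk tr) ≤ D u v
          short = +-cancelʳ-≤ (D r u) _ _ (≤-trans (≤-reflexive (len tr)) (≤-trans (triangle r u v) (≤-reflexive (+-comm (D r u) (D u v)))))

      -- Keeping the length at the distance from `s i` makes the assembled walk shortest, and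
      -- thereby simple, without comparing its segments with each other.
      Prefix : Fin k → Fin n → Set
      Prefix i b = Σ[ w ∈ Walk G (s i) b ] walkLength G w ≤ D (s i) b × (∀ {z} → z ∈ walkVertices G w → ∃[ m ] On i m z)

      join : ∀ {i a b} → Prefix i a → (w : Walk G a b) → walkLength G w ≤ D a b → D (s i) a + D a b ≤ D (s i) b →
             (∀ {z} → z ∈ walkVertices G w → ∃[ m ] On i m z) → Prefix i b
      join (w₀ , l₀ , f₀) w l l′ f = w₀ ◅◅ w ,
        ≤-trans (≤-reflexive (length-◅◅ G w₀ w)) (≤-trans (+-mono-≤ l₀ l) l′) ,
        λ q → [ f₀ , f ]′ (∈-◅◅ G w₀ w q)

      hop : ∀ {i a b} → Prefix i a → D a b ≤ 1 → D (s i) a + D a b ≤ D (s i) b → ∃[ m ] On i m b → Prefix i b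
      hop {i} {a} {b} P l l′ o with D≤1 l
      ... | inj₁ refl = P
      ... | inj₂ e = join P (e ◅ halt) (n≢0⇒n>0 λ z → ~-irrefl (D≡0 (≤-reflexive z)) e) l′
        λ { (here refl) → last∈ P ; (there (here refl)) → o }
        where
        end∈ : ∀ {a b} (w : Walk G a b) → b ∈ walkVertices G w
        end∈ halt       = here refl
        end∈ (e ◅ w) = there (end∈ w)
        last∈ : Prefix i a → ∃[ m ] On i m a
        last∈ (w , _ , f) = f (end∈ w)

      through : ∀ i m → Prefix i (fx · i , m) → Prefix i (fy · i , m)
      through i m P = let w , l , f = segment i m in
        join P w l (proj₁ (proj₁ (proj₂ (proj₂ okay)) i m)) (λ q → m , f q)

      prefix : ∀ i m → Prefix i (fy · i , m)
      prefix i = <-weakInduction (λ m → Prefix i (fy · i , m))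
        (through i zero (subst (Prefix i) begins (halt , z≤n , λ { (here refl) → zero ,
          subst (On i zero) (sym begins) (let w , _ , f = segment i zero in f (start∈ G w)) })))
        (λ m P → through i (suc m) (hop P (proj₁ (proj₁ (proj₂ okay) i m)) (proj₂ (proj₁ (proj₂ okay) i m))
          (suc m , (let w , _ , f = segment i (suc m) in f (start∈ G w)))))
        where
        open import Data.Fin.Induction using (<-weakInduction)
        begins : s i ≡ fx · i , zero
        begins = D≡0 (proj₁ (proj₂ (proj₁ okay i)))

      whole : ∀ i → Prefix i (t i)
      whole i = subst (Prefix i) (D≡0 (proj₂ (proj₂ (proj₁ okay i)))) (prefix i (fromℕ R))

      path : ∀ i → Path G (s i) (t i)
      path i = let w , l , _ = whole i in record { walk = w ; simple = geodesic-simple w l }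

      path-shortest : ∀ i → IsShortest G (path i)
      path-shortest i Q = ≤-trans (proj₁ (proj₂ (whole i))) (shortest (Path.walk Q))

      -- A common vertex lies on trails of two segments. For equal references the trails meet only
      -- at ends of both paths; otherwise the vertex would be in both intervals, which `okPair`
      -- excludes.
      common : ∀ {i j z} → i ≢ j → z ∈ Path.vertices (path i) → z ∈ Path.vertices (path j) → Ends i z × Ends j z
      common {i} {j} {z} i≢j a b with proj₂ (proj₂ (whole i)) a | proj₂ (proj₂ (whole j)) b
      ... | m , o | m′ , o′ with proj₂ (proj₂ (proj₂ okay)) i m j m′
      ...   | inj₁ q = contradiction q (not-same i≢j)
      ...   | inj₂ (inj₁ q , _) = apart i≢j (D≡0 q) o o′
      ...   | inj₂ (inj₂ f , _) with f z
      ...     | inj₁ l = contradiction (≤-trans (≤-reflexive (+-comm 1 _)) (≤-trans l (inside (trail i m) o))) (<⇒≱ ≤-refl)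
      ...     | inj₂ l = contradiction (≤-trans (≤-reflexive (+-comm 1 _)) (≤-trans l (inside (trail j m′) o′))) (<⇒≱ ≤-refl)

      path-disjoint : ∀ i j → i ≢ j → InternallyDisjoint G (path i) (path j)
      path-disjoint i j i≢j =
        (λ z (a , ns , nt) b → [ ns , nt ]′ (proj₁ (common i≢j a b))) ,
        (λ z (b , ns , nt) a → [ ns , nt ]′ (proj₂ (common i≢j a b)))

-- Completeness: playing the game along a solution

unique-length : ∀ {n} {xs : List (Fin n)} → Unique xs → length xs ≤ n
unique-length {n} {xs} un = Fin.injective⇒≤ {f = Data.List.Base.lookup xs} (λ {i} {j} → inj un i j)
  where
  ∈-lookup′ : ∀ (ys : List (Fin n)) i → Data.List.Base.lookup ys i ∈ ys
  ∈-lookup′ (y ∷ ys) zero    = here refl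
  ∈-lookup′ (y ∷ ys) (suc i) = there (∈-lookup′ ys i)
  inj : ∀ {ys : List (Fin n)} → Unique ys → ∀ i j → Data.List.Base.lookup ys i ≡ Data.List.Base.lookup ys j → i ≡ j
  inj {y ∷ ys} (a ∷ un) zero    zero    e = refl
  inj {y ∷ ys} (a ∷ un) zero    (suc j) e = contradiction e (All.lookup a (∈-lookup′ ys j))
  inj {y ∷ ys} (a ∷ un) (suc i) zero    e = contradiction (sym e) (All.lookup a (∈-lookup′ ys i))
  inj {y ∷ ys} (a ∷ un) (suc i) (suc j) e = cong suc (inj un i j e)

sumF : ∀ {m} → (Fin m → ℕ) → ℕ
sumF {zero}  f = 0
sumF {suc m} f = f zero + sumF (f ∘ suc)

sumF-≤ : ∀ {m c} (f : Fin m → ℕ) → (∀ i → f i ≤ c) → sumF f ≤ m * c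
sumF-≤ {zero}  f l = z≤n
sumF-≤ {suc m} f l = +-mono-≤ (l zero) (sumF-≤ (f ∘ suc) (l ∘ suc))

sumF-cong : ∀ {m} {f g : Fin m → ℕ} → (∀ i → f i ≡ g i) → sumF f ≡ sumF g
sumF-cong {zero}  e = refl
sumF-cong {suc m} e = cong₂ _+_ (e zero) (sumF-cong (e ∘ suc))

sumF-drop : ∀ {m} {f g : Fin m → ℕ} i → f i ≡ suc (g i) → (∀ j → j ≢ i → f j ≡ g j) → sumF f ≡ suc (sumF g)
sumF-drop {suc m} zero    e o = cong₂ _+_ e (sumF-cong λ j → o (suc j) λ ())
sumF-drop {suc m} {f} {g} (suc i) e o = trans (cong₂ _+_ (o zero λ ()) (sumF-drop i e λ j ne → o (suc j) (ne ∘ Fin.suc-injective)))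
  (+-suc (g zero) (sumF (g ∘ suc)))

least : ∀ {m} {P : Fin m → Set} → (∀ i → Dec (P i)) → (key : Fin m → ℕ) →
        (∃[ i ] P i × ∀ {j} → P j → key i ≤ key j) ⊎ (∀ i → ¬ P i)
least {zero}  P? key = inj₂ λ ()
least {suc m} P? key with least (P? ∘ suc) (key ∘ suc) | P? zero
... | inj₂ none | no ¬p = inj₂ λ { zero → ¬p ; (suc i) → none i }
... | inj₂ none | yes p = inj₁ (zero , p , λ { {zero} _ → ≤-refl ; {suc j} q → contradiction q (none j) })
... | inj₁ (i , q , f) | no ¬p = inj₁ (suc i , q , λ { {zero} p → contradiction p ¬p ; {suc j} → f })
... | inj₁ (i , q , f) | yes p with key zero ≤? key (suc i)
...   | yes l = inj₁ (zero , p , λ { {zero} _ → ≤-refl ; {suc j} q′ → ≤-trans l (f q′) })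
...   | no l  = inj₁ (suc i , q , λ { {zero} _ → <⇒≤ (≰⇒> l) ; {suc j} → f })

module _ {n} (G : Graph n) where
  open Graph G

  place : ∀ {a b} → Walk G a b → ℕ → Fin n
  place {a} halt       _       = a
  place {a} (e ◅ w) zero    = a
  place     (e ◅ w) (suc j) = place w j

  place-0 : ∀ {a b} (w : Walk G a b) → place w 0 ≡ a
  place-0 halt       = refl
  place-0 (e ◅ w) = refl

  place-end : ∀ {a b} (w : Walk G a b) → place w (walkLength G w) ≡ b
  place-end halt       = refl
  place-end (e ◅ w) = place-end w

  place-edge : ∀ {a b} (w : Walk G a b) {j} → j < walkLength G w → place w j ~ place w (suc j)
  place-edge (e ◅ w) {zero}  l       = subst (_ ~_) (sym (place-0 w)) e
  place-edge (e ◅ w) {suc j} (s≤s l) = place-edge w l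

  place∈ : ∀ {a b} (w : Walk G a b) j → place w j ∈ walkVertices G w
  place∈ halt       j       = here refl
  place∈ (e ◅ w) zero    = here refl
  place∈ (e ◅ w) (suc j) = there (place∈ w j)

  length-vertices : ∀ {a b} (w : Walk G a b) → length (walkVertices G w) ≡ suc (walkLength G w)
  length-vertices halt       = refl
  length-vertices (e ◅ w) = cong suc (length-vertices w)

  module _ {D : Fin n → Fin n → ℕ} (isDist : IsDist G D) where
    open IsDist isDist

    place-≤ : ∀ {a b} (w : Walk G a b) i j → i + j ≤ walkLength G w → D (place w i) (place w (i + j)) ≤ j
    place-≤ w i zero    l = ≤-reflexive (trans (cong (λ z → D (place w i) (place w z)) (+-identityʳ i)) (D-refl _))
    place-≤ w i (suc j) l = subst (λ z → D (place w i) (place w z) ≤ suc j) (sym (+-suc i j))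
      (≤-trans (triangle _ (place w (i + j)) _) (≤-trans (+-mono-≤ (place-≤ w i j (<⇒≤ l′)) (D-edge (place-edge w l′)))
        (≤-reflexive (+-comm j 1))))
      where
      l′ : i + j < walkLength G w
      l′ = ≤-trans (≤-reflexive (sym (+-suc i j))) l

    -- The stretches before, between and after the two places have at most the expected distances,
    -- and together they must reach the distance of the ends, so none falls short.
    place-geodesic : ∀ {a b} (w : Walk G a b) → walkLength G w ≤ D a b → ∀ {i j} → i ≤ j → j ≤ walkLength G w →
                     D (place w i) (place w j) ≡ j ∸ i
    place-geodesic {a} {b} w short {i} {j} i≤j j≤l = ≤-antisym upper lower
      where
      ℓ = walkLength G w
      upper : D (place w i) (place w j) ≤ j ∸ i
      upper = subst (λ z → D (place w i) (place w z) ≤ j ∸ i) (m+[n∸m]≡n i≤j)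
        (place-≤ w i (j ∸ i) (≤-trans (≤-reflexive (m+[n∸m]≡n i≤j)) j≤l))
      before : D a (place w i) ≤ i
      before = subst (λ z → D z (place w i) ≤ i) (place-0 w) (place-≤ w 0 i (≤-trans i≤j j≤l))
      after : D (place w j) b ≤ ℓ ∸ j
      after = subst₂ (λ y z → D (place w j) y ≤ z) (trans (cong (place w) (m+[n∸m]≡n j≤l)) (place-end w)) refl
        (place-≤ w j (ℓ ∸ j) (≤-reflexive (m+[n∸m]≡n j≤l)))
      total : ℓ ≤ i + (D (place w i) (place w j) + (ℓ ∸ j))
      total = ≤-trans short (≤-trans (triangle a (place w i) b) (+-mono-≤ before
        (≤-trans (triangle (place w i) (place w j) b) (+-monoʳ-≤ _ after))))
      lower : j ∸ i ≤ D (place w i) (place w j)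
      lower = m≤n+o⇒m∸n≤o j i (+-cancelʳ-≤ (ℓ ∸ j) j _ (≤-trans (≤-reflexive (m+[n∸m]≡n j≤l))
        (≤-trans total (≤-reflexive (sym (+-assoc i _ (ℓ ∸ j)))))))

    path-short : ∀ {a b} (P : Path G a b) → walkLength G (Path.walk P) < n
    path-short P = ≤-trans (≤-reflexive (sym (length-vertices (Path.walk P)))) (unique-length (Path.simple P))

    -- `IsShortest` compares with simple paths only, but a walk that realises the distance is
    -- simple. The distance is realised since a simple path has fewer than n edges.
    shortest-length : ∀ {a b} (P : Path G a b) → IsShortest G P → walkLength G (Path.walk P) ≤ D a b
    shortest-length {a} {b} P min = let w , e = realised (≤-<-trans (shortest (Path.walk P)) (path-short P)) in
      ≤-trans (min (record { walk = w ; simple = geodesic-simple G isDist w (≤-reflexive e) })) (≤-reflexive e)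

-- The number `R` of `Cutting.Pieces`, stated apart from all graphs because the program has to be
-- built from it.
bound : ℕ → ℕ
bound k = suc k * (k * (k * (k * 3)) ^ k) * (k * 1) * 2

module Playing {n} (G : Graph n) {D : Fin n → Fin n → ℕ} (isDist : IsDist G D) (k R : ℕ) (τ : Fin (k * 2) → Fin n) where
  open Graph G
  open IsDist isDist
  open Formulas k R hiding (V)
  open Meaning n D _~_
  open Game G isDist k R τ

  data Play : ℕ → State → Set where
    begin : ∀ {r c} → Init c → Play r c
    turn  : ∀ {r c c′} → Play r c′ → Step c′ c → Play (suc r) c

  record Oriented (X Y r : Fin n) (ℓ : ℕ) (OnPath : Fin n → Set) : Set where
    field
      u v      : Fin n
      pos      : ℕ → Fin n
      pos-0    : pos 0 ≡ u
      pos-ℓ    : pos ℓ ≡ v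
      ends-uv  : (u ≡ X × v ≡ Y) ⊎ (u ≡ Y × v ≡ X)
      straight : D r v ≡ D r u + ℓ
      geodesic : ∀ {a b} → a ≤ b → b ≤ ℓ → D (pos a) (pos b) ≡ b ∸ a
      on-path  : ∀ q → OnPath (pos q)

    from-u : ∀ {q} → q ≤ ℓ → D u (pos q) ≡ q
    from-u {q} l = trans (cong (λ z → D z (pos q)) (sym pos-0)) (geodesic z≤n l)

    to-v : ∀ {q} → q ≤ ℓ → D (pos q) v ≡ ℓ ∸ q
    to-v {q} l = trans (cong (D (pos q)) (sym pos-ℓ)) (geodesic l ≤-refl)

    u-v : D u v ≡ ℓ
    u-v = trans (cong (D u) (sym pos-ℓ)) (from-u ≤-refl)

    between : ∀ {q} → q ≤ ℓ → D u (pos q) + D (pos q) v ≤ D u v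
    between l = ≤-reflexive (trans (cong₂ _+_ (from-u l) (to-v l)) (trans (m+[n∸m]≡n l) (sym u-v)))

    -- Both ends have the right distance from r and the whole stretch has no slack, so neither has
    -- any vertex on it.
    height′ : ∀ {q} → q ≤ ℓ → D r (pos q) ≡ D r u + q
    height′ {q} l = ≤-antisym (≤-trans (triangle r u (pos q)) (+-monoʳ-≤ _ (≤-reflexive (from-u l))))
      (+-cancelʳ-≤ (ℓ ∸ q) _ _ (≤-trans (≤-reflexive (trans (+-assoc (D r u) q (ℓ ∸ q)) (cong (D r u +_) (m+[n∸m]≡n l))))
        (≤-trans (≤-reflexive (sym straight)) (≤-trans (triangle r (pos q) v) (+-monoʳ-≤ _ (≤-reflexive (to-v l)))))))

  module _ (γ : ℕ → Fin n) {lo hi L : ℕ} (lo≤hi : lo ≤ hi) (hi≤L : hi ≤ L)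
           (geo : ∀ {a b} → a ≤ b → b ≤ L → D (γ a) (γ b) ≡ b ∸ a) where

    -- The piece is read backwards if its reference sees the later end first.
    orient : ∀ {r} → D r (γ hi) ≡ D r (γ lo) + D (γ lo) (γ hi) ⊎ D r (γ lo) ≡ D r (γ hi) + D (γ lo) (γ hi) →
             Oriented (γ lo) (γ hi) r (hi ∸ lo) (λ z → ∃[ j ] z ≡ γ j)
    orient {r} (inj₁ e) = record
      { u = γ lo ; v = γ hi ; pos = λ q → γ (lo + q)
      ; pos-0 = cong γ (+-identityʳ lo) ; pos-ℓ = cong γ (m+[n∸m]≡n lo≤hi) ; ends-uv = inj₁ (refl , refl)
      ; straight = trans e (cong (D r (γ lo) +_) (geo lo≤hi hi≤L))
      ; geodesic = λ {a} {b} l l′ → trans (geo (+-monoʳ-≤ lo l)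
          (≤-trans (≤-trans (+-monoʳ-≤ lo l′) (≤-reflexive (m+[n∸m]≡n lo≤hi))) hi≤L)) ([m+n]∸[m+o]≡n∸o lo b a)
      ; on-path = λ q → lo + q , refl }
    orient {r} (inj₂ e) = record
      { u = γ hi ; v = γ lo ; pos = λ q → γ (hi ∸ q)
      ; pos-0 = refl ; pos-ℓ = cong γ (m∸[m∸n]≡n lo≤hi) ; ends-uv = inj₂ (refl , refl)
      ; straight = trans e (cong (D r (γ hi) +_) (geo lo≤hi hi≤L))
      ; geodesic = λ {a} {b} l l′ → trans (D-sym _ _) (trans (geo (∸-monoʳ-≤ hi l) (≤-trans (m∸n≤m hi a) hi≤L))
          (flip (≤-trans l′ (m∸n≤m hi lo)) l))
      ; on-path = λ q → hi ∸ q , refl }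
      where
      flip : ∀ {a b} → b ≤ hi → a ≤ b → (hi ∸ a) ∸ (hi ∸ b) ≡ b ∸ a
      flip {a} {b} b≤ a≤b = +-cancelʳ-≡ (hi ∸ b) _ _ (trans (m∸n+n≡m (∸-monoʳ-≤ hi a≤b))
        (sym (trans (sym (+-∸-comm (hi ∸ b) a≤b)) (cong (_∸ a) (m+[n∸m]≡n b≤)))))

  module Curves (P : ∀ i → Path G (s i) (t i)) (shortestP : ∀ i → walkLength G (Path.walk (P i)) ≤ D (s i) (t i))
           (disjoint : ∀ i j → i ≢ j → InternallyDisjoint G (P i) (P j)) where

    γ : Fin k → ℕ → Fin n
    γ i = place G (Path.walk (P i))

    L : Fin k → ℕ
    L i = walkLength G (Path.walk (P i))

    geo : ∀ i {a b} → a ≤ b → b ≤ L i → D (γ i a) (γ i b) ≡ b ∸ a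
    geo i = place-geodesic G isDist (Path.walk (P i)) (shortestP i)

    γ-ends : ∀ {i j z} → i ≢ j → (∃[ a ] z ≡ γ i a) → (∃[ b ] z ≡ γ j b) → Ends i z × Ends j z
    γ-ends {i} {j} {z} i≢j (a , refl) (b , e) = at-end i≢j z∈i z∈j , at-end (≢-sym i≢j) z∈j z∈i
      where
      z∈i = place∈ G (Path.walk (P i)) a
      z∈j = subst (_∈ Path.vertices (P j)) (sym e) (place∈ G (Path.walk (P j)) b)
      at-end : ∀ {i j} → i ≢ j → z ∈ Path.vertices (P i) → z ∈ Path.vertices (P j) → Ends i z
      at-end {i} {j} i≢j a b with z Fin.≟ s i | z Fin.≟ t i
      ... | yes e | _     = inj₁ e
      ... | no _  | yes e = inj₂ e
      ... | no ns | no nt = contradiction b (proj₁ (disjoint i j i≢j) z (a , ns , nt))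

  record Plan : Set where
    field
      γ      : Fin k → ℕ → Fin n
      L      : Fin k → ℕ
      geo    : ∀ i {a b} → a ≤ b → b ≤ L i → D (γ i a) (γ i b) ≡ b ∸ a
      γ-0    : ∀ i → γ i 0 ≡ s i
      γ-L    : ∀ i → γ i (L i) ≡ t i
      L<n    : ∀ i → L i < n
      meets  : ∀ {i j z} → i ≢ j → (∃[ a ] z ≡ γ i a) → (∃[ b ] z ≡ γ j b) → Ends i z × Ends j z
      lo hi  : Fin k → Fin (suc R) → ℕ
      lo-0   : ∀ i → lo i zero ≡ 0
      hi-R   : ∀ i → hi i (fromℕ R) ≡ L i
      lo≤hi  : ∀ i m → lo i m ≤ hi i m
      hi≤L   : ∀ i m → hi i m ≤ L i
      link   : ∀ i m → lo i (suc m) ≡ hi i (inject₁ m) ⊎ lo i (suc m) ≡ suc (hi i (inject₁ m))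
      ref    : Fin k → Fin (suc R) → Fin n
      piece  : ∀ i m → Oriented (γ i (lo i m)) (γ i (hi i m)) (ref i m) (hi i m ∸ lo i m) (λ z → ∃[ j ] z ≡ γ i j)
      agree  : ∀ {i m i′ m′ z} → i ≢ i′ →
        D (γ i (lo i m)) z + D z (γ i (hi i m)) ≤ D (γ i (lo i m)) (γ i (hi i m)) →
        D (γ i′ (lo i′ m′)) z + D z (γ i′ (hi i′ m′)) ≤ D (γ i′ (lo i′ m′)) (γ i′ (hi i′ m′)) →
        ref i m ≡ ref i′ m′

  module Run (plan : Plan) where
    open Plan plan

    module O i m = Oriented (piece i m)

    len : Fin k → Fin (suc R) → ℕ
    len i m = hi i m ∸ lo i m

    Count : Set
    Count = Fin (k * suc R) → ℕ

    state : Count → State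
    state q ⟨ fx , i , m ⟩ⁿ = γ i (lo i m)
    state q ⟨ fy , i , m ⟩ⁿ = γ i (hi i m)
    state q ⟨ fu , i , m ⟩ⁿ = O.u i m
    state q ⟨ fv , i , m ⟩ⁿ = O.v i m
    state q ⟨ fr , i , m ⟩ⁿ = ref i m
    state q ⟨ fp , i , m ⟩ⁿ = O.pos i m (q (combine i m))

    Valid : Count → Set
    Valid q = ∀ i m → q (combine i m) ≤ len i m

    zeroD : ∀ {a b} → a ≡ b → D a b ≤ 0
    zeroD {a} refl = ≤-reflexive (D-refl a)

    oneD : ∀ {a b} → a ≢ b → 1 ≤ D a b
    oneD a≢b = n≢0⇒n>0 λ z → a≢b (D≡0 (≤-reflexive z))

    toEnds : ∀ {i z} → Ends i z → D z (s i) ≤ 0 ⊎ D z (t i) ≤ 0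
    toEnds = [ inj₁ ∘ zeroD , inj₂ ∘ zeroD ]′

    from-s : ∀ i {a} → a ≤ L i → D (s i) (γ i a) ≡ a
    from-s i {a} l = trans (cong (λ z → D z (γ i a)) (sym (γ-0 i))) (geo i z≤n l)

    inside-xy : ∀ i m {z} → D (O.u i m) z + D z (O.v i m) ≤ D (O.u i m) (O.v i m) →
                D (γ i (lo i m)) z + D z (γ i (hi i m)) ≤ D (γ i (lo i m)) (γ i (hi i m))
    inside-xy i m {z} l with O.u i m | O.v i m | O.ends-uv i m
    ... | _ | _ | inj₁ (refl , refl) = l
    ... | _ | _ | inj₂ (refl , refl) = subst₂ _≤_
      (trans (+-comm (D (γ i (hi i m)) z) _) (cong₂ _+_ (D-sym z _) (D-sym _ z))) (D-sym (γ i (hi i m)) (γ i (lo i m))) l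

    okay-state : ∀ c {q} → Valid q → ⟦ ok ⟧ᶠ (val₂ c (state q))
    okay-state c {q} vq = path , links , segs , pairs
      where
      path : ∀ i → _
      path i = ≤-trans (≤-reflexive (+-comm (D (s i) (t i)) 1)) (≤-<-trans (≤-reflexive (trans (cong (D (s i)) (sym (γ-L i))) (from-s i ≤-refl))) (L<n i)) ,
        zeroD (trans (sym (γ-0 i)) (cong (γ i) (sym (lo-0 i)))) ,
        zeroD (trans (cong (γ i) (hi-R i)) (γ-L i))
      links : ∀ i m → _
      links i m = ≤-trans (≤-reflexive (geo i h≤ l≤L)) gap ,
        ≤-reflexive (trans (cong₂ _+_ (from-s i (hi≤L i (inject₁ m))) (geo i h≤ l≤L)) (trans (m+[n∸m]≡n h≤) (sym (from-s i l≤L))))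
        where
        l≤L : lo i (suc m) ≤ L i
        l≤L = ≤-trans (lo≤hi i (suc m)) (hi≤L i (suc m))
        h≤ : hi i (inject₁ m) ≤ lo i (suc m)
        h≤ with link i m
        ... | inj₁ e = ≤-reflexive (sym e)
        ... | inj₂ e = ≤-trans (n≤1+n _) (≤-reflexive (sym e))
        gap : lo i (suc m) ∸ hi i (inject₁ m) ≤ 1
        gap with link i m
        ... | inj₁ e = ≤-trans (≤-reflexive (trans (cong (_∸ hi i (inject₁ m)) e) (n∸n≡0 (hi i (inject₁ m))))) z≤n
        ... | inj₂ e = ≤-reflexive (trans (cong (_∸ hi i (inject₁ m)) e) (m+n∸n≡m 1 (hi i (inject₁ m))))
      segs : ∀ i m → _
      segs i m = ≤-reflexive (trans (cong₂ _+_ (from-s i (≤-trans (lo≤hi i m) (hi≤L i m))) (geo i (lo≤hi i m) (hi≤L i m)))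
            (trans (m+[n∸m]≡n (lo≤hi i m)) (sym (from-s i (hi≤L i m))))) ,
        [ (λ (a , b) → inj₁ (zeroD a , zeroD b)) , (λ (a , b) → inj₂ (zeroD a , zeroD b)) ]′ (O.ends-uv i m) ,
        ≤-reflexive (trans (cong (D (ref i m) (O.u i m) +_) (O.u-v i m)) (sym (O.straight i m))) ,
        O.between i m (vq i m)
      pairs : ∀ i m i′ m′ → ⟦ okPair i m i′ m′ ⟧ᶠ (val₂ c (state q))
      pairs i m i′ m′ with i Fin.≟ i′
      ... | yes refl = inj₁ (≤-refl , ≤-refl)
      ... | no i≢ = inj₂ (coupled , clear)
        where
        coupled : _
        coupled with ref i m Fin.≟ ref i′ m′
        ... | yes e = inj₁ (zeroD e)
        ... | no ne = inj₂ sepa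
          where
          sepa : ∀ z → D (O.u i m) (O.v i m) + 1 ≤ D (O.u i m) z + D z (O.v i m) ⊎
                       D (O.u i′ m′) (O.v i′ m′) + 1 ≤ D (O.u i′ m′) z + D z (O.v i′ m′)
          sepa z with D (O.u i m) (O.v i m) + 1 ≤? D (O.u i m) z + D z (O.v i m)
                    | D (O.u i′ m′) (O.v i′ m′) + 1 ≤? D (O.u i′ m′) z + D z (O.v i′ m′)
          ... | yes l | _     = inj₁ l
          ... | no _  | yes l = inj₂ l
          -- A vertex in both intervals would force the references to agree.
          ... | no l  | no l′ = contradiction (agree i≢ (inside-xy i m (in′ l)) (inside-xy i′ m′ (in′ l′))) ne
            where
            in′ : ∀ {a b} → ¬ (a + 1 ≤ b) → b ≤ a
            in′ {a} f = ≮⇒≥ λ l → f (≤-trans (≤-reflexive (+-comm a 1)) l)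
        clear : _
        clear with state q ⟨ fp , i , m ⟩ⁿ Fin.≟ state q ⟨ fp , i′ , m′ ⟩ⁿ
        ... | no ne = inj₂ (inj₁ (oneD ne))
        ... | yes e = let a , b = meets i≢ (O.on-path i m (q (combine i m)))
                            (let j , e′ = O.on-path i′ m′ (q (combine i′ m′)) in j , trans e e′)
                      in inj₂ (inj₂ (toEnds a , toEnds b))

    Unfinished : Count → Fin k → Fin (suc R) → Set
    Unfinished q i m = q (combine i m) < len i m

    key : Count → Fin k → Fin (suc R) → ℕ
    key q i m = D (ref i m) (O.pos i m (q (combine i m)))

    private
      split′ : Fin (k * suc R) → Fin k × Fin (suc R)
      split′ = remQuot {k} (suc R)

      at-combine : ∀ {A : Set} (f : Fin k → Fin (suc R) → A) i m → uncurry f (split′ (combine i m)) ≡ f i m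
      at-combine f i m = cong (uncurry f) (Fin.remQuot-combine i m)

    -- The minimum is taken over all unfinished pebbles, each measured from its own reference; in
    -- particular the chosen one is nearest among those sharing its reference.
    next : ∀ q → (∃[ i ] ∃[ m ] Unfinished q i m × (∀ {i′ m′} → Unfinished q i′ m′ → key q i m ≤ key q i′ m′)) ⊎
                 (∀ i m → ¬ Unfinished q i m)
    next q with least (λ j → uncurry (λ i m → q (combine i m) <? len i m) (split′ j)) (uncurry (key q) ∘ split′)
    ... | inj₁ (j , un , f) = inj₁ (proj₁ (split′ j) , proj₂ (split′ j) , un ,
      λ {i′} {m′} un′ → subst (uncurry (key q) (split′ j) ≤_) (at-combine (key q) i′ m′)
        (f {combine i′ m′} (subst (λ z → uncurry (λ i m → q (combine i m) < len i m) z) (sym (Fin.remQuot-combine i′ m′)) un′)))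
    ... | inj₂ none = inj₂ λ i m un → none (combine i m)
      (subst (λ z → uncurry (λ i m → q (combine i m) < len i m) z) (sym (Fin.remQuot-combine i m)) un)

    bump : Count → Fin (k * suc R) → Count
    bump q a j with j Fin.≟ a
    ... | yes _ = suc (q j)
    ... | no _  = q j

    bump-same : ∀ q a → bump q a a ≡ suc (q a)
    bump-same q a with a Fin.≟ a
    ... | yes _ = refl
    ... | no ne = contradiction refl ne

    bump-other : ∀ q {a j} → j ≢ a → bump q a j ≡ q j
    bump-other q {a} {j} ne with j Fin.≟ a
    ... | yes e = contradiction e ne
    ... | no _  = refl

    remaining : Count → Fin (k * suc R) → ℕ
    remaining q j = uncurry len (split′ j) ∸ q j

    module _ {q} (vq : Valid q) {i₀ m₀} (un : Unfinished q i₀ m₀)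
             (min : ∀ {i m} → Unfinished q i m → key q i₀ m₀ ≤ key q i m) where

      private
        a₀ = combine i₀ m₀
        q′ = bump q a₀

        same-index : ∀ {i m} → combine i m ≡ a₀ → i ≡ i₀ × m ≡ m₀
        same-index {i} {m} e = Fin.combine-injectiveˡ i m i₀ m₀ e , Fin.combine-injectiveʳ i m i₀ m₀ e

      bump-valid : Valid q′
      bump-valid i m = go (combine i m Fin.≟ a₀)
        where
        go : Dec (combine i m ≡ a₀) → q′ (combine i m) ≤ len i m
        go (no ne) = ≤-trans (≤-reflexive (bump-other q ne)) (vq i m)
        go (yes e) with same-index e
        ... | refl , refl = ≤-trans (≤-reflexive (bump-same q a₀)) un

      bump-remaining : sumF (remaining q) ≡ suc (sumF (remaining q′))
      bump-remaining = sumF-drop a₀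
        (trans (cong (_∸ q a₀) (at-combine len i₀ m₀)) (trans (+-∸-assoc 1 un)
          (cong suc (sym (cong₂ _∸_ (at-combine len i₀ m₀) (bump-same q a₀))))))
        (λ j ne → cong (uncurry len (split′ j) ∸_) (sym (bump-other q ne)))

      private
        p-new : O.pos i₀ m₀ (q′ a₀) ≡ O.pos i₀ m₀ (suc (q a₀))
        p-new = cong (O.pos i₀ m₀) (bump-same q a₀)

      bump-step : Step (state q) (state q′)
      bump-step = okay-state (state q) {q′} bump-valid ,
        (λ i m → zeroD refl , zeroD refl , zeroD refl , zeroD refl , zeroD refl) ,
        i₀ , m₀ , stay , adjacent , farther , waits
        where
        stay : ∀ i m → _
        stay i m = go (combine i m Fin.≟ a₀)
          where
          go : Dec (combine i m ≡ a₀) → ⟦ (same i₀ i ∧ same m₀ m) ∨ eq (was fp i m) (fp at i , m) ⟧ᶠ (val₂ (state q) (state q′))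
          go (no ne) = inj₂ (zeroD (cong (O.pos i m) (sym (bump-other q ne))))
          go (yes e) with same-index e
          ... | refl , refl = inj₁ ((≤-refl , ≤-refl) , (≤-refl , ≤-refl))
        adjacent : D (O.pos i₀ m₀ (q a₀)) (O.pos i₀ m₀ (q′ a₀)) ≤ 1
        adjacent = ≤-reflexive (trans (cong (D _) p-new) (trans (O.geodesic i₀ m₀ (n≤1+n _) un) (m+n∸n≡m 1 (q a₀))))
        farther : D (ref i₀ m₀) (O.pos i₀ m₀ (q a₀)) + 1 ≤ D (ref i₀ m₀) (O.pos i₀ m₀ (q′ a₀))
        farther = ≤-reflexive (trans (cong (_+ 1) (O.height′ i₀ m₀ (vq i₀ m₀))) (trans (+-comm _ 1)
          (trans (sym (+-suc _ (q a₀))) (trans (sym (O.height′ i₀ m₀ un)) (cong (D (ref i₀ m₀)) (sym p-new))))))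
        waits : ∀ i m → ⟦ wait i₀ m₀ i m ⟧ᶠ (val₂ (state q) (state q′))
        waits i m with ref i₀ m₀ Fin.≟ ref i m | q (combine i m) <? len i m
        ... | no ne | _ = inj₂ (inj₁ (oneD ne))
        ... | yes _ | no fin = inj₂ (inj₂ (inj₁ (zeroD (trans (cong (O.pos i m) (≤-antisym (vq i m) (≮⇒≥ fin))) (O.pos-ℓ i m)))))
        ... | yes e | yes un′ = inj₂ (inj₂ (inj₂ (subst (λ z → D (ref i₀ m₀) (O.pos i₀ m₀ (q a₀)) ≤ D z (O.pos i m (q (combine i m)))) (sym e) (min un′))))

    play : ∀ f q {a} → Valid q → sumF (remaining q) ≡ f → Play a (state q) →
           ∃[ q′ ] Valid q′ × (∀ i m → ¬ Unfinished q′ i m) × Play (a + f) (state q′)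
    play f q {a} vq e pl with next q
    play zero q {a} vq e pl | inj₂ none = q , vq , none , subst (λ z → Play z (state q)) (sym (+-identityʳ a)) pl
    play (suc f) q {a} vq e pl | inj₂ none = contradiction (trans (sym e) (sumF-all-zero (remaining q)
        (λ j → subst (λ z → uncurry len (split′ j) ∸ q z ≡ 0) (Fin.combine-remQuot {k} (suc R) j)
          (m≤n⇒m∸n≡0 (≮⇒≥ (none _ _)))))) λ ()
      where
      sumF-all-zero : ∀ {m} (g : Fin m → ℕ) → (∀ i → g i ≡ 0) → sumF g ≡ 0
      sumF-all-zero {zero}  g z = refl
      sumF-all-zero {suc m} g z = cong₂ _+_ (z zero) (sumF-all-zero (g ∘ suc) (z ∘ suc))
    play zero q {a} vq e pl | inj₁ (i₀ , m₀ , un , min) = contradiction (trans (sym (bump-remaining {q} vq un min)) e) λ ()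
    play (suc f) q {a} vq e pl | inj₁ (i₀ , m₀ , un , min) =
      let q₁ , v₁ , fin , pl₁ = play f (bump q (combine i₀ m₀)) (bump-valid {q} vq un min)
            (suc-injective (trans (sym (bump-remaining {q} vq un min)) e)) (turn pl (bump-step {q} vq un min))
      in q₁ , v₁ , fin , subst (λ z → Play z (state q₁)) (sym (+-suc a f)) pl₁

    -- Every move uses up one step of one segment, and a segment is shorter than n, so n moves per
    -- segment suffice.
    win : ∃[ c ] Accept c × Play (k * suc R * n) c
    win = state q , (λ i m → zeroD (trans (cong (O.pos i m) (≤-antisym (vq i m) (≮⇒≥ (fin i m)))) (O.pos-ℓ i m))) ,
      more-time (sumF-≤ (remaining (λ _ → 0)) (λ j → ≤-trans (m∸n≤m (uncurry len (split′ j)) 0) (≤-trans (m∸n≤m (uncurry hi (split′ j)) (uncurry lo (split′ j)))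
        (≤-trans (hi≤L _ _) (<⇒≤ (L<n _)))))) pl
      where
      opening = play (sumF (remaining (λ _ → 0))) (λ _ → 0) {0} (λ _ _ → z≤n) refl
        (begin (okay-state (state (λ _ → 0)) {λ _ → 0} (λ _ _ → z≤n) , λ i m → zeroD (O.pos-0 i m)))
      q = proj₁ opening
      vq = proj₁ (proj₂ opening)
      fin = proj₁ (proj₂ (proj₂ opening))
      pl = proj₂ (proj₂ (proj₂ opening))
      more-time : ∀ {a b c} → a ≤ b → Play a c → Play b c
      more-time l (begin i) = begin i
      more-time (s≤s l) (turn p s) = turn (more-time l p) s

-- Weights: costs as exponents

weightₑ : ∀ {V} → Expr V → ℕ
weightₑ (var x)   = 2
weightₑ (con m)   = 2
weightₑ (a ⊕ b)   = weightₑ a + weightₑ b + 1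
weightₑ (a ⊖ b)   = weightₑ a + weightₑ b + 1
weightₑ (get a)   = weightₑ a + 2
weightₑ (sum<n a) = weightₑ a + 5

weight : ∀ {V} → Stmt V → ℕ
weight skip      = 0
weight (put a b) = weightₑ a + weightₑ b + 2
weight (s ⨾ t)   = weight s + weight t
weight (for<n s) = weight s + 5

private
  ⊔-suc : ∀ {a b x y} → a ≤ x → b ≤ y → a ⊔ suc b ≤ x + y + 1
  ⊔-suc {a} {b} {x} {y} l l′ = ⊔-lub (≤-trans l (≤-trans (m≤m+n x y) (m≤m+n _ 1)))
    (≤-trans (s≤s l′) (≤-trans (≤-reflexive (+-comm 1 y)) (+-monoˡ-≤ 1 (m≤n+m y x))))

-- The weight is made for the running time but bounds the registers as well, so a single number
-- determines `W`.
heightₑ≤ : ∀ {V} (e : Expr V) → heightₑ e ≤ weightₑ e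
heightₑ≤ (var x)   = s≤s z≤n
heightₑ≤ (con m)   = s≤s z≤n
heightₑ≤ (a ⊕ b)   = ⊔-suc (heightₑ≤ a) (heightₑ≤ b)
heightₑ≤ (a ⊖ b)   = ⊔-suc (heightₑ≤ a) (heightₑ≤ b)
heightₑ≤ (get a)   = ≤-trans (heightₑ≤ a) (m≤m+n _ 2)
heightₑ≤ (sum<n a) = ≤-trans (≤-reflexive (+-comm 2 _)) (+-mono-≤ (heightₑ≤ a) (≤ᵇ⇒≤ 2 5 tt))

height≤ : ∀ {V} (s : Stmt V) → height s ≤ weight s
height≤ skip      = z≤n
height≤ (put a b) = ≤-trans (⊔-suc (heightₑ≤ a) (heightₑ≤ b)) (+-monoʳ-≤ (weightₑ a + weightₑ b) (s≤s z≤n))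
height≤ (s ⨾ t)   = ⊔-lub (≤-trans (height≤ s) (m≤m+n _ _)) (≤-trans (height≤ t) (m≤n+m _ _))
height≤ (for<n s) = ≤-trans (≤-reflexive (+-comm 2 _)) (+-mono-≤ (height≤ s) (≤ᵇ⇒≤ 2 5 tt))

n<2^n : ∀ m → m < 2 ^ m
n<2^n zero    = s≤s z≤n
n<2^n (suc m) = ≤-trans (s≤s (n<2^n m)) (≤-trans (+-mono-≤ (m^n>0 2 m) (m≤m+n (2 ^ m) 0)) ≤-refl)

module Costs (n : ℕ) where
  open Semantics n

  N : ℕ
  N = 2 ⊔ n

  2≤N : 2 ≤ N
  2≤N = m≤m⊔n 2 n

  instance
    N≢0 : NonZero N
    N≢0 = >-nonZero (≤-trans (s≤s z≤n) 2≤N)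

  pow : ∀ a → 2 ^ a ≤ N ^ a
  pow a = ^-monoˡ-≤ a 2≤N

  grow : ∀ a b {x y z} → x ≤ N ^ a → y ≤ N ^ b → z ≤ x * y → z ≤ N ^ (a + b)
  grow a b l l′ l″ = ≤-trans l″ (≤-trans (*-mono-≤ l l′) (≤-reflexive (sym (^-distribˡ-+-* N a b))))

  -- The successors let a product absorb a sum: 1 + x + y is at most (1 + x)(1 + y). So costs that
  -- add up have exponents that add up.
  seq-cost : ∀ a b {x y} → suc x ≤ N ^ a → suc y ≤ N ^ b → suc (x + y) ≤ N ^ (a + b)
  seq-cost a b {x} {y} l l′ = grow a b l l′ (s≤s (≤-trans (≤-reflexive (+-comm x y)) (+-monoʳ-≤ y (m≤m*n x (suc y)))))

  plus-cost : ∀ a c {x} → suc x ≤ N ^ a → suc (x + c) ≤ N ^ (a + c)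
  plus-cost a c l = seq-cost a c l (≤-trans (n<2^n c) (pow c))

  binary-cost : ∀ a b c {x y} → suc x ≤ N ^ a → suc y ≤ N ^ b → suc (x + (y + c)) ≤ N ^ (a + b + c)
  binary-cost a b c {x} {y} l l′ = subst (λ z → suc z ≤ N ^ (a + b + c)) (+-assoc x y c)
    (plus-cost (a + b) c (seq-cost a b l l′))

  -- Of the five extra exponents one pays for the n rounds and four for the constant 16 = 2⁴.
  loop-cost : ∀ a c e {x} → c ≤ 5 → e ≤ 4 → suc x ≤ N ^ a → suc (e + n * (x + c)) ≤ N ^ (a + 5)
  loop-cost a c e {x} c≤ e≤ l = grow a 5 l (≤-trans (≤-reflexive refl) (≤-refl {N ^ 5})) (begin
    suc (e + n * (x + c))          ≤⟨ s≤s (+-mono-≤ e≤ (*-mono-≤ (m≤n⊔m 2 n) (+-monoʳ-≤ x c≤))) ⟩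
    5 + N * (x + 5)                ≤⟨ +-mono-≤ (≤-trans (≤-reflexive (sym (*-identityˡ 5))) (*-monoˡ-≤ 5 (≤-trans (s≤s z≤n) 2≤N))) ≤-refl ⟩
    N * 5 + N * (x + 5)            ≡⟨ sym (*-distribˡ-+ N 5 (x + 5)) ⟩
    N * (5 + (x + 5))              ≤⟨ *-monoʳ-≤ N bound′ ⟩
    N * (suc x * 16)               ≤⟨ *-monoʳ-≤ N (*-monoʳ-≤ (suc x) (pow 4)) ⟩
    N * (suc x * N ^ 4)            ≡⟨ trans (*-comm N _) (trans (*-assoc (suc x) (N ^ 4) N) (cong (suc x *_) (*-comm (N ^ 4) N))) ⟩
    suc x * N ^ 5                  ∎)
    where
    open ≤-Reasoning
    bound′ : 5 + (x + 5) ≤ suc x * 16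
    bound′ = ≤-trans (≤-reflexive (trans (+-comm 5 _) (+-assoc x 5 5)))
      (≤-trans (+-mono-≤ (m≤m*n x 16) (≤ᵇ⇒≤ 10 16 tt)) (≤-reflexive (+-comm (x * 16) 16)))

  costₑ≤ : ∀ {V} (e : Expr V) → suc (costₑ e) ≤ N ^ weightₑ e
  costₑ≤ (var x)   = ≤-trans (≤ᵇ⇒≤ 3 4 tt) (pow 2)
  costₑ≤ (con m)   = ≤-trans (≤ᵇ⇒≤ 2 4 tt) (pow 2)
  costₑ≤ (a ⊕ b)   = binary-cost (weightₑ a) (weightₑ b) 1 (costₑ≤ a) (costₑ≤ b)
  costₑ≤ (a ⊖ b)   = binary-cost (weightₑ a) (weightₑ b) 1 (costₑ≤ a) (costₑ≤ b)
  costₑ≤ (get a)   = plus-cost (weightₑ a) 2 (costₑ≤ a)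
  costₑ≤ (sum<n a) = subst (λ z → suc z ≤ N ^ (weightₑ a + 5))
    (trans (cong (λ z → 4 + n * z) (trans (+-comm (costₑ a) 5) (cong (2 +_) (+-comm 3 (costₑ a)))))
      (cong (2 +_) (+-comm 2 _)))
    (loop-cost (weightₑ a) 5 4 ≤-refl ≤-refl (costₑ≤ a))

  cost≤ : ∀ {V} (s : Stmt V) → suc (cost s) ≤ N ^ weight s
  cost≤ skip      = ≤-refl
  cost≤ (put a b) = binary-cost (weightₑ a) (weightₑ b) 2 (costₑ≤ a) (costₑ≤ b)
  cost≤ (s ⨾ t)   = seq-cost (weight s) (weight t) (cost≤ s) (cost≤ t)
  cost≤ (for<n s) = subst (λ z → suc z ≤ N ^ (weight s + 5))
    (trans (cong (λ z → 3 + n * z) (trans (+-comm (cost s) 4) (cong (2 +_) (+-comm 2 (cost s)))))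
      (cong (1 +_) (+-comm 2 _)))
    (loop-cost (weight s) 4 3 (≤ᵇ⇒≤ 4 5 tt) (≤ᵇ⇒≤ 3 4 tt) (cost≤ s))

weight-and : ∀ {V} (e f : Expr V) → weightₑ (andₑ e f) ≡ weightₑ e + weightₑ f + 10
weight-and e f = solve 2 (λ x y → con 2 :+ ((con 2 :+ x :+ con 1) :+ (con 2 :+ y :+ con 1) :+ con 1) :+ con 1 := x :+ y :+ con 10) refl (weightₑ e) (weightₑ f)
  where
  open import Data.Nat.Solver using (module +-*-Solver)
  open +-*-Solver

-- The size of a formula bounds the weight of its translation, if the atoms
-- dist and edge have weight at most a.
module Sizes (a : ℕ) where

  sizeₜ : ∀ {A} → Tm A → ℕ
  sizeₜ (dist x y) = a
  sizeₜ (val x)    = 2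
  sizeₜ (lit m)    = 2
  sizeₜ size       = 7
  sizeₜ (s ∔ t)    = sizeₜ s + sizeₜ t + 1

  sizeᶠ : ∀ {A} → Fm A → ℕ
  size⋀ : ∀ m → (Fin m → ℕ) → ℕ

  sizeᶠ (edge x y) = a
  sizeᶠ (s ≼ t)    = sizeₜ s + sizeₜ t + 4
  sizeᶠ (φ ∧ ψ)    = sizeᶠ φ + sizeᶠ ψ + 10
  sizeᶠ (φ ∨ ψ)    = sizeᶠ φ + sizeᶠ ψ + 1
  sizeᶠ (all φ)    = sizeᶠ φ + 11
  sizeᶠ (⋀ m φ)    = size⋀ m (λ i → sizeᶠ (φ i))
  sizeᶠ (⋁ m φ)    = size⋀ m (λ i → sizeᶠ (φ i))

  size⋀ zero    f = 2
  size⋀ (suc m) f = f zero + size⋀ m (f ∘ suc) + 10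

  size⋀-≤ : ∀ m {f c} → (∀ i → f i ≤ c) → size⋀ m f ≤ suc m * (c + 10)
  size⋀-≤ zero    {f} {c} l = ≤-trans (≤-trans (≤ᵇ⇒≤ 2 10 tt) (m≤n+m 10 c)) (m≤m+n _ 0)
  size⋀-≤ (suc m) {f} {c} l = ≤-trans (≤-reflexive (trans (+-assoc (f zero) _ 10) (trans (cong (f zero +_) (+-comm _ 10)) (sym (+-assoc (f zero) 10 _)))))
    (+-mono-≤ (+-monoˡ-≤ 10 (l zero)) (size⋀-≤ m (l ∘ suc)))

  module _ (tD tE : ∀ {V} → Fin V → Fin V → Expr (V + 1))
           (wD : ∀ {V} (i j : Fin V) → weightₑ (tD i j) ≤ a) (wE : ∀ {V} (i j : Fin V) → weightₑ (tE i j) ≤ a) where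
    open Translate tD tE

    weight-trₜ : ∀ {A V} (t : Tm A) (l : A → Fin V) → weightₑ (trₜ t l) ≤ sizeₜ t
    weight-trₜ (dist x y) l = wD (l x) (l y)
    weight-trₜ (val x)    l = ≤-refl
    weight-trₜ (lit m)    l = ≤-refl
    weight-trₜ size       l = ≤-refl
    weight-trₜ (s ∔ t)    l = +-monoˡ-≤ 1 (+-mono-≤ (weight-trₜ s l) (weight-trₜ t l))

    weight-all : ∀ {V} m (f : Fin m → Expr V) (g : Fin m → ℕ) → (∀ i → weightₑ (f i) ≤ g i) → weightₑ (allₑ m f) ≤ size⋀ m g
    weight-all zero    f g l = ≤-refl
    weight-all (suc m) f g l = ≤-trans (≤-reflexive (weight-and (f zero) (allₑ m (f ∘ suc))))
      (+-monoˡ-≤ 10 (+-mono-≤ (l zero) (weight-all m (f ∘ suc) (g ∘ suc) (l ∘ suc))))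

    weight-any : ∀ {V} m (f : Fin m → Expr V) (g : Fin m → ℕ) → (∀ i → weightₑ (f i) ≤ g i) → weightₑ (anyₑ m f) ≤ size⋀ m g
    weight-any zero    f g l = ≤-refl
    weight-any (suc m) f g l = +-mono-≤ (+-mono-≤ (l zero) (weight-any m (f ∘ suc) (g ∘ suc) (l ∘ suc))) (s≤s z≤n)

    weight-tr : ∀ {A V} (φ : Fm A) (l : A → Fin V) → weightₑ (tr φ l) ≤ sizeᶠ φ
    weight-tr (edge x y) l = wE (l x) (l y)
    weight-tr (s ≼ t)    l = ≤-trans (≤-reflexive (trans (cong (_+ 1) (+-comm 2 _)) (trans (+-assoc _ 2 1) (+-assoc (weightₑ (trₜ s l) + weightₑ (trₜ t l)) 1 3))))
      (+-monoˡ-≤ 4 (+-mono-≤ (weight-trₜ s l) (weight-trₜ t l)))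
    weight-tr (φ ∧ ψ)    l = ≤-trans (≤-reflexive (weight-and (tr φ l) (tr ψ l))) (+-monoˡ-≤ 10 (+-mono-≤ (weight-tr φ l) (weight-tr ψ l)))
    weight-tr (φ ∨ ψ)    l = +-monoˡ-≤ 1 (+-mono-≤ (weight-tr φ l) (weight-tr ψ l))
    weight-tr (all φ)    l = ≤-trans (≤-reflexive (solve 1 (λ x → con 2 :+ ((con 2 :+ x :+ con 1) :+ con 5) :+ con 1 := x :+ con 11) refl (weightₑ (tr φ (ext zero (suc ∘ l))))))
      (+-monoˡ-≤ 11 (weight-tr φ _))
      where
      open import Data.Nat.Solver using (module +-*-Solver)
      open +-*-Solver
    weight-tr (⋀ m φ)    l = weight-all m _ _ (λ i → weight-tr (φ i) l)
    weight-tr (⋁ m φ)    l = weight-any m _ _ (λ i → weight-tr (φ i) l)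

-- The algorithm and its correctness

module _ {n} {G : Graph n} where

  castPath : ∀ {a b a′ b′} → a ≡ a′ → b ≡ b′ → Path G a b → Path G a′ b′
  castPath refl refl P = P

  cast-shortest : ∀ {a b a′ b′} (e : a ≡ a′) (f : b ≡ b′) {P} → IsShortest G P → IsShortest G (castPath e f P)
  cast-shortest refl refl q = q

  cast-disjoint : ∀ {a b a′ b′ c d c′ d′} (e : a ≡ a′) (f : b ≡ b′) (e′ : c ≡ c′) (f′ : d ≡ d′) {P Q} →
                  InternallyDisjoint G P Q → InternallyDisjoint G (castPath e f P) (castPath e′ f′ Q)
  cast-disjoint refl refl refl refl q = q

  Solution : ∀ {k} → (Fin k → Fin n) → (Fin k → Fin n) → Set
  Solution {k} s t = Σ[ P ∈ (∀ i → Path G (s i) (t i)) ] (∀ i → IsShortest G (P i)) ×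
                     (∀ i j → i ≢ j → InternallyDisjoint G (P i) (P j))

  cast-solution : ∀ {k} {s t s′ t′ : Fin k → Fin n} → (∀ i → s i ≡ s′ i) → (∀ i → t i ≡ t′ i) →
                  Solution s t → Solution s′ t′
  cast-solution e f (P , q , r) = (λ i → castPath (e i) (f i) (P i)) , (λ i → cast-shortest (e i) (f i) (q i)) ,
    λ i j ne → cast-disjoint (e i) (f i) (e j) (f j) (r i j ne)

module Algorithm (k : ℕ) where

  R : ℕ
  R = bound k

  open Formulas k R hiding (V)

  module B = DistPhase k

  segments size′ : ℕ
  segments = k * suc R
  size′    = 6 * segments

  code : Field → Fin 6
  code fx = zero
  code fy = suc zero
  code fu = suc (suc zero)
  code fv = suc (suc (suc zero))
  code fr = suc (suc (suc (suc zero)))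
  code fp = suc (suc (suc (suc (suc zero))))

  decode : Fin 6 → Field
  decode zero                               = fx
  decode (suc zero)                         = fy
  decode (suc (suc zero))                   = fu
  decode (suc (suc (suc zero)))             = fv
  decode (suc (suc (suc (suc zero))))       = fr
  decode (suc (suc (suc (suc (suc zero))))) = fp

  decode-code : ∀ f → decode (code f) ≡ f
  decode-code fx = refl
  decode-code fy = refl
  decode-code fu = refl
  decode-code fv = refl
  decode-code fr = refl
  decode-code fp = refl

  loc : Name → Fin size′
  loc ⟨ f , i , m ⟩ⁿ = combine (code f) (combine i m)

  name : Fin size′ → Name
  name z = let f , w = remQuot {6} segments z ; i , m = remQuot {k} (suc R) w in ⟨ decode f , i , m ⟩ⁿ

  name-loc : ∀ a → name (loc a) ≡ a
  name-loc ⟨ f , i , m ⟩ⁿ = trans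
    (cong (λ (f , w) → let i , m = remQuot {k} (suc R) w in ⟨ decode f , i , m ⟩ⁿ) (Fin.remQuot-combine {6} (code f) (combine i m)))
    (cong₂ (λ f (i , m) → ⟨ f , i , m ⟩ⁿ) (decode-code f) (Fin.remQuot-combine {k} i m))

  -- The table of the game starts after the n² cells of the matrix and the n³ cells of the distance
  -- phase.
  base : ∀ V → Expr (V + 1)
  base V = B.base V ⊕ sum<n (sum<n (sum<n (con 1)))

  module P = Reach B.tD B.tE size′ loc initᶠ stepᶠ base

  -- Saturation for `K * n` rounds is guaranteed to find plays of fewer than `K * n` moves, and a
  -- win may take `segments * n`; hence one loop more than there are segments.
  prog : Stmt (k * 2 + 1)
  prog = B.phase ⨾ P.rounds (suc segments) id

  answer : Expr (k * 2 + 1)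
  answer = P.some acceptᶠ id

  -- Sealed, to keep these large numerals from being computed.
  abstract
    W : ℕ
    W = 20 + (weight prog + weightₑ answer)

    W-def : W ≡ 20 + (weight prog + weightₑ answer)
    W-def = refl

  room : 20 + (height prog ⊔ heightₑ answer) ≤ W
  room = ≤-trans (+-monoʳ-≤ 20 (⊔-lub (≤-trans (height≤ prog) (m≤m+n (weight prog) (weightₑ answer)))
    (≤-trans (heightₑ≤ answer) (m≤n+m (weightₑ answer) (weight prog))))) (≤-reflexive (sym W-def))

  1≤W : 1 ≤ W
  1≤W = ≤-trans (s≤s z≤n) (≤-trans (m≤m+n 20 _) room)

  module M = Machine k prog answer W 1≤W room

  module Correctness (1≤k : 1 ≤ k) {n} (1≤n : 1 ≤ n) (G : Graph n) (pairs : Vec (Fin n × Fin n) k)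
    (X₀ : ℕ) (h : Heap)
    (edges : ∀ {u v} → u ≢ v → h (X₀ + (toℕ u * n + toℕ v)) ≡ Input.adjacent G pairs u v)
    (blank : ∀ {x} → X₀ + n * n ≤ x → h x ≡ 0) where

    open Graph G
    open Semantics n
    open Environment n X₀

    private
      ν = flat pairs
      τ = lookup ν

    D : Fin n → Fin n → ℕ
    D = B.Dist G X₀ h edges blank ν

    isDist : IsDist G D
    isDist = B.isDist G X₀ h edges blank ν

    heap₁ : Heap
    heap₁ = B.heap G X₀ h edges blank ν

    private
      b = X₀ + n * n + n ^ 3

      base-ok : ∀ {V} (ν : Vec (Fin n) V) h → ⟦ base V ⟧ (env ν) h ≡ b
      base-ok ν h = cong₂ _+_
        (cong₂ _+_ (env-X ν) (trans (∑-const n _) (cong (n *_) one)))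
        (trans (∑-const n _) (cong (n *_) (trans (∑-const n _) (cong (n *_) (∑-const n 1)))))
        where
        one : ∑ n (λ _ → 1) ≡ n
        one = trans (∑-const n 1) (*-identityʳ n)

    open P.Correct n X₀ D _~_ b heap₁

    private
      tE-ok : ∀ {V} (ν : Vec (Fin n) V) i j {h} → Agree h → ⟦ B.tE i j ⟧ (env ν) h ≢ 0 ⇔ (lookup ν i ~ lookup ν j)
      tE-ok ν′ i j ag = B.tE-ok G X₀ h edges blank ν′ i j
        (λ l → trans (ag (<-≤-trans l (m≤m+n _ _))) (B.heap-agree G X₀ h edges blank ν l))

      tD-ok : ∀ {V} (ν : Vec (Fin n) V) i j {h} → Agree h → ⟦ B.tD i j ⟧ (env ν) h ≡ D (lookup ν i) (lookup ν j)
      tD-ok ν′ i j ag = B.tD-ok G X₀ h edges blank ν ν′ i j ag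

      fresh : ∀ {x} → b ≤ x → heap₁ x ≡ 0
      fresh = B.heap-blank G X₀ h edges blank ν

      RI = ReachIn base-ok tD-ok tE-ok fresh τ

      done = rounds-ok base-ok tD-ok tE-ok fresh τ id ν (λ _ → refl) (suc segments)
      open Sound (proj₁ done)

    open Game G isDist k R τ using (s; t; State; val₂; Trails; advance; module Extract) renaming (start to opening)
    open Meaning n D _~_
    open Playing G isDist k R τ using (Play; begin; turn)

    private
      state : Vec (Fin n) size′ → State
      state c a = lookup c (loc a)

      vec : State → Vec (Fin n) size′
      vec c = Vec.tabulate (c ∘ name)

      lookup-vec : ∀ c a → lookup (vec c) (loc a) ≡ c a
      lookup-vec c a = trans (Vec.lookup∘tabulate (c ∘ name) (loc a)) (cong c (name-loc a))

      to-val : ∀ c′ c a → view base-ok tD-ok tE-ok fresh τ c′ c a ≡ val₂ (state c′) (state c) a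
      to-val c′ c (old a)  = refl
      to-val c′ c (new a)  = refl
      to-val c′ c (glob t) = refl

      from-val : ∀ c′ c a → val₂ c′ c a ≡ view base-ok tD-ok tE-ok fresh τ (vec c′) (vec c) a
      from-val c′ c (old a)  = sym (lookup-vec c′ a)
      from-val c′ c (new a)  = sym (lookup-vec c a)
      from-val c′ c (glob t) = refl

      trails : ∀ {r c} → RI r c → Trails (state c)
      trails {c = c} (start i) = opening (congᶠ initᶠ (to-val c c) i)
      trails {c = c} (more {c′ = c′} re st) = advance (trails re) (congᶠ stepᶠ (to-val c′ c) st)

      plays : ∀ {r c} → Play r c → RI r (vec c)
      plays {c = c} (begin i) = start (congᶠ initᶠ (from-val c c) i)
      plays {c = c} (turn {c′ = c′} pl st) = more (plays pl) (congᶠ stepᶠ (from-val c′ c) st)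

      result : ℕ
      result = ⟦ answer ⟧ (env ν) (exec prog (env ν) h)

      accepted : result ≢ 0 ⇔ (∃[ c ] Marked base-ok tD-ok tE-ok fresh τ (exec prog (env ν) h) c × ⟦ acceptᶠ ⟧ᶠ (view base-ok tD-ok tE-ok fresh τ c c))
      accepted = some-ok base-ok tD-ok tE-ok fresh τ acceptᶠ id ν (λ _ → refl) agree

      sound : result ≢ 0 → Solution {G = G} s t
      sound q = solve (Equivalence.to accepted q)
        where
        solve : (∃[ c ] Marked base-ok tD-ok tE-ok fresh τ (exec prog (env ν) h) c × ⟦ acceptᶠ ⟧ᶠ (view base-ok tD-ok tE-ok fresh τ c c)) →
                Solution {G = G} s t
        solve (c , mk , ac) = E.path , E.path-shortest , E.path-disjoint
          where
          module E = Extract (trails (proj₂ (reached c mk))) (congᶠ acceptᶠ (to-val c c) ac)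

      complete : Solution {G = G} s t → result ≢ 0
      complete (P , min , dis) = Equivalence.from accepted
        (vec c , proj₂ done (<-≤-trans (n<n+ (segments * n)) (≤-reflexive refl)) (plays pl) , congᶠ acceptᶠ (from-val c c) ac)
        where
        n<n+ : ∀ x → x < n + x
        n<n+ x = m<n+m x 1≤n
        open IsDist isDist
        len : ∀ i → walkLength G (Path.walk (P i)) ≤ D (s i) (t i)
        len i = shortest-length G isDist (P i) (min i)
        open Playing G isDist k R τ using (module Run; module Curves; orient)
        open Curves P len dis
        module Co = Conditions n k D D≤n D-refl D-sym triangle γ L geo
        module Ge = Geodesics n k D D≤n D-refl D-sym triangle γ L geo
        module Cu = Cutting.Pieces n k D D≤n D-refl D-sym triangle γ L geo Co.bases (λ _ _ → ≤-refl) Co.bases-suffice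
        module Sp i = Splitting (Cu.ρ i ∘ γ i) (L i) (λ l l′ → Cu.ρ-mono (Ge.forward i l l′))
        cut′ : ∀ i → Sp.Split i R 0
        cut′ i = Sp.split i R 0 0 z≤n (inj₂ z≤n) (Cu.ρ≤R 1≤k i (γ i (L i)))
        module S i = Sp.Split i (cut′ i)
        open S
        piece : ∀ i m → Cu.Piece i (γ i (lo i m)) (γ i (hi i m))
        piece i m = record { a≤b = lo≤hi i m ; b≤L = hi≤L i m ; x≡ = refl ; y≡ = refl ; same = level i m }
        -- The line picked for a segment has a path index as root; the vertex r is the source of
        -- that path.
        ref : Fin k → Fin (suc R) → Fin n
        ref i m = γ (Cu.reference i (γ i (lo i m)) (γ i (hi i m))) 0
        won = Run.win (record
          { γ = γ ; L = L ; geo = geo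
          ; γ-0 = λ i → place-0 G (Path.walk (P i)) ; γ-L = λ i → place-end G (Path.walk (P i))
          ; L<n = λ i → path-short G isDist (P i) ; meets = γ-ends
          ; lo = lo ; hi = hi ; lo-0 = λ i → S.start i ; hi-R = λ i → finish i
          ; lo≤hi = lo≤hi ; hi≤L = hi≤L ; link = link ; ref = ref
          ; piece = λ i m → orient (γ i) (lo≤hi i m) (hi≤L i m) (geo i) (Cu.reference-straight (piece i m))
          ; agree = λ {i} {m} {i′} {m′} ne a b → cong (λ j → γ j 0) (Cu.reference-agree ne (piece i m) (piece i′ m′) a b) })
        c = proj₁ won
        ac = proj₁ (proj₂ won)
        pl = proj₂ (proj₂ won)

    correct : result ≢ 0 ⇔ HasDisjointShortestPaths G pairs
    correct = mk⇔ (cast-solution (proj₁ ∘ flat-lookup pairs) (proj₂ ∘ flat-lookup pairs) ∘ sound)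
      (complete ∘ cast-solution (λ i → sym (proj₁ (flat-lookup pairs i))) (λ i → sym (proj₂ (flat-lookup pairs i))))

-- The exponent of the running time

weight-idx : ∀ {m V} (f : Fin m → Fin V) → weightₑ (idx f) ≡ m * 8 + 2
weight-idx {zero}      f = refl
weight-idx {suc m} {V} f = trans (cong (λ z → z + 5 + 2 + 1) (weight-idx {m} {suc V} (suc ∘ f ∘ suc)))
  (solve 1 (λ x → x :+ con 2 :+ con 5 :+ con 2 :+ con 1 := con 8 :+ x :+ con 2) refl (m * 8))
  where
  open import Data.Nat.Solver using (module +-*-Solver)
  open +-*-Solver

weight-sums : ∀ m {V} (e : Expr ((m + V) + 1)) → weightₑ (sums m e) ≡ weightₑ e + m * 5
weight-sums zero    e = sym (+-identityʳ _)
weight-sums (suc m) e = trans (weight-sums m (sum<n e)) (+-assoc (weightₑ e) 5 (m * 5))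

weight-fors : ∀ m {V} (s : Stmt ((m + V) + 1)) → weight (fors m s) ≡ weight s + m * 5
weight-fors zero    s = sym (+-identityʳ _)
weight-fors (suc m) s = trans (weight-fors m (for<n s)) (+-assoc (weight s) 5 (m * 5))

module ReachWeight (tD tE : ∀ {V} → Fin V → Fin V → Expr (V + 1))
  (m : ℕ) {N T : Set} (loc : N → Fin m) (init step : Fm (Var N T)) (base : ∀ V → Expr (V + 1))
  (w wi ws : ℕ) (base≤ : ∀ V → weightₑ (base V) ≤ w)
  (init≤ : ∀ {V} (l : Var N T → Fin V) → weightₑ (Translate.tr tD tE init l) ≤ wi)
  (step≤ : ∀ {V} (l : Var N T → Fin V) → weightₑ (Translate.tr tD tE step l) ≤ ws) where
  open Reach tD tE m loc init step base
  open Translate tD tE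

  cellW : ℕ
  cellW = w + (m * 8 + 2) + 1

  cell≤ : ∀ {V} (f : Fin m → Fin V) → weightₑ (cell f) ≤ cellW
  cell≤ {V} f = +-monoˡ-≤ 1 (+-mono-≤ (base≤ V) (≤-reflexive (weight-idx f)))

  test≤ : ∀ {V x} (e : Expr V) (f : Expr V) {y} → weightₑ e ≤ x → weightₑ f ≤ y → weightₑ (andₑ e f) ≤ x + y + 10
  test≤ e f l l′ = ≤-trans (≤-reflexive (weight-and e f)) (+-monoˡ-≤ 10 (+-mono-≤ l l′))

  updateW : ℕ
  updateW = cellW + (cellW + 2 + (wi + (cellW + 2 + ws + 10 + m * 5) + 1) + 1) + 2

  update≤ : ∀ {V} (l : T → Fin V) → weight (update l) ≤ updateW
  update≤ {V} l = +-monoˡ-≤ 2 (+-mono-≤ (cell≤ (_↑ˡ V)) (+-monoˡ-≤ 1 (+-mono-≤ (+-monoˡ-≤ 2 (cell≤ (_↑ˡ V)))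
    (+-monoˡ-≤ 1 (+-mono-≤ (init≤ (alone l)) (≤-trans (≤-reflexive (weight-sums m (andₑ (get (cell (_↑ˡ (m + V)))) (tr step (both l)))))
      (+-monoˡ-≤ (m * 5) (test≤ (get (cell (_↑ˡ (m + V)))) (tr step (both l)) (+-monoˡ-≤ 2 (cell≤ (_↑ˡ (m + V)))) (step≤ (both l))))))))))

  rounds≤ : ∀ {V} K (l : T → Fin V) → weight (rounds K l) ≤ K * (updateW + m * 5 + 5)
  rounds≤ zero    l = z≤n
  rounds≤ (suc K) l = ≤-trans (+-mono-≤ (rounds≤ K l) (+-monoˡ-≤ 5
    (≤-trans (≤-reflexive (weight-fors m (update (suc ∘ l)))) (+-monoˡ-≤ (m * 5) (update≤ (suc ∘ l))))))
    (≤-reflexive (+-comm (K * (updateW + m * 5 + 5)) _))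

  some≤ : ∀ {V} (φ : Fm (Var N T)) (l : T → Fin V) {y} → (∀ {V} (l : Var N T → Fin V) → weightₑ (tr φ l) ≤ y) →
          weightₑ (some φ l) ≤ cellW + 2 + y + 10 + m * 5
  some≤ {V} φ l f = ≤-trans (≤-reflexive (weight-sums m (andₑ (get (cell (_↑ˡ V))) (tr φ (alone l))))) (+-monoˡ-≤ (m * 5) (test≤ (get (cell (_↑ˡ V))) (tr φ (alone l)) (+-monoˡ-≤ 2 (cell≤ (_↑ˡ V))) (f (alone l))))

module Linear (P : ℕ) (1≤P : 1 ≤ P) where

  infix 4 _≲_
  infixl 6 _⊹_

  record _≲_ (x c : ℕ) : Set where
    constructor below
    field
      times : x ≤ c * P

  open _≲_ public

  lit≲ : ∀ {x} c → x ≤ c → x ≲ c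
  lit≲ c l = below (≤-trans l (≤-trans (≤-reflexive (sym (*-identityʳ c))) (*-monoʳ-≤ c 1≤P)))

  _⊹_ : ∀ {x y c c′} → x ≲ c → y ≲ c′ → x + y ≲ c + c′
  _⊹_ {c = c} {c′} (below l) (below l′) = below (≤-trans (+-mono-≤ l l′) (≤-reflexive (sym (*-distribʳ-+ P c c′))))

  raise : ∀ {x c c′} → c ≤ c′ → x ≲ c → x ≲ c′
  raise l (below l′) = below (≤-trans l′ (*-monoˡ-≤ P l))

  below-≤ : ∀ {x y c} → x ≤ y → y ≲ c → x ≲ c
  below-≤ l (below l′) = below (≤-trans l l′)

module FormulaSizes (k R Z : ℕ) (k<Z : suc k ≤ Z) (R<Z : suc (suc R) ≤ Z) where
  open Formulas k R
  open Sizes 52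

  1≤Z : 1 ≤ Z
  1≤Z = ≤-trans (s≤s z≤n) k<Z

  -- The deepest families range over pairs of segments, that is over two paths and two positions,
  -- and each index costs a factor `Z`. The bound 2000 for what stands inside is generous.
  Z² Z⁴ : ℕ
  Z² = Z * Z
  Z⁴ = Z² * Z²

  1≤Z² : 1 ≤ Z²
  1≤Z² = *-mono-≤ 1≤Z 1≤Z

  open Linear Z⁴ (*-mono-≤ 1≤Z² 1≤Z²)

  up² : ∀ {x c} → x ≤ c * Z² → x ≲ c
  up² {x} {c} l = below (≤-trans l (*-monoʳ-≤ c (≤-trans (≤-reflexive (sym (*-identityʳ Z²))) (*-monoʳ-≤ Z² 1≤Z²))))

  family : ∀ {m} {f : Fin m → ℕ} c → suc m ≤ Z → (∀ i → f i ≤ c) → size⋀ m f ≤ Z * (c + 10)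
  family {m} c m<Z l = ≤-trans (size⋀-≤ m l) (*-monoˡ-≤ (c + 10) m<Z)

  family² : ∀ {m} (f : Fin k → Fin m → ℕ) c → suc m ≤ Z → (∀ i j → f i j ≤ c) →
            size⋀ k (λ i → size⋀ m (f i)) ≤ (c + 20) * Z²
  family² f c m<Z l = ≤-trans (family (Z * (c + 10)) k<Z (λ i → family c m<Z (l i)))
    (≤-trans (*-monoʳ-≤ Z (≤-trans (+-monoʳ-≤ (Z * (c + 10)) (*-monoˡ-≤ 10 1≤Z)) (≤-reflexive (sym (*-distribˡ-+ Z (c + 10) 10)))))
      (≤-reflexive (trans (sym (*-assoc Z Z _)) (trans (cong (Z² *_) (+-assoc c 10 10)) (*-comm Z² (c + 20))))))

  R≤ : suc R ≤ Z
  R≤ = ≤-trans (n≤1+n _) R<Z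

  family⁴ : ∀ (f : Fin k → Fin (suc R) → Fin k → Fin (suc R) → ℕ) c → (∀ i m i′ m′ → f i m i′ m′ ≤ c) →
            size⋀ k (λ i → size⋀ (suc R) λ m → size⋀ k λ i′ → size⋀ (suc R) (f i m i′)) ≲ c + 40
  family⁴ f c l = below (≤-trans (family² (λ i m → size⋀ k λ i′ → size⋀ (suc R) (f i m i′)) ((c + 20) * Z²) R<Z (λ i m → family² (f i m) c R<Z (l i m)))
    (≤-trans (*-monoˡ-≤ Z² (≤-trans (+-monoʳ-≤ ((c + 20) * Z²) (≤-trans (≤-reflexive (sym (*-identityʳ 20))) (*-monoʳ-≤ 20 1≤Z²)))
      (≤-reflexive (trans (sym (*-distribʳ-+ Z² (c + 20) 20)) (cong (_* Z²) (+-assoc c 20 20))))))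
      (≤-reflexive (*-assoc (c + 40) Z² Z²))))

  private
    ten : 10 ≲ 10
    ten = lit≲ 10 ≤-refl

  ok≤ : sizeᶠ ok ≲ 8120
  ok≤ = let total = paths ⊹ (links ⊹ (segs ⊹ pairs ⊹ ten) ⊹ ten) ⊹ ten in total
    where
    paths : sizeᶠ (⋀ k okPath) ≲ 2010
    paths = up² (≤-trans (family 2000 k<Z (λ i → ≤ᵇ⇒≤ _ 2000 tt))
      (≤-trans (≤-reflexive (*-comm Z 2010)) (*-monoʳ-≤ 2010 (≤-trans (≤-reflexive (sym (*-identityʳ Z))) (*-monoʳ-≤ Z 1≤Z)))))
    links : sizeᶠ (⋀ k λ i → ⋀ R λ m → okLink i m) ≲ 2020
    links = up² {c = 2020} (family² (λ i m → sizeᶠ (okLink i m)) 2000 R≤ (λ i m → ≤ᵇ⇒≤ _ 2000 tt))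
    segs : sizeᶠ (⋀⋀ okSeg) ≲ 2020
    segs = up² {c = 2020} (family² (λ i m → sizeᶠ (okSeg i m)) 2000 R<Z (λ i m → ≤ᵇ⇒≤ _ 2000 tt))
    pairs : sizeᶠ (⋀⋀ λ i m → ⋀⋀ λ i′ m′ → okPair i m i′ m′) ≲ 2040
    pairs = family⁴ (λ i m i′ m′ → sizeᶠ (okPair i m i′ m′)) 2000 (λ i m i′ m′ → ≤ᵇ⇒≤ _ 2000 tt)

  init≤ : sizeᶠ initᶠ ≲ 20000
  init≤ = raise {c = 10150} (≤ᵇ⇒≤ 10150 20000 tt) (let total = ok≤ ⊹ at-start ⊹ ten in total)
    where
    at-start : sizeᶠ (⋀⋀ λ i m → eq (fp at i , m) (fu at i , m)) ≲ 2020
    at-start = up² {c = 2020} (family² (λ i m → sizeᶠ (eq (fp at i , m) (fu at i , m))) 2000 R<Z (λ i m → ≤ᵇ⇒≤ _ 2000 tt))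

  accept≤ : sizeᶠ acceptᶠ ≲ 20000
  accept≤ = raise {c = 2020} (≤ᵇ⇒≤ 2020 20000 tt)
    (up² {c = 2020} (family² (λ i m → sizeᶠ (eq (fp at i , m) (fv at i , m))) 2000 R<Z (λ i m → ≤ᵇ⇒≤ _ 2000 tt)))

  move≤ : ∀ i m → sizeᶠ (move i m) ≤ 8070 * Z²
  move≤ i m = times′ {c = 8070} (let total = stays ⊕′ (near ⊕′ (farther ⊕′ waits ⊕′ ten′) ⊕′ ten′) ⊕′ ten′ in total)
    where
    open Linear Z² 1≤Z² using () renaming (below to below′; times to times′; _≲_ to infix 4 _≲′_; _⊹_ to infixl 6 _⊕′_; lit≲ to lit′)
    ten′ : 10 ≲′ 10
    ten′ = lit′ 10 ≤-refl
    near : sizeᶠ (dist (was fp i m) (fp at i , m) ≼ lit 1) ≲′ 2000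
    near = lit′ 2000 (≤ᵇ⇒≤ _ 2000 tt)
    farther : sizeᶠ (dist (fr at i , m) (was fp i m) ∔ lit 1 ≼ dist (fr at i , m) (fp at i , m)) ≲′ 2000
    farther = lit′ 2000 (≤ᵇ⇒≤ _ 2000 tt)
    stays : sizeᶠ (⋀⋀ λ i′ m′ → (same i i′ ∧ same m m′) ∨ eq (was fp i′ m′) (fp at i′ , m′)) ≲′ 2020
    stays = below′ (family² (λ i′ m′ → sizeᶠ ((same i i′ ∧ same m m′) ∨ eq (was fp i′ m′) (fp at i′ , m′))) 2000 R<Z (λ _ _ → ≤ᵇ⇒≤ _ 2000 tt))
    waits : sizeᶠ (⋀⋀ λ i′ m′ → wait i m i′ m′) ≲′ 2020
    waits = below′ (family² (λ i′ m′ → sizeᶠ (wait i m i′ m′)) 2000 R<Z (λ _ _ → ≤ᵇ⇒≤ _ 2000 tt))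

  step≤ : sizeᶠ stepᶠ ≲ 20000
  step≤ = raise {c = 18250} (≤ᵇ⇒≤ 18250 20000 tt) (let total = ok≤ ⊹ (statics ⊹ moves ⊹ ten) ⊹ ten in total)
    where
    statics : sizeᶠ (⋀⋀ static) ≲ 2020
    statics = up² {c = 2020} (family² (λ i m → sizeᶠ (static i m)) 2000 R<Z (λ i m → ≤ᵇ⇒≤ _ 2000 tt))
    moves : sizeᶠ (⋁ k λ i → ⋁ (suc R) λ m → move i m) ≲ 8090
    moves = below (≤-trans (family² (λ i m → sizeᶠ (move i m)) (8070 * Z²) R<Z move≤)
      (≤-trans (*-monoˡ-≤ Z² (≤-trans (+-monoʳ-≤ (8070 * Z²) (≤-trans (≤-reflexive (sym (*-identityʳ 20))) (*-monoʳ-≤ 20 1≤Z²)))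
        (≤-reflexive (sym (*-distribʳ-+ Z² 8070 20)))))
        (≤-reflexive (*-assoc 8090 Z² Z²))))

module TimeBound (k : ℕ) where
  open Algorithm k
  open Formulas k R using (initᶠ; stepᶠ; acceptᶠ)

  private
    Z : ℕ
    Z = suc (suc (k + R))

    k<Z : suc k ≤ Z
    k<Z = s≤s (≤-trans (m≤m+n k R) (n≤1+n _))

    R<Z : suc (suc R) ≤ Z
    R<Z = s≤s (s≤s (m≤n+m R k))

    open FormulaSizes k R Z k<Z R<Z
    open Linear Z⁴ (*-mono-≤ 1≤Z² 1≤Z²)

    wD : ∀ {V} (i j : Fin V) → weightₑ (B.tD i j) ≤ 52
    wD i j = ≤ᵇ⇒≤ _ 52 tt

    wE : ∀ {V} (i j : Fin V) → weightₑ (B.tE i j) ≤ 52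
    wE i j = ≤ᵇ⇒≤ _ 52 tt

    module RW = ReachWeight B.tD B.tE size′ loc initᶠ stepᶠ base 33 (Sizes.sizeᶠ 52 initᶠ) (Sizes.sizeᶠ 52 stepᶠ)
      (λ V → ≤ᵇ⇒≤ _ 33 tt) (Sizes.weight-tr 52 B.tD B.tE wD wE initᶠ) (Sizes.weight-tr 52 B.tD B.tE wD wE stepᶠ)

    scale : ∀ {x c} j → x ≲ c → x * j ≲ c * j
    scale {x} {c} j (below l) = below (≤-trans (*-monoˡ-≤ j l)
      (≤-reflexive (trans (*-assoc c Z⁴ j) (trans (cong (c *_) (*-comm Z⁴ j)) (sym (*-assoc c j Z⁴))))))

    segments≤ : suc segments ≤ Z²
    segments≤ = ≤-trans (+-monoˡ-≤ (k * suc R) (s≤s (z≤n {R}))) (*-mono-≤ k<Z R≤)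

    size′≤ : size′ ≲ 6
    size′≤ = up² {c = 6} (*-monoʳ-≤ 6 (≤-trans (n≤1+n segments) segments≤))

    num : ∀ c → c ≲ c
    num c = lit≲ c ≤-refl

    cell≤ : RW.cellW ≲ 84
    cell≤ = let total = num 33 ⊹ (scale 8 size′≤ ⊹ num 2) ⊹ num 1 in total

    update≤ : RW.updateW ≲ 40300
    update≤ = let total = cell≤ ⊹ (cell≤ ⊹ num 2 ⊹ (init≤ ⊹ (cell≤ ⊹ num 2 ⊹ step≤ ⊹ num 10 ⊹ scale 5 size′≤) ⊹ num 1) ⊹ num 1) ⊹ num 2 in total

    round≤ : RW.updateW + size′ * 5 + 5 ≲ 40335
    round≤ = let total = update≤ ⊹ scale 5 size′≤ ⊹ num 5 in total

    some≤ : RW.cellW + 2 + Sizes.sizeᶠ 52 acceptᶠ + 10 + size′ * 5 ≲ 20126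
    some≤ = let total = cell≤ ⊹ num 2 ⊹ accept≤ ⊹ num 10 ⊹ scale 5 size′≤ in total

  -- The game consists of at most `Z²` loops, and the body of each weighs `Z⁴` up to a constant.
  Q : ℕ
  Q = Z² * Z⁴

  private
    1≤Q : 1 ≤ Q
    1≤Q = *-mono-≤ 1≤Z² (*-mono-≤ 1≤Z² 1≤Z²)

    module L = Linear Q 1≤Q

    play≤ : weight (P.rounds (suc segments) id) L.≲ 40335
    play≤ = L.below (≤-trans (RW.rounds≤ (suc segments) id) (≤-trans (*-mono-≤ segments≤ (times {c = 40335} round≤)) (≤-reflexive (swap Z² 40335 Z⁴))))
      where
      swap : ∀ x y z → x * (y * z) ≡ y * (x * z)
      swap x y z = trans (sym (*-assoc x y z)) (trans (cong (_* z) (*-comm x y)) (*-assoc y x z))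

    answer≤ : weightₑ answer L.≲ 20126
    answer≤ = L.below (≤-trans (RW.some≤ acceptᶠ id (Sizes.weight-tr 52 B.tD B.tE wD wE acceptᶠ)) (≤-trans (times {c = 20126} some≤)
      (*-monoʳ-≤ 20126 (≤-trans (≤-reflexive (sym (*-identityˡ Z⁴))) (*-monoˡ-≤ Z⁴ 1≤Z²)))))

    phase≤ : weight B.phase L.≲ 1000
    phase≤ = L.lit≲ 1000 (≤ᵇ⇒≤ _ 1000 tt)

  W≤ : W ≤ 61481 * Q
  W≤ = ≤-trans (≤-reflexive W-def) (L.times {c = 61481} total)
    where
    total : 20 + (weight B.phase + weight (P.rounds (suc segments) id) + weightₑ answer) L.≲ 61481
    total = let t = L.lit≲ 20 ≤-refl L.⊹ (phase≤ L.⊹ play≤ L.⊹ answer≤) in t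

  open Boot k W 1≤W using (saveTime; offset; copy; restore)

  saveTime≤ : ∀ j → j ≤ W → saveTime j ≤ j * (W + W + 2)
  saveTime≤ zero    l = z≤n
  saveTime≤ (suc j) l = ≤-trans (+-mono-≤ (saveTime≤ j (<⇒≤ l))
    (≤-trans (≤-reflexive (trans (+-comm _ 1) (+-comm 2 (W + suc j)))) (+-monoˡ-≤ 2 (+-monoʳ-≤ W l))))
    (≤-reflexive (+-comm (j * (W + W + 2)) _))

  restore≤ : ∀ {V} (X : Fin V) j → weight (restore X j) ≤ j * 19
  restore≤ X zero    = z≤n
  restore≤ X (suc j) = ≤-trans (+-monoˡ-≤ 19 (restore≤ X j)) (≤-reflexive (+-comm (j * 19) 19))

  -- The time of the rescue does not depend on n; as m < 2 ^ m it may serve as its own exponent. It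
  -- is the one summand quadratic in `W`, for W cells with a number of additions linear in `W` each.
  exponent : ℕ
  exponent = saveTime W + ((weightₑ offset + ((weight M.main + (weightₑ answer + 2)) + 2)) + 2)

  exponent≤ : exponent ≤ 94 * (W * W)
  exponent≤ = times′ {c = 94} total
    where
    open Linear (W * W) (*-mono-≤ 1≤W 1≤W) using () renaming (_≲_ to infix 4 _≲′_; below to below′; times to times′; _⊹_ to infixl 6 _⊹′_; lit≲ to lit′; below-≤ to below-≤′)
    one : W ≲′ 1
    one = below′ (≤-trans (≤-trans (≤-reflexive (sym (*-identityʳ W))) (*-monoʳ-≤ W 1≤W)) (≤-reflexive (sym (+-identityʳ _))))
    both≤ : weight prog + weightₑ answer ≤ W
    both≤ = ≤-trans (m≤n+m _ 20) (≤-reflexive (sym W-def))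
    save : saveTime W ≲′ 4
    save = below′ (≤-trans (saveTime≤ W ≤-refl) (≤-trans (*-monoʳ-≤ W
      (≤-trans (+-monoʳ-≤ (W + W) (+-mono-≤ 1≤W 1≤W)) (≤-reflexive (solve 1 (λ w → (w :+ w) :+ (w :+ w) := w :* con 4) refl W))))
      (≤-reflexive (solve 1 (λ w → w :* (w :* con 4) := con 4 :* (w :* w)) refl W))))
      where
      open import Data.Nat.Solver using (module +-*-Solver)
      open +-*-Solver
    off : weightₑ offset ≲′ 23
    off = lit′ 23 ≤-refl
    cp : weight (copy M.X) ≲′ 40
    cp = lit′ 40 (≤ᵇ⇒≤ _ 40 tt)
    rs : weight (restore M.X W) ≲′ 19
    rs = below′ (≤-trans (restore≤ M.X W) (≤-trans (≤-reflexive (*-comm W 19))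
      (*-monoʳ-≤ 19 (≤-trans (≤-reflexive (sym (*-identityʳ W))) (*-monoʳ-≤ W 1≤W)))))
    pr : weight prog ≲′ 1
    pr = below-≤′ (≤-trans (m≤m+n (weight prog) (weightₑ answer)) both≤) one
    an : weightₑ answer ≲′ 1
    an = below-≤′ (≤-trans (m≤n+m (weightₑ answer) (weight prog)) both≤) one
    two : 2 ≲′ 2
    two = lit′ 2 ≤-refl
    total : saveTime W + ((weightₑ offset + (((weight (copy M.X) + weight (restore M.X W) + weight prog) + (weightₑ answer + 2)) + 2)) + 2) ≲′ 94
    total = let t = save ⊹′ ((off ⊹′ (((cp ⊹′ rs ⊹′ pr) ⊹′ (an ⊹′ two)) ⊹′ two)) ⊹′ two) in t

  time≤ : ∀ n → M.time n ≤ (2 ⊔ n) ^ exponent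
  time≤ n = ≤-trans (n≤1+n (M.time n))
    (total (saveTime W) (weightₑ offset) (weight M.main) (weightₑ answer)
      {saveTime W} {Semantics.costₑ n offset} {Semantics.cost n M.main} {Semantics.costₑ n answer}
      (≤-trans (n<2^n (saveTime W)) (pow (saveTime W))) (costₑ≤ offset) (cost≤ M.main) (costₑ≤ answer))
    where
    open Costs n
    two : ∀ a {x} → suc x ≤ N ^ a → suc (2 + x) ≤ N ^ (a + 2)
    two a {x} l = subst (λ z → suc z ≤ N ^ (a + 2)) (+-comm x 2) (plus-cost a 2 l)
    total : ∀ a b c e {w x y z} → suc w ≤ N ^ a → suc x ≤ N ^ b → suc y ≤ N ^ c → suc z ≤ N ^ e →
            suc (w + (2 + (x + (2 + (y + (z + 2)))))) ≤ N ^ (a + ((b + ((c + (e + 2)) + 2)) + 2))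
    total a b c e lw lx ly lz = seq-cost a ((b + ((c + (e + 2)) + 2)) + 2) lw
      (two (b + ((c + (e + 2)) + 2)) (seq-cost b ((c + (e + 2)) + 2) lx
        (two (c + (e + 2)) (seq-cost c (e + 2) ly (plus-cost e 2 lz)))))

-- Comparison with k ^ (5 ^ k)

private
  -- For k = 3 this would read 180 ≤ 125; hence the threshold 4.
  linear<5^ : ∀ j → 72 + 36 * (4 + j) ≤ 5 ^ (4 + j)
  linear<5^ zero    = ≤ᵇ⇒≤ _ _ tt
  linear<5^ (suc j) = ≤-trans (≤-reflexive (trans (cong (72 +_) (trans (cong (36 *_) (+-suc 4 j)) (*-suc 36 (4 + j))))
      (trans (sym (+-assoc 72 36 _)) (trans (cong (_+ 36 * (4 + j)) (+-comm 72 36)) (+-assoc 36 72 _)))))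
    (≤-trans (+-mono-≤ (≤-trans (≤-trans (≤ᵇ⇒≤ 36 72 tt) (m≤m+n 72 _)) (linear<5^ j)) (≤-trans (linear<5^ j) (m≤m+n _ _)))
      (≤-reflexive (cong (5 ^_) (sym (+-suc 4 j)))))

  module Large (k : ℕ) (4≤k : 4 ≤ k) where

    Y A Z : ℕ
    Y = (k * (k * 3)) ^ k
    A = k * (k * (k * (k * k))) * Y
    Z = suc (suc (k + bound k))

    1≤k : 1 ≤ k
    1≤k = ≤-trans (s≤s z≤n) 4≤k

    2≤k : 2 ≤ k
    2≤k = ≤-trans (s≤s (s≤s z≤n)) 4≤k

    3≤k : 3 ≤ k
    3≤k = ≤-trans (s≤s (s≤s (s≤s z≤n))) 4≤k

    instance
      k≢0 : NonZero k
      k≢0 = >-nonZero 1≤k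

    Y≤ : Y ≤ k ^ (3 * k)
    Y≤ = ≤-trans (^-monoˡ-≤ k (*-monoʳ-≤ k (*-monoʳ-≤ k (≤-trans 3≤k (≤-reflexive (sym (*-identityʳ k)))))))
      (≤-reflexive (^-*-assoc k 3 k))

    1≤Y : 1 ≤ Y
    1≤Y = ≤-trans (≤-reflexive (sym (^-zeroˡ k))) (^-monoˡ-≤ k (*-mono-≤ 1≤k (*-mono-≤ 1≤k (s≤s {n = 2} z≤n))))

    k≤A : k ≤ A
    k≤A = ≤-trans (≤-reflexive (trans (sym (*-identityʳ k)) (sym (*-identityʳ (k * 1)))))
      (*-mono-≤ (*-monoʳ-≤ k (*-mono-≤ 1≤k (*-mono-≤ 1≤k (*-mono-≤ 1≤k 1≤k)))) 1≤Y)

    bound≤ : bound k ≤ A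
    bound≤ = ≤-trans (*-mono-≤ (*-monoˡ-≤ (k * 1) (*-monoˡ-≤ (k * Y) sk≤)) 2≤k)
      (≤-reflexive (solve 2 (λ k t → k :* k :* (k :* t) :* (k :* con 1) :* k := k :* (k :* (k :* (k :* k))) :* t) refl k Y))
      where
      open import Data.Nat.Solver using (module +-*-Solver)
      open +-*-Solver
      sk≤ : suc k ≤ k * k
      sk≤ = ≤-trans (+-monoˡ-≤ k 1≤k) (≤-trans (≤-reflexive (cong (k +_) (sym (+-identityʳ k)))) (*-monoˡ-≤ k 2≤k))

    -- `Z` is at most 3A, and a further factor k pays for the 3; `A` is k⁵ times `Y`, which is at
    -- most `k ^ (3 * k)`.
    Z≤ : Z ≤ k ^ (6 + 3 * k)
    Z≤ = ≤-trans (+-mono-≤ (≤-trans 2≤k k≤A) (+-mono-≤ k≤A bound≤))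
      (≤-trans (≤-reflexive (cong (λ z → A + (A + z)) (sym (+-identityʳ A)))) (≤-trans (*-monoˡ-≤ A 3≤k)
      (≤-trans (≤-reflexive (solve 2 (λ k t → k :* (k :* (k :* (k :* (k :* k))) :* t) := (k :* (k :* (k :* (k :* (k :* (k :* con 1)))))) :* t) refl k Y))
      (≤-trans (*-monoʳ-≤ (k ^ 6) Y≤) (≤-reflexive (sym (^-distribˡ-+-* k 6 (3 * k))))))))
      where
      open import Data.Nat.Solver using (module +-*-Solver)
      open +-*-Solver

    _⊛_ : ∀ {x y a b} → x ≤ k ^ a → y ≤ k ^ b → x * y ≤ k ^ (a + b)
    _⊛_ {a = a} {b} l l′ = ≤-trans (*-mono-≤ l l′) (≤-reflexive (sym (^-distribˡ-+-* k a b)))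

    -- The exponent is quadratic in `W` and `W` is linear in `Q`, the sixth power of `Z`. So twelve
    -- factors `Z` arise, and 12 (6 + 3k) = 72 + 36k.
    square≤ : TimeBound.Q k * TimeBound.Q k ≤ k ^ (5 ^ k)
    square≤ = ≤-trans (_⊛_ {a = q} {q} cube cube) (^-monoʳ-≤ k (≤-trans (≤-reflexive (twelve k))
      (subst (λ k → 72 + 36 * k ≤ 5 ^ k) (m+[n∸m]≡n 4≤k) (linear<5^ (k ∸ 4)))))
      where
      open import Data.Nat.Solver using (module +-*-Solver)
      open +-*-Solver
      e q : ℕ
      e = 6 + 3 * k
      q = (e + e) + ((e + e) + (e + e))
      twelve : ∀ k → let e = 6 + 3 * k ; q = (e + e) + ((e + e) + (e + e)) in q + q ≡ 72 + 36 * k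
      twelve = solve 1 (λ k →
        let e = con 6 :+ con 3 :* k ; q = (e :+ e) :+ ((e :+ e) :+ (e :+ e)) in q :+ q := con 72 :+ con 36 :* k) refl
      two : Z * Z ≤ k ^ (e + e)
      two = _⊛_ {a = e} {e} Z≤ Z≤
      cube : TimeBound.Q k ≤ k ^ q
      cube = _⊛_ {a = e + e} {(e + e) + (e + e)} two (_⊛_ {a = e + e} {e + e} two two)

-- The coefficients are variables here, lest numerals be unfolded.
module Demand (a c : ℕ) where

  demand : ℕ → ℕ
  demand k = a * ((c * TimeBound.Q k) * (c * TimeBound.Q k))

  abstract
    -- The values for k below 4 are absorbed by the constant, since the power of k is at least 1.
    factor : ℕ
    factor = (demand 1 + (demand 2 + demand 3)) + a * (c * c)

    small : ∀ k {x} → 1 ≤ k → x ≤ factor → x ≤ factor * k ^ (5 ^ k)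
    small k 1≤k l = ≤-trans l (m≤m*n factor (k ^ (5 ^ k)) {{>-nonZero (m^n>0 k {{>-nonZero 1≤k}} (5 ^ k))}})

    demand≤ : ∀ k → 1 ≤ k → demand k ≤ factor * k ^ (5 ^ k)
    demand≤ k 1≤k with k ≟ 1 | k ≟ 2 | k ≟ 3
    ... | yes e | _ | _ = small k 1≤k (≤-trans (≤-reflexive (cong demand e)) (summand₁ (demand 1) (demand 2) (demand 3) (a * (c * c))))
      where
      summand₁ : ∀ w x y z → w ≤ (w + (x + y)) + z
      summand₁ w x y z = ≤-trans (m≤m+n w (x + y)) (m≤m+n _ z)
    ... | _ | yes e | _ = small k 1≤k (≤-trans (≤-reflexive (cong demand e)) (summand₂ (demand 1) (demand 2) (demand 3) (a * (c * c))))
      where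
      summand₂ : ∀ w x y z → x ≤ (w + (x + y)) + z
      summand₂ w x y z = ≤-trans (m≤m+n x y) (≤-trans (m≤n+m _ w) (m≤m+n _ z))
    ... | _ | _ | yes e = small k 1≤k (≤-trans (≤-reflexive (cong demand e)) (summand₃ (demand 1) (demand 2) (demand 3) (a * (c * c))))
      where
      summand₃ : ∀ w x y z → y ≤ (w + (x + y)) + z
      summand₃ w x y z = ≤-trans (m≤n+m y x) (≤-trans (m≤n+m _ w) (m≤m+n _ z))
    ... | no n₁ | no n₂ | no n₃ = ≤-trans (≤-reflexive (regroup a c (TimeBound.Q k)))
      (*-mono-≤ (m≤n+m (a * (c * c)) (demand 1 + (demand 2 + demand 3)))
        (Large.square≤ k (≤∧≢⇒< (≤∧≢⇒< (≤∧≢⇒< 1≤k (≢-sym n₁)) (≢-sym n₂)) (≢-sym n₃))))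
      where
      open import Data.Nat.Solver using (module +-*-Solver)
      open +-*-Solver
      regroup : ∀ a c q → a * ((c * q) * (c * q)) ≡ (a * (c * c)) * (q * q)
      regroup = solve 3 (λ a c q → a :* ((c :* q) :* (c :* q)) := (a :* (c :* c)) :* (q :* q)) refl

-- Assembling the result

if≡true : ∀ {v} → (if v ≡ᵇ 0 then false else true) ≡ true ⇔ v ≢ 0
if≡true {zero}  = mk⇔ (λ ()) (λ p → contradiction refl p)
if≡true {suc v} = mk⇔ (λ _ ()) (λ _ → refl)

accept-run : ∀ {t c} → Config.counter c ≡ 0 → 1 ≤ t → run (accept ∷ []) t c ≡ just true
accept-run {c = ⟨ 0 , M ⟩} refl (s≤s l) = refl

theorem1 : Σ[ C ∈ ℕ ] ((k : ℕ) →
    Σ[ p ∈ Program ] ((n : ℕ) (G : Graph n) (pairs : Vec (Fin n × Fin n) k) →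
    Σ[ b ∈ Bool ]
    (p on encode G pairs answers b within ((2 ⊔ n) ^ (C * (k ^ (5 ^ k))))) ×
    (b ≡ true ⇔ HasDisjointShortestPaths G pairs)))
theorem1 = Demand.factor 94 61481 , λ
  -- Without pairs the power `0 ^ (5 ^ 0)` vanishes and the time allowed is a single instruction,
  -- just enough for `accept`.
  { zero → (accept ∷ []) , λ n G pairs → true ,
      accept-run refl (m^n>0 (2 ⊔ n) {{Costs.N≢0 n}} (Demand.factor 94 61481 * (0 ^ (5 ^ 0)))) ,
      mk⇔ (λ _ → (λ ()) , (λ ()) , λ ()) (λ _ → refl)
  ; k@(suc k′) → Algorithm.M.program k , λ n G pairs →
      -- The first source witnesses that the graph has a vertex, as the memory layout requires.
      let 1≤n = ≤-trans (s≤s z≤n) (Fin.toℕ<n (proj₁ (lookup pairs zero)))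
          h , (edges , blank) , finish = Algorithm.M.answers k 1≤n G pairs
      in _ ,
        finish _ (≤-trans (TimeBound.time≤ k n) (^-monoʳ-≤ (2 ⊔ n) {{Costs.N≢0 n}} (≤-trans (TimeBound.exponent≤ k)
          (≤-trans (*-monoʳ-≤ 94 (*-mono-≤ (TimeBound.W≤ k) (TimeBound.W≤ k))) (Demand.demand≤ 94 61481 k (s≤s z≤n)))))) ,
        (if≡true ∙ Algorithm.Correctness.correct k (s≤s z≤n) 1≤n G pairs _ h edges blank) }
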